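{- There is an absolute constant $c>0$ such that the following holds. For every $\varepsilon>0$ there is $n_0=n_0(\varepsilon)$ such that for every $n\ge n_0$ and every $d$-regular $n$-vertex graph $F$ with $d\le(1-\varepsilon)n$, every 2-coloring $f:E(K_n)\to\{\pm1\}$ admits a copy of $F$ in $K_n$ with discrepancy at least $c\sqrt{\varepsilon d}\,n$.
   Context: For a coloring $f:E(K_n)\to\{\pm1\}$ and a subgraph $F_0\subseteq K_n$, the discrepancy of $F_0$ is $\left|\sum_{e\in E(F_0)}f(e)\right|$. A copy of $F$ in $K_n$ is a subgraph of $K_n$ isomorphic to $F$. -}

module Defs where

open import Data.Bool using (Bool; true; false; if_then_else_)
open import Data.Empty using (⊥-elim)
open import Data.Fin using (Fin)
import Data.Fin as Fin
open import Data.Fin.Permutation using (Permutation′; _⟨$⟩ʳ_)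
open import Data.Fin.Subset using (Subset) renaming (∣_∣ to card)
open import Data.Integer using (ℤ; +_; 0ℤ; _◃_)
import Data.Integer as ℤ
import Data.Integer.Properties as ℤ
open import Data.Nat using (ℕ; zero; suc)
import Data.Nat as ℕ
import Data.Nat.Properties as ℕ
open import Data.Product using (∃; ∃₂; _×_; _,_; proj₁; proj₂)
open import Data.Rational
open import Data.Rational.Properties
open import Data.Rational.Solver using (module +-*-Solver)
import Data.Rational.Unnormalised as ℚᵘ
import Data.Rational.Unnormalised.Properties as ℚᵘ
open import Data.Sign using (Sign)
open import Data.Sum using (_⊎_; inj₁; inj₂)
open import Data.Vec using (tabulate)
open import Relation.Binary using (tri<; tri≈; tri>)
open import Relation.Binary.PropositionalEquality
  using (_≡_; refl; sym; trans; cong; subst; subst₂)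
open import Relation.Nullary using (¬_; Dec; yes; no)
open import Algebra.Properties.CommutativeMonoid.Sum ℤ.+-0-commutativeMonoid
  using (sum-syntax)

open +-*-Solver

module RationalLemmas where
  0<q-p : ∀ {p q} → p < q → 0ℚ < q - p
  0<q-p {p} {q} p<q = subst (_< q - p) (+-inverseʳ p) (+-monoˡ-< (- p) p<q)

  0≤q-p : ∀ {p q} → p ≤ q → 0ℚ ≤ q - p
  0≤q-p {p} {q} p≤q = subst (_≤ q - p) (+-inverseʳ p) (+-monoˡ-≤ (- p) p≤q)

  q-p+p : ∀ p q → (q - p) + p ≡ q
  q-p+p = solve 2 (λ p q → (q :- p) :+ p := q) refl

  0<q-p⁻¹ : ∀ {p q} → 0ℚ < q - p → p < q
  0<q-p⁻¹ {p} {q} h = subst₂ _<_ (+-identityˡ p) (q-p+p p q) (+-monoˡ-< p h)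

  0≤q-p⁻¹ : ∀ {p q} → 0ℚ ≤ q - p → p ≤ q
  0≤q-p⁻¹ {p} {q} h = subst₂ _≤_ (+-identityˡ p) (q-p+p p q) (+-monoˡ-≤ p h)

  0≤+ : ∀ {p q} → 0ℚ ≤ p → 0ℚ ≤ q → 0ℚ ≤ p + q
  0≤+ = +-mono-≤

  0<+ : ∀ {p q} → 0ℚ < p → 0ℚ ≤ q → 0ℚ < p + q
  0<+ = +-mono-<-≤

  0≤* : ∀ {p q} → 0ℚ ≤ p → 0ℚ ≤ q → 0ℚ ≤ p * q
  0≤* {p} {q} 0≤p 0≤q =
    nonNegative⁻¹ (p * q)
      {{nonNeg*nonNeg⇒nonNeg p {{nonNegative 0≤p}} q {{nonNegative 0≤q}}}}

  0<* : ∀ {p q} → 0ℚ < p → 0ℚ < q → 0ℚ < p * q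
  0<* {p} {q} 0<p 0<q =
    positive⁻¹ (p * q) {{pos*pos⇒pos p {{positive 0<p}} q {{positive 0<q}}}}

  0<½ : 0ℚ < ½
  0<½ = positive⁻¹ ½

  0<1 : 0ℚ < 1ℚ
  0<1 = positive⁻¹ 1ℚ

  halves : ∀ p → ½ * p + ½ * p ≡ p
  halves = solve 1 (λ p → con ½ :* p :+ con ½ :* p := p) refl

  p<p+q : ∀ p {q} → 0ℚ < q → p < p + q
  p<p+q p {q} 0<q = subst (_< p + q) (+-identityʳ p) (+-monoʳ-< p 0<q)

  p-1<p : ∀ p → p - 1ℚ < p
  p-1<p p =
    0<q-p⁻¹ (subst (0ℚ <_) (solve 1 (λ p → con 1ℚ := p :- (p :- con 1ℚ)) refl p) 0<1)

  p≤∣p∣ : ∀ p → p ≤ ∣ p ∣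
  p≤∣p∣ p with ≤-total 0ℚ p
  ... | inj₁ 0≤p = ≤-reflexive (sym (0≤p⇒∣p∣≡p 0≤p))
  ... | inj₂ p≤0 = ≤-trans p≤0 (0≤∣p∣ p)

  -∣p∣≤p : ∀ p → - ∣ p ∣ ≤ p
  -∣p∣≤p p =
    subst₂ _≤_ (cong -_ (∣-p∣≡∣p∣ p)) (solve 1 (λ p → :- (:- p) := p) refl p)
      (neg-antimono-≤ (p≤∣p∣ (- p)))

  between-lower : ∀ {p x y} → p < x → p < y → ∃ λ q → p < q × q < x × q < y
  between-lower {p} {x} {y} p<x p<y with ≤-total x y
  ... | inj₁ x≤y = let q , p<q , q<x = <-dense p<x in q , p<q , q<x , <-≤-trans q<x x≤y
  ... | inj₂ y≤x = let q , p<q , q<y = <-dense p<y in q , p<q , <-≤-trans q<y y≤x , q<y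

  between-upper : ∀ {p x y} → x < p → y < p → ∃ λ q → q < p × x < q × y < q
  between-upper {p} {x} {y} x<p y<p with ≤-total x y
  ... | inj₁ x≤y = let q , y<q , q<p = <-dense y<p in q , q<p , ≤-<-trans x≤y y<q , y<q
  ... | inj₂ y≤x = let q , x<q , q<p = <-dense x<p in q , q<p , x<q , ≤-<-trans y≤x x<q

  square-mono-< : ∀ {p q} → 0ℚ ≤ p → p < q → p * p < q * q
  square-mono-< {p} {q} 0≤p p<q =
    ≤-<-trans
      (*-monoˡ-≤-nonNeg p {{nonNegative 0≤p}} (<⇒≤ p<q))
      (*-monoˡ-<-pos q {{positive (≤-<-trans 0≤p p<q)}} p<q)

  times : ℕ → ℚ → ℚ
  times zero    h = 0ℚ
  times (suc k) h = h + times k h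

  times-toℚᵘ : ∀ k h → toℚᵘ (times k h) ℚᵘ.≃ ℚᵘ.mkℚᵘ (+ k) 0 ℚᵘ.* toℚᵘ h
  times-toℚᵘ zero    h = ℚᵘ.≃-sym (ℚᵘ.*-zeroˡ (toℚᵘ h))
  times-toℚᵘ (suc k) h = begin
    toℚᵘ (h + times k h)                    ≈⟨ toℚᵘ-homo-+ h (times k h) ⟩
    toℚᵘ h ℚᵘ.+ toℚᵘ (times k h)            ≈⟨ ℚᵘ.+-congʳ (toℚᵘ h) (times-toℚᵘ k h) ⟩
    toℚᵘ h ℚᵘ.+ k′ ℚᵘ.* toℚᵘ h              ≈⟨ ℚᵘ.+-congˡ (k′ ℚᵘ.* toℚᵘ h) (ℚᵘ.≃-sym (ℚᵘ.*-identityˡ (toℚᵘ h))) ⟩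
    ℚᵘ.1ℚᵘ ℚᵘ.* toℚᵘ h ℚᵘ.+ k′ ℚᵘ.* toℚᵘ h  ≈⟨ ℚᵘ.≃-sym (ℚᵘ.*-distribʳ-+ (toℚᵘ h) ℚᵘ.1ℚᵘ k′) ⟩
    (ℚᵘ.1ℚᵘ ℚᵘ.+ k′) ℚᵘ.* toℚᵘ h            ≈⟨ ℚᵘ.*-congʳ {toℚᵘ h} 1+k′≃ ⟩
    ℚᵘ.mkℚᵘ (+ suc k) 0 ℚᵘ.* toℚᵘ h         ∎
    where
    open ℚᵘ.≃-Reasoning
    k′ = ℚᵘ.mkℚᵘ (+ k) 0
    1+k′≃ : ℚᵘ.1ℚᵘ ℚᵘ.+ k′ ℚᵘ.≃ ℚᵘ.mkℚᵘ (+ suc k) 0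
    1+k′≃ = ℚᵘ.*≡* (cong (λ z → (+ 1 ℤ.+ z) ℤ.* + 1) (ℤ.*-identityʳ (+ k)))

  archimedean : ∀ r {h} → 0ℚ < h → ∃ λ k → r ≤ times k h
  archimedean r@(mkℚ n a _) {h@(mkℚ (+ suc m) b _)} 0<h =
    k , toℚᵘ-cancel-≤ (ℚᵘ.≤-respʳ-≃ (ℚᵘ.≃-sym (times-toℚᵘ k h)) (ℚᵘ.*≤* bound))
    where
    k = ℤ.∣ n ∣ ℕ.* suc b
    n≤∣n∣ : ∀ n → n ℤ.≤ + ℤ.∣ n ∣
    n≤∣n∣ (+ n)      = ℤ.≤-refl
    n≤∣n∣ ℤ.-[1+ n ] = ℤ.-≤+
    bound : n ℤ.* (+ 1 ℤ.* + suc b) ℤ.≤ (+ k ℤ.* + suc m) ℤ.* + suc a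
    bound = ℤ.≤-trans
      (ℤ.*-monoʳ-≤-nonNeg (+ 1 ℤ.* + suc b) (n≤∣n∣ n))
      (subst₂ ℤ._≤_
        (trans (ℤ.pos-* ℤ.∣ n ∣ (suc b)) (cong (+ ℤ.∣ n ∣ ℤ.*_) (sym (ℤ.*-identityˡ (+ suc b)))))
        (trans (ℤ.pos-* (k ℕ.* suc m) (suc a)) (cong (ℤ._* + suc a) (ℤ.pos-* k (suc m))))
        (ℤ.+≤+ (ℕ.≤-trans (ℕ.m≤m*n k (suc m)) (ℕ.m≤m*n (k ℕ.* suc m) (suc a)))))
  archimedean r {mkℚ (+ zero)    b _} (*<* (ℤ.+<+ ()))
  archimedean r {mkℚ ℤ.-[1+ m ] b _} (*<* ())

open RationalLemmas

-- Real numbers: two-sided, located Dedekind cuts of ℚ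

record ℝ : Set₁ where
  field
    lower upper     : ℚ → Set
    lower-inhabited : ∃ lower
    upper-inhabited : ∃ upper
    lower-closed    : ∀ {p q} → p < q → lower q → lower p
    upper-closed    : ∀ {p q} → p < q → upper p → upper q
    lower-open      : ∀ {p} → lower p → ∃ λ q → p < q × lower q
    upper-open      : ∀ {q} → upper q → ∃ λ p → p < q × upper p
    disjoint        : ∀ {q} → lower q → ¬ upper q
    located         : ∀ {p q} → p < q → lower p ⊎ upper q

open ℝ

infix 4 _≤ᴿ_ _<ᴿ_

_≤ᴿ_ : ℝ → ℝ → Set
x ≤ᴿ y = ∀ q → lower x q → lower y q

_<ᴿ_ : ℝ → ℝ → Set
x <ᴿ y = ∃ λ q → upper x q × lower y q

fromℚ : ℚ → ℝ
fromℚ r = record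
  { lower           = _< r
  ; upper           = r <_
  ; lower-inhabited = r - 1ℚ , p-1<p r
  ; upper-inhabited = r + 1ℚ , p<p+q r 0<1
  ; lower-closed    = <-trans
  ; upper-closed    = λ p<q r<p → <-trans r<p p<q
  ; lower-open      = <-dense
  ; upper-open      = λ r<q → let p , r<p , p<q = <-dense r<q in p , p<q , r<p
  ; disjoint        = <-asym
  ; located         = loc
  }
  where
  loc : ∀ {p q} → p < q → p < r ⊎ r < q
  loc {p} p<q with p <? r
  ... | yes p<r = inj₁ p<r
  ... | no  p≮r = inj₂ (≤-<-trans (≮⇒≥ p≮r) p<q)

fromℕ : ℕ → ℝ
fromℕ n = fromℚ (+ n / 1)

0ᴿ 1ᴿ : ℝ
0ᴿ = fromℕ 0
1ᴿ = fromℕ 1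

module CutLemmas where
  lower<upper : ∀ x {a b} → lower x a → upper x b → a < b
  lower<upper x {a} {b} a∈ b∈ with <-cmp a b
  ... | tri< a<b _ _    = a<b
  ... | tri≈ _ refl _   = ⊥-elim (disjoint x a∈ b∈)
  ... | tri> _ _ b<a    = ⊥-elim (disjoint x (lower-closed x b<a a∈) b∈)

  lower-⊔ : ∀ x {p q} → lower x p → lower x q → lower x (p ⊔ q)
  lower-⊔ x {p} {q} p∈ q∈ with ≤-total p q
  ... | inj₁ p≤q = subst (lower x) (sym (p≤q⇒p⊔q≡q p≤q)) q∈
  ... | inj₂ q≤p = subst (lower x) (sym (p≥q⇒p⊔q≡p q≤p)) p∈

  upper-⊓ : ∀ x {p q} → upper x p → upper x q → upper x (p ⊓ q)
  upper-⊓ x {p} {q} p∈ q∈ with ≤-total p q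
  ... | inj₁ p≤q = subst (upper x) (sym (p≤q⇒p⊓q≡p p≤q)) p∈
  ... | inj₂ q≤p = subst (upper x) (sym (p≥q⇒p⊓q≡q q≤p)) q∈

  upper-closed-≤ : ∀ x {p q} → p ≤ q → upper x p → upper x q
  upper-closed-≤ x {p} {q} p≤q p∈ with <-cmp p q
  ... | tri< p<q _ _  = upper-closed x p<q p∈
  ... | tri≈ _ refl _ = p∈
  ... | tri> _ _ q<p  = ⊥-elim (<-irrefl refl (<-≤-trans q<p p≤q))

  approximate : ∀ x {δ} → 0ℚ < δ → ∃ λ a → lower x a × upper x (a + δ)
  approximate x {δ} 0<δ = walk (proj₁ steps) l∈ u′∈
    where
    h = ½ * δ
    0<h = 0<* 0<½ 0<δ
    l = proj₁ (lower-inhabited x)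
    l∈ = proj₂ (lower-inhabited x)
    u = proj₁ (upper-inhabited x)
    steps = archimedean (u - l) 0<h
    u′∈ : upper x (l + times (proj₁ steps) h)
    u′∈ = upper-closed-≤ x
      (subst (_≤ l + times (proj₁ steps) h)
        (solve 2 (λ l u → l :+ (u :- l) := u) refl l u)
        (+-monoʳ-≤ l (proj₂ steps)))
      (proj₂ (upper-inhabited x))
    walk : ∀ k {a} → lower x a → upper x (a + times k h) →
           ∃ λ a → lower x a × upper x (a + δ)
    walk zero {a} a∈ a′∈ = ⊥-elim (disjoint x a∈ (subst (upper x) (+-identityʳ a) a′∈))
    walk (suc k) {a} a∈ a′∈ with located x (p<p+q (a + h) 0<h)
    ... | inj₁ a+h∈  = walk k a+h∈ (subst (upper x) (sym (+-assoc a h (times k h))) a′∈)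
    ... | inj₂ a+2h∈ =
      a , a∈ , subst (upper x) (trans (+-assoc a h h) (cong (_+_ a) (halves δ))) a+2h∈

open CutLemmas

-- Real arithmetic.  A rational lies strictly below (above) x ∘ y when it lies
-- strictly below (above) every value of ∘ on some box [a , b] × [c , d] with
-- a < x < b and c < y < d; it suffices to look at the corners of the box.

infixl 6 _-ᴿ_
infixl 7 _*ᴿ_

_-ᴿ_ : ℝ → ℝ → ℝ
x -ᴿ y = record
  { lower           = Lower
  ; upper           = Upper
  ; lower-inhabited = lowers (lower-inhabited x) (upper-inhabited y)
  ; upper-inhabited = uppers (upper-inhabited x) (lower-inhabited y)
  ; lower-closed    = λ { p<q (a , d , a∈ , d∈ , q<) → a , d , a∈ , d∈ , <-trans p<q q< }
  ; upper-closed    = λ { p<q (b , c , b∈ , c∈ , <p) → b , c , b∈ , c∈ , <-trans <p p<q }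
  ; lower-open      = λ { (a , d , a∈ , d∈ , p<) →
                          let q , p<q , q< = <-dense p< in q , p<q , a , d , a∈ , d∈ , q< }
  ; upper-open      = λ { (b , c , b∈ , c∈ , <q) →
                          let p , <p , p<q = <-dense <q in p , p<q , b , c , b∈ , c∈ , <p }
  ; disjoint        = λ { (a , d , a∈ , d∈ , q<) (b , c , b∈ , c∈ , <q) →
                          <-asym (<-trans <q q<)
                            (+-mono-< (lower<upper x a∈ b∈)
                                      (neg-antimono-< (lower<upper y c∈ d∈))) }
  ; located         = loc
  }
  where
  Lower Upper : ℚ → Set
  Lower q = ∃₂ λ a d → lower x a × upper y d × q < a - d
  Upper q = ∃₂ λ b c → upper x b × lower y c × b - c < q

  lowers : ∃ (lower x) → ∃ (upper y) → ∃ Lower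
  lowers (a , a∈) (d , d∈) = a - d - 1ℚ , a , d , a∈ , d∈ , p-1<p (a - d)

  uppers : ∃ (upper x) → ∃ (lower y) → ∃ Upper
  uppers (b , b∈) (c , c∈) = b - c + 1ℚ , b , c , b∈ , c∈ , p<p+q (b - c) 0<1

  loc : ∀ {p q} → p < q → Lower p ⊎ Upper q
  loc {p} {q} p<q =
    let m , p<m , m<q = <-dense p<q
        0<h           = 0<* 0<½ (0<q-p p<m)
        a , a∈ , b∈   = approximate x 0<h
        c , c∈ , d∈   = approximate y 0<h
    in decide m (½ * (m - p)) a c (halves (m - p)) m<q a∈ b∈ c∈ d∈
    where
    decide : ∀ m h a c → h + h ≡ m - p → m < q →
             lower x a → upper x (a + h) → lower y c → upper y (c + h) →
             Lower p ⊎ Upper q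
    decide m h a c h+h≡ m<q a∈ b∈ c∈ d∈ with p <? a - (c + h)
    ... | yes p<a-d = inj₁ (a , c + h , a∈ , d∈ , p<a-d)
    ... | no  p≮a-d = inj₂ (a + h , c , b∈ , c∈ , ≤-<-trans b-c≤m m<q)
      where
      b-c≤m : a + h - c ≤ m
      b-c≤m = subst₂ _≤_
        (solve 3 (λ a c h → a :- (c :+ h) :+ (h :+ h) := a :+ h :- c) refl a c h)
        (trans (cong (_+_ p) h+h≡) (solve 2 (λ p m → p :+ (m :- p) := m) refl p m))
        (+-monoˡ-≤ (h + h) (≮⇒≥ p≮a-d))

module ProductLemmas where
  affine-lower : ∀ {q a b p} c → a ≤ p → p ≤ b → q < a * c → q < b * c → q < p * c
  affine-lower c a≤p p≤b q<ac q<bc with ≤-total 0ℚ c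
  ... | inj₁ 0≤c = <-≤-trans q<ac (*-monoʳ-≤-nonNeg c {{nonNegative 0≤c}} a≤p)
  ... | inj₂ c≤0 = <-≤-trans q<bc (*-monoʳ-≤-nonPos c {{nonPositive c≤0}} p≤b)

  affine-upper : ∀ {q a b p} c → a ≤ p → p ≤ b → a * c < q → b * c < q → p * c < q
  affine-upper c a≤p p≤b ac<q bc<q with ≤-total 0ℚ c
  ... | inj₁ 0≤c = ≤-<-trans (*-monoʳ-≤-nonNeg c {{nonNegative 0≤c}} p≤b) bc<q
  ... | inj₂ c≤0 = ≤-<-trans (*-monoʳ-≤-nonPos c {{nonPositive c≤0}} a≤p) ac<q

  swap-< : ∀ {q} x y → q < x * y → q < y * x
  swap-< {q} x y = subst (q <_) (*-comm x y)

  swap-> : ∀ {q} x y → x * y < q → y * x < q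
  swap-> {q} x y = subst (_< q) (*-comm x y)

  box-lower : ∀ {q a b c d p r} → a ≤ p → p ≤ b → c ≤ r → r ≤ d →
              q < a * c → q < a * d → q < b * c → q < b * d → q < p * r
  box-lower {q} {a} {b} {c} {d} {p} {r} a≤p p≤b c≤r r≤d ac ad bc bd =
    swap-< r p (affine-lower p c≤r r≤d
      (swap-< p c (affine-lower c a≤p p≤b ac bc))
      (swap-< p d (affine-lower d a≤p p≤b ad bd)))

  box-upper : ∀ {q a b c d p r} → a ≤ p → p ≤ b → c ≤ r → r ≤ d →
              a * c < q → a * d < q → b * c < q → b * d < q → p * r < q
  box-upper {q} {a} {b} {c} {d} {p} {r} a≤p p≤b c≤r r≤d ac ad bc bd =
    swap-> r p (affine-upper p c≤r r≤d
      (swap-> p c (affine-upper c a≤p p≤b ac bc))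
      (swap-> p d (affine-upper d a≤p p≤b ad bd)))

  scaled-upper : ∀ {s δ K c} → 0ℚ ≤ s → s ≤ δ → 0ℚ ≤ K → c ≤ K → s * c ≤ K * δ
  scaled-upper {s} {δ} {K} {c} 0≤s s≤δ 0≤K c≤K =
    ≤-trans (*-monoˡ-≤-nonNeg s {{nonNegative 0≤s}} c≤K)
      (subst (_≤ K * δ) (*-comm K s) (*-monoˡ-≤-nonNeg K {{nonNegative 0≤K}} s≤δ))

  scaled-lower : ∀ {s δ K c} → 0ℚ ≤ s → s ≤ δ → 0ℚ ≤ K → - K ≤ c → - (K * δ) ≤ s * c
  scaled-lower {s} {δ} {K} {c} 0≤s s≤δ 0≤K -K≤c =
    subst (- (K * δ) ≤_) (solve 2 (λ s c → :- (s :* (:- c)) := s :* c) refl s c)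
      (neg-antimono-≤ (scaled-upper 0≤s s≤δ 0≤K
        (subst (- c ≤_) (solve 1 (λ K → :- (:- K) := K) refl K) (neg-antimono-≤ -K≤c))))

  corner-upper : ∀ {a a′ c c′ δ K} → 0ℚ ≤ K →
                 a ≤ a′ → a′ - a ≤ δ → c ≤ c′ → c′ - c ≤ δ → c ≤ K → a′ ≤ K →
                 a′ * c′ ≤ a * c + (K * δ + K * δ)
  corner-upper {a} {a′} {c} {c′} {δ} {K} 0≤K a≤ a-δ c≤ c-δ c≤K a′≤K =
    subst (_≤ a * c + (K * δ + K * δ))
      (solve 4 (λ a a′ c c′ → a :* c :+ ((a′ :- a) :* c :+ (c′ :- c) :* a′) := a′ :* c′)
        refl a a′ c c′)
      (+-monoʳ-≤ (a * c) (+-mono-≤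
        (scaled-upper (0≤q-p a≤) a-δ 0≤K c≤K)
        (scaled-upper (0≤q-p c≤) c-δ 0≤K a′≤K)))

  corner-lower : ∀ {a a′ c c′ δ K} → 0ℚ ≤ K →
                 a ≤ a′ → a′ - a ≤ δ → c ≤ c′ → c′ - c ≤ δ → - K ≤ c → - K ≤ a′ →
                 a * c - (K * δ + K * δ) ≤ a′ * c′
  corner-lower {a} {a′} {c} {c′} {δ} {K} 0≤K a≤ a-δ c≤ c-δ -K≤c -K≤a′ =
    subst₂ _≤_
      (cong (_+_ (a * c)) (sym (neg-distrib-+ (K * δ) (K * δ))))
      (solve 4 (λ a a′ c c′ → a :* c :+ ((a′ :- a) :* c :+ (c′ :- c) :* a′) := a′ :* c′)
        refl a a′ c c′)
      (+-monoʳ-≤ (a * c) (+-mono-≤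
        (scaled-lower (0≤q-p a≤) a-δ 0≤K -K≤c)
        (scaled-lower (0≤q-p c≤) c-δ 0≤K -K≤a′)))

  record Enclosure (x : ℝ) (δ K : ℚ) : Set where
    field
      a b   : ℚ
      a∈    : lower x a
      b∈    : upper x b
      a≤b   : a ≤ b
      b-a≤δ : b - a ≤ δ
      -K≤a  : - K ≤ a
      b≤K   : b ≤ K

  enclose : ∀ x {δ K a₀ b₀} → 0ℚ < δ → lower x a₀ → upper x b₀ →
            - K ≤ a₀ → b₀ ≤ K → Enclosure x δ K
  enclose x {δ} {K} {a₀} {b₀} 0<δ a₀∈ b₀∈ -K≤a₀ b₀≤K =
    let a₁ , a₁∈ , b₁∈ = approximate x 0<δ in record
    { a     = a₁ ⊔ a₀
    ; b     = (a₁ + δ) ⊓ b₀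
    ; a∈    = lower-⊔ x a₁∈ a₀∈
    ; b∈    = upper-⊓ x b₁∈ b₀∈
    ; a≤b   = <⇒≤ (lower<upper x (lower-⊔ x a₁∈ a₀∈) (upper-⊓ x b₁∈ b₀∈))
    ; b-a≤δ = subst ((a₁ + δ) ⊓ b₀ - (a₁ ⊔ a₀) ≤_)
                (solve 2 (λ a δ → a :+ δ :- a := δ) refl a₁ δ)
                (+-mono-≤ (p⊓q≤p (a₁ + δ) b₀) (neg-antimono-≤ (p≤p⊔q a₁ a₀)))
    ; -K≤a  = ≤-trans -K≤a₀ (p≤q⊔p a₁ a₀)
    ; b≤K   = ≤-trans (p⊓q≤q (a₁ + δ) b₀) b₀≤K
    }

open ProductLemmas

_*ᴿ_ : ℝ → ℝ → ℝ
x *ᴿ y = record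
  { lower           = Lower
  ; upper           = Upper
  ; lower-inhabited = lowers
  ; upper-inhabited = uppers
  ; lower-closed    = λ { p<q (a , b , c , d , a∈ , b∈ , c∈ , d∈ , ac , ad , bc , bd) →
      a , b , c , d , a∈ , b∈ , c∈ , d∈ ,
      <-trans p<q ac , <-trans p<q ad , <-trans p<q bc , <-trans p<q bd }
  ; upper-closed    = λ { p<q (a , b , c , d , a∈ , b∈ , c∈ , d∈ , ac , ad , bc , bd) →
      a , b , c , d , a∈ , b∈ , c∈ , d∈ ,
      <-trans ac p<q , <-trans ad p<q , <-trans bc p<q , <-trans bd p<q }
  ; lower-open      = λ { (a , b , c , d , a∈ , b∈ , c∈ , d∈ , ac , ad , bc , bd) →
      let m , p<m , m<ac , m<ad = between-lower ac ad
          n , p<n , n<bc , n<bd = between-lower bc bd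
          q , p<q , q<m , q<n   = between-lower p<m p<n
      in q , p<q , a , b , c , d , a∈ , b∈ , c∈ , d∈ ,
         <-trans q<m m<ac , <-trans q<m m<ad , <-trans q<n n<bc , <-trans q<n n<bd }
  ; upper-open      = λ { (a , b , c , d , a∈ , b∈ , c∈ , d∈ , ac , ad , bc , bd) →
      let m , m<q , ac<m , ad<m = between-upper ac ad
          n , n<q , bc<n , bd<n = between-upper bc bd
          p , p<q , m<p , n<p   = between-upper m<q n<q
      in p , p<q , a , b , c , d , a∈ , b∈ , c∈ , d∈ ,
         <-trans ac<m m<p , <-trans ad<m m<p , <-trans bc<n n<p , <-trans bd<n n<p }
  ; disjoint        = disj
  ; located         = loc
  }
  where
  Lower Upper : ℚ → Set
  Lower q = ∃₂ λ a b → ∃₂ λ c d →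
    lower x a × upper x b × lower y c × upper y d ×
    q < a * c × q < a * d × q < b * c × q < b * d
  Upper q = ∃₂ λ a b → ∃₂ λ c d →
    lower x a × upper x b × lower y c × upper y d ×
    a * c < q × a * d < q × b * c < q × b * d < q

  a₀ = proj₁ (lower-inhabited x)
  b₀ = proj₁ (upper-inhabited x)
  c₀ = proj₁ (lower-inhabited y)
  d₀ = proj₁ (upper-inhabited y)
  a₀∈ = proj₂ (lower-inhabited x)
  b₀∈ = proj₂ (upper-inhabited x)
  c₀∈ = proj₂ (lower-inhabited y)
  d₀∈ = proj₂ (upper-inhabited y)

  lowers : ∃ Lower
  lowers =
    let m , m< , ac , ad = beneath (a₀ * c₀) (a₀ * d₀)
        n , n< , bc , bd = beneath (b₀ * c₀) (b₀ * d₀)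
        q , _ , q<m , q<n = beneath m n
    in q , a₀ , b₀ , c₀ , d₀ , a₀∈ , b₀∈ , c₀∈ , d₀∈ ,
       <-trans q<m ac , <-trans q<m ad , <-trans q<n bc , <-trans q<n bd
    where
    beneath : ∀ u v → ∃ λ q → q < u ⊓ v × q < u × q < v
    beneath u v = u ⊓ v - 1ℚ , p-1<p (u ⊓ v) ,
      <-≤-trans (p-1<p (u ⊓ v)) (p⊓q≤p u v) , <-≤-trans (p-1<p (u ⊓ v)) (p⊓q≤q u v)

  uppers : ∃ Upper
  uppers =
    let m , m< , ac , ad = above (a₀ * c₀) (a₀ * d₀)
        n , n< , bc , bd = above (b₀ * c₀) (b₀ * d₀)
        q , _ , m<q , n<q = above m n
    in q , a₀ , b₀ , c₀ , d₀ , a₀∈ , b₀∈ , c₀∈ , d₀∈ ,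
       <-trans ac m<q , <-trans ad m<q , <-trans bc n<q , <-trans bd n<q
    where
    above : ∀ u v → ∃ λ q → u ⊔ v < q × u < q × v < q
    above u v = u ⊔ v + 1ℚ , p<p+q (u ⊔ v) 0<1 ,
      ≤-<-trans (p≤p⊔q u v) (p<p+q (u ⊔ v) 0<1) , ≤-<-trans (p≤q⊔p u v) (p<p+q (u ⊔ v) 0<1)

  disj : ∀ {q} → Lower q → ¬ Upper q
  disj (a , b , c , d , a∈ , b∈ , c∈ , d∈ , ac , ad , bc , bd)
       (a′ , b′ , c′ , d′ , a′∈ , b′∈ , c′∈ , d′∈ , ac′ , ad′ , bc′ , bd′) =
    <-asym
      (box-lower (p≤p⊔q a a′) (below x p∈ b∈) (p≤p⊔q c c′) (below y r∈ d∈) ac ad bc bd)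
      (box-upper (p≤q⊔p a a′) (below x p∈ b′∈) (p≤q⊔p c c′) (below y r∈ d′∈)
        ac′ ad′ bc′ bd′)
    where
    p∈ = lower-⊔ x a∈ a′∈
    r∈ = lower-⊔ y c∈ c′∈
    below : ∀ z {p q} → lower z p → upper z q → p ≤ q
    below z p∈ q∈ = <⇒≤ (lower<upper z p∈ q∈)

  K = 1ℚ + (∣ a₀ ∣ + ∣ b₀ ∣ + (∣ c₀ ∣ + ∣ d₀ ∣))

  0<K : 0ℚ < K
  0<K = 0<+ 0<1 (0≤+ (0≤+ (0≤∣p∣ a₀) (0≤∣p∣ b₀)) (0≤+ (0≤∣p∣ c₀) (0≤∣p∣ d₀)))

  summand≤ : ∀ {p q r} → 0ℚ ≤ r → r ≡ q - p → p ≤ q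
  summand≤ 0≤r r≡ = 0≤q-p⁻¹ (subst (0ℚ ≤_) r≡ 0≤r)

  0≤1+ : ∀ {p q r} → 0ℚ ≤ p → 0ℚ ≤ q → 0ℚ ≤ r → 0ℚ ≤ 1ℚ + (p + (q + r))
  0≤1+ 0≤p 0≤q 0≤r = 0≤+ (<⇒≤ 0<1) (0≤+ 0≤p (0≤+ 0≤q 0≤r))

  ∣a₀∣≤K : ∣ a₀ ∣ ≤ K
  ∣a₀∣≤K = summand≤ (0≤1+ (0≤∣p∣ b₀) (0≤∣p∣ c₀) (0≤∣p∣ d₀))
    (solve 4 (λ a b c d → con 1ℚ :+ (b :+ (c :+ d)) := con 1ℚ :+ (a :+ b :+ (c :+ d)) :- a)
      refl (∣ a₀ ∣) (∣ b₀ ∣) (∣ c₀ ∣) (∣ d₀ ∣))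

  ∣b₀∣≤K : ∣ b₀ ∣ ≤ K
  ∣b₀∣≤K = summand≤ (0≤1+ (0≤∣p∣ a₀) (0≤∣p∣ c₀) (0≤∣p∣ d₀))
    (solve 4 (λ a b c d → con 1ℚ :+ (a :+ (c :+ d)) := con 1ℚ :+ (a :+ b :+ (c :+ d)) :- b)
      refl (∣ a₀ ∣) (∣ b₀ ∣) (∣ c₀ ∣) (∣ d₀ ∣))

  ∣c₀∣≤K : ∣ c₀ ∣ ≤ K
  ∣c₀∣≤K = summand≤ (0≤1+ (0≤∣p∣ a₀) (0≤∣p∣ b₀) (0≤∣p∣ d₀))
    (solve 4 (λ a b c d → con 1ℚ :+ (a :+ (b :+ d)) := con 1ℚ :+ (a :+ b :+ (c :+ d)) :- c)
      refl (∣ a₀ ∣) (∣ b₀ ∣) (∣ c₀ ∣) (∣ d₀ ∣))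

  ∣d₀∣≤K : ∣ d₀ ∣ ≤ K
  ∣d₀∣≤K = summand≤ (0≤1+ (0≤∣p∣ a₀) (0≤∣p∣ b₀) (0≤∣p∣ c₀))
    (solve 4 (λ a b c d → con 1ℚ :+ (a :+ (b :+ c)) := con 1ℚ :+ (a :+ b :+ (c :+ d)) :- d)
      refl (∣ a₀ ∣) (∣ b₀ ∣) (∣ c₀ ∣) (∣ d₀ ∣))

  -K≤ : ∀ p → ∣ p ∣ ≤ K → - K ≤ p
  -K≤ p ∣p∣≤K = ≤-trans (neg-antimono-≤ ∣p∣≤K) (-∣p∣≤p p)

  ≤K : ∀ p → ∣ p ∣ ≤ K → p ≤ K
  ≤K p = ≤-trans (p≤∣p∣ p)

  K⁻¹ = (1/ K) {{>-nonZero 0<K}}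

  0<K⁻¹ : 0ℚ < K⁻¹
  0<K⁻¹ = positive⁻¹ K⁻¹ {{1/pos⇒pos K {{positive 0<K}}}}

  loc : ∀ {p q} → p < q → Lower p ⊎ Upper q
  loc {p} {q} p<q = decide
      (enclose x 0<δ a₀∈ b₀∈ (-K≤ a₀ ∣a₀∣≤K) (≤K b₀ ∣b₀∣≤K))
      (enclose y 0<δ c₀∈ d₀∈ (-K≤ c₀ ∣c₀∣≤K) (≤K d₀ ∣d₀∣≤K))
    where
    η = ½ * (½ * (q - p))
    0<η = 0<* 0<½ (0<* 0<½ (0<q-p p<q))
    m = p + (η + η)
    δ = (½ * η) * K⁻¹
    0<δ = 0<* (0<* 0<½ 0<η) 0<K⁻¹

    Kδ+Kδ : K * δ + K * δ ≡ η
    Kδ+Kδ = trans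
      (solve 3 (λ k h i → k :* (con ½ :* h :* i) :+ k :* (con ½ :* h :* i) := h :* (k :* i))
        refl K η K⁻¹)
      (trans (cong (η *_) (*-inverseʳ K {{>-nonZero 0<K}})) (*-identityʳ η))

    0≤K = <⇒≤ 0<K
    0≤δ = <⇒≤ 0<δ

    p-p≤δ : ∀ p → p - p ≤ δ
    p-p≤δ p = subst (_≤ δ) (sym (+-inverseʳ p)) 0≤δ

    p<m-η : p < m - η
    p<m-η = subst (p <_) (solve 2 (λ p e → p :+ e := p :+ (e :+ e) :- e) refl p η)
              (p<p+q p 0<η)

    m+η<q : m + η < q
    m+η<q = subst (m + η <_)
      (solve 2 (λ p q → let e = con ½ :* (con ½ :* (q :- p)) in
                        p :+ (e :+ e) :+ e :+ e := q) refl p q)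
      (p<p+q (m + η) 0<η)

    decide : Enclosure x δ K → Enclosure y δ K → Lower p ⊎ Upper q
    decide X Y = compare (m <? a * c)
      where
      open Enclosure X
      open Enclosure Y renaming
        ( a to c; b to d; a∈ to c∈; b∈ to d∈; a≤b to c≤d
        ; b-a≤δ to d-c≤δ; -K≤a to -K≤c; b≤K to d≤K )

      corner> : ∀ {a′ c′} → a ≤ a′ → a′ - a ≤ δ → c ≤ c′ → c′ - c ≤ δ →
                m < a * c → p < a′ * c′
      corner> {a′} {c′} a≤ a-δ c≤ c-δ m<ac =
        <-≤-trans (<-trans p<m-η (+-monoˡ-< (- η) m<ac))
          (subst (λ e → a * c - e ≤ a′ * c′) Kδ+Kδ
            (corner-lower 0≤K a≤ a-δ c≤ c-δ -K≤c (≤-trans -K≤a a≤)))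

      corner< : ∀ {a′ c′} → a ≤ a′ → a′ - a ≤ δ → c ≤ c′ → c′ - c ≤ δ → a′ ≤ K →
                a * c ≤ m → a′ * c′ < q
      corner< {a′} {c′} a≤ a-δ c≤ c-δ a′≤K ac≤m =
        ≤-<-trans
          (≤-trans
            (subst (λ e → a′ * c′ ≤ a * c + e) Kδ+Kδ
              (corner-upper 0≤K a≤ a-δ c≤ c-δ (≤-trans c≤d d≤K) a′≤K))
            (+-monoˡ-≤ η ac≤m))
          m+η<q

      compare : Dec (m < a * c) → Lower p ⊎ Upper q
      compare (yes m<ac) = inj₁ (a , b , c , d , a∈ , b∈ , c∈ , d∈ ,
        corner> ≤-refl (p-p≤δ a) ≤-refl (p-p≤δ c) m<ac ,
        corner> ≤-refl (p-p≤δ a) c≤d    d-c≤δ     m<ac ,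
        corner> a≤b    b-a≤δ     ≤-refl (p-p≤δ c) m<ac ,
        corner> a≤b    b-a≤δ     c≤d    d-c≤δ     m<ac)
      compare (no m≮ac) = inj₂ (a , b , c , d , a∈ , b∈ , c∈ , d∈ ,
        corner< ≤-refl (p-p≤δ a) ≤-refl (p-p≤δ c) (≤-trans a≤b b≤K) ac≤m ,
        corner< ≤-refl (p-p≤δ a) c≤d    d-c≤δ     (≤-trans a≤b b≤K) ac≤m ,
        corner< a≤b    b-a≤δ     ≤-refl (p-p≤δ c) b≤K ac≤m ,
        corner< a≤b    b-a≤δ     c≤d    d-c≤δ     b≤K ac≤m)
        where ac≤m = ≮⇒≥ m≮ac

-- The square root, extended by √ x = 0 for x < 0.
√ : ℝ → ℝ
√ x = record
  { lower           = Lower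
  ; upper           = Upper
  ; lower-inhabited = 0ℚ - 1ℚ , 0ℚ , p-1<p 0ℚ , inj₁ ≤-refl
  ; upper-inhabited = uppers
  ; lower-closed    = λ { p<q (r , q<r , r∈) → r , <-trans p<q q<r , r∈ }
  ; upper-closed    = λ { p<q (r , r<p , r∈) → r , <-trans r<p p<q , r∈ }
  ; lower-open      = λ { (r , p<r , r∈) →
                          let q , p<q , q<r = <-dense p<r in q , p<q , r , q<r , r∈ }
  ; upper-open      = λ { (r , r<q , r∈) →
                          let p , r<p , p<q = <-dense r<q in p , p<q , r , r<p , r∈ }
  ; disjoint        = disj
  ; located         = loc
  }
  where
  Lower Upper : ℚ → Set
  Lower q = ∃ λ r → q < r × (r ≤ 0ℚ ⊎ lower x (r * r))
  Upper q = ∃ λ r → r < q × 0ℚ ≤ r × upper x (r * r)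

  uppers : ∃ Upper
  uppers = s + 1ℚ , s , p<p+q s 0<1 , 0≤s , upper-closed-≤ x u≤ss (proj₂ (upper-inhabited x))
    where
    u = proj₁ (upper-inhabited x)
    s = 1ℚ ⊔ u
    0≤s : 0ℚ ≤ s
    0≤s = ≤-trans (<⇒≤ 0<1) (p≤p⊔q 1ℚ u)
    u≤ss : u ≤ s * s
    u≤ss = ≤-trans (p≤q⊔p 1ℚ u)
      (subst (_≤ s * s) (*-identityˡ s)
        (*-monoʳ-≤-nonNeg s {{nonNegative 0≤s}} (p≤p⊔q 1ℚ u)))

  disj : ∀ {q} → Lower q → ¬ Upper q
  disj (r , q<r , inj₁ r≤0) (s , s<q , 0≤s , s∈) =
    <-irrefl refl (<-≤-trans (<-trans s<q q<r) (≤-trans r≤0 0≤s))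
  disj (r , q<r , inj₂ r∈) (s , s<q , 0≤s , s∈) =
    <-asym (square-mono-< 0≤s (<-trans s<q q<r)) (lower<upper x r∈ s∈)

  loc : ∀ {p q} → p < q → Lower p ⊎ Upper q
  loc {p} {q} p<q with p <? 0ℚ
  ... | yes p<0 = inj₁ (0ℚ , p<0 , inj₁ ≤-refl)
  ... | no  p≮0 with <-dense p<q
  ...   | r , p<r , r<q with <-dense r<q
  ...     | s , r<s , s<q with located x (square-mono-< 0≤r r<s)
    where 0≤r = ≤-trans (≮⇒≥ p≮0) (<⇒≤ p<r)
  ...       | inj₁ r∈ = inj₁ (r , p<r , inj₂ r∈)
  ...       | inj₂ s∈ = inj₂ (s , s<q , <⇒≤ (≤-<-trans (≮⇒≥ p≮0) (<-trans p<r r<s)) , s∈)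


record Graph (n : ℕ) : Set where
  field
    adj        : Fin n → Fin n → Bool
    adj-sym    : ∀ i j → adj i j ≡ adj j i
    adj-irrefl : ∀ i → adj i i ≡ false

open Graph public

degree : ∀ {n} → Graph n → Fin n → ℕ
degree G i = card (tabulate (adj G i))

Regular : ∀ {n} → ℕ → Graph n → Set
Regular d G = ∀ i → degree G i ≡ d

-- E(K n): an unordered pair {i , j} is listed once, with i < j.
CompleteEdge : ℕ → Set
CompleteEdge n = ∃₂ λ (i j : Fin n) → i Fin.< j

Coloring : ℕ → Set
Coloring n = CompleteEdge n → Sign

module _ {n : ℕ} (f : Coloring n) (G : Graph n) where

  edgeValue : Fin n → Fin n → ℤ
  edgeValue i j with i Fin.<? j
  ... | yes i<j = if adj G i j then f (i , j , i<j) ◃ 1 else 0ℤ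
  ... | no  _   = 0ℤ

  discrepancy : ℕ
  discrepancy = ℤ.∣ ∑[ i < n ] ∑[ j < n ] edgeValue i j ∣

record _≅_ {n} (G H : Graph n) : Set where
  field
    bijection    : Permutation′ n
    preservesAdj : ∀ i j → adj H (bijection ⟨$⟩ʳ i) (bijection ⟨$⟩ʳ j) ≡ adj G i j

-- A subgraph of K n isomorphic to an n-vertex graph F uses all n vertices, so
-- it is a graph on Fin n.
record Copy {n} (F : Graph n) : Set where
  field
    graph : Graph n
    iso   : F ≅ graph

open Copy public

{-# OPTIONS --safe #-}

-- Put k = n − d and let x be the discrepancy of a copy.  Since k ≥ ε n, it is
-- enough to find a copy with n d k ≤ (B x)² for an absolute constant B.
--
-- For a matrix M let A_M(x, y; z, w) = M x z − M x w − M y z + M y w.  If the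
-- colouring is nearly constant, a random copy works by linearity of
-- expectation.  Otherwise A_f is nonzero on a positive proportion of all
-- quadruples of vertices: many vertices see both signs often, and joining two
-- cherries by an edge of either sign yields a path with signs + − + or − + −,
-- on which A_f cannot vanish.  For F, regularity gives Σ A_F² ≥ 2 n² d k over
-- quadruples of distinct vertices.
--
-- Averaging over relabellings of both sides one fixes disjoint pairs U_i and
-- W_j of vertices for which Σ (A_F A_f)² is of order at least d k.  Swapping the
-- vertices within the pairs according to signs s_i and t_j changes the signed
-- weight of the copy; its part bilinear in s and t is Σ s_i t_j A_F A_f.  By
-- Khintchine's inequality some choice of t, followed by the best choice of s,
-- makes this at least of order √(n d k), so one of four copies is unbalanced.

module Submission where

open import Data.Bool using (Bool; true; false; not; _xor_)
open import Data.Empty using (⊥-elim)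
open import Data.Fin using (Fin; zero; suc; _↑ˡ_; _↑ʳ_)
import Data.Fin as Fin
open import Data.Fin.Permutation using (Permutation′; _⟨$⟩ʳ_; _⟨$⟩ˡ_)
import Data.Fin.Permutation as Perm
import Data.Fin.Permutation.Components as PC
import Data.Fin.Properties as Fin
open import Data.Fin.Subset using () renaming (∣_∣ to card)
open import Data.Integer
  using (ℤ; +_; -[1+_]; 0ℤ; 1ℤ; _+_; _*_; _-_; -_; _≤_; _<_; +≤+; +<+; -≤+)
import Data.Integer as ℤ
import Data.Integer.Properties as ℤ
open import Data.Integer.Tactic.RingSolver using (solve-∀)
open import Data.Nat using (ℕ; zero; suc; z≤n; s≤s; _≥_)
import Data.Nat as ℕ
import Data.Nat.DivMod as ℕ
import Data.Nat.Properties as ℕ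
import Data.Nat.Solver as ℕ
open import Data.Product using (∃; ∃₂; _×_; _,_; proj₁; proj₂)
open import Data.Rational using (ℚ; 0ℚ; 1ℚ)
import Data.Rational as ℚ
import Data.Rational.Properties as ℚ
import Data.Rational.Solver as ℚ
import Data.Rational.Unnormalised as ℚᵘ
import Data.Rational.Unnormalised.Properties as ℚᵘ
open import Data.Sign using (Sign)
open import Data.Sum using (_⊎_; inj₁; inj₂)
import Data.Sum as Sum
open import Data.Vec using (Vec; []; _∷_; lookup)
import Data.Vec as Vec
import Data.Vec.Properties as Vec
open import Function using (_∘_)
open import Relation.Binary using (tri<; tri≈; tri>)
open import Relation.Binary.PropositionalEquality
  using (_≡_; _≢_; refl; sym; trans; cong; cong₂; subst; subst₂; module ≡-Reasoning)
open import Relation.Nullary using (¬_; Dec; yes; no)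
open import Relation.Nullary.Decidable using (_→-dec_)
open import Algebra.Properties.Semiring.Sum ℤ.+-*-semiring
  using (sum; ∑-distrib-+; ∑-comm; sum-permute; *-distribˡ-sum; *-distribʳ-sum)
  renaming (sum-cong-≗ to sum-cong)

open import Defs

open ℝ using (lower)

-- Regularity is the obstacle that shapes the proof: a matrix of the form `a x + b y` has the same
-- weight on every copy of a regular graph, so that part of a colouring is useless. The mixed second
-- differences A_M vanish on such matrices, which is why the imbalance is extracted from them. The
-- size √(n d k) comes from a balance between rows. Two rows of F differ in few places, so for each
-- i the sum over j of (A_F A_f)² is at most of order d k / n. One scale l of order √(d k / n)
-- therefore serves all rows in Khintchine's inequality, and a total of order d k divided by l is of
-- order √(n d k). Until the reals enter, everything is an inequality between integers: an
-- expectation is a sum over tuples, a square root is an integer l with N l² between K and 4 K, and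
-- the conclusion is squared. Quadruples with repeated vertices are a lower-order term for F only
-- once k exceeds a constant; this and the size needed for the colouring determine n₀.

private variable
  m n k : ℕ

-- Integer inequalities, finite sums and indicators

-- Polynomial inequalities are proved by certificates: a ring identity writes the difference of the
-- two sides as a combination of visibly nonnegative terms.
by-diff : ∀ {a b} → 0ℤ ≤ b - a → a ≤ b
by-diff = ℤ.0≤i-j⇒j≤i

diff≥0 : ∀ {a b} → a ≤ b → 0ℤ ≤ b - a
diff≥0 = ℤ.i≤j⇒0≤j-i

0≤+ : ∀ {a b} → 0ℤ ≤ a → 0ℤ ≤ b → 0ℤ ≤ a + b
0≤+ = ℤ.+-mono-≤

0≤* : ∀ {a b} → 0ℤ ≤ a → 0ℤ ≤ b → 0ℤ ≤ a * b
0≤* {+ a} {+ b} _ _ = subst (0ℤ ≤_) (ℤ.pos-* a b) (+≤+ z≤n)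

0≤+n : 0ℤ ≤ + n
0≤+n = +≤+ z≤n

0≤square : ∀ a → 0ℤ ≤ a * a
0≤square (+ a)    = 0≤* {+ a} {+ a} 0≤+n 0≤+n
0≤square -[1+ a ] = 0≤+n

*-monoˡ : ∀ {a b c} → 0ℤ ≤ c → a ≤ b → c * a ≤ c * b
*-monoˡ {c = c} 0≤c = ℤ.*-monoˡ-≤-nonNeg c {{ℤ.nonNegative 0≤c}}

*-mono : ∀ {a b c d} → 0ℤ ≤ a → 0ℤ ≤ d → a ≤ b → c ≤ d → a * c ≤ b * d
*-mono {a} {b} {c} {d} 0≤a 0≤d a≤b c≤d =
  ℤ.≤-trans (*-monoˡ 0≤a c≤d) (ℤ.*-monoʳ-≤-nonNeg d {{ℤ.nonNegative 0≤d}} a≤b)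

≤-*-cancelˡ : ∀ {a b} c → 0ℤ < c → c * a ≤ c * b → a ≤ b
≤-*-cancelˡ c 0<c = ℤ.*-cancelˡ-≤-pos _ _ c {{ℤ.positive 0<c}}

sum-minus : (f g : Fin n → ℤ) → sum (λ i → f i - g i) ≡ sum f - sum g
sum-minus f g = begin
  sum (λ i → f i - g i)               ≡⟨ ∑-distrib-+ f (λ i → - g i) ⟩
  sum f + sum (λ i → - g i)           ≡⟨ cong₂ _+_ (refl {x = sum f}) (sum-cong λ i → sym (ℤ.-1*i≡-i (g i))) ⟩
  sum f + sum (λ i → -[1+ 0 ] * g i)  ≡⟨ cong₂ _+_ (refl {x = sum f}) (sym (*-distribˡ-sum -[1+ 0 ] g)) ⟩
  sum f + -[1+ 0 ] * sum g            ≡⟨ cong₂ _+_ (refl {x = sum f}) (ℤ.-1*i≡-i (sum g)) ⟩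
  sum f - sum g                       ∎
  where open ≡-Reasoning

sum-mono : {f g : Fin n → ℤ} → (∀ i → f i ≤ g i) → sum f ≤ sum g
sum-mono {zero}  f≤g = ℤ.≤-refl
sum-mono {suc n} f≤g = ℤ.+-mono-≤ (f≤g zero) (sum-mono (f≤g ∘ suc))

sum-const : ∀ n a → sum {n} (λ _ → a) ≡ + n * a
sum-const zero    a = sym (ℤ.*-zeroˡ a)
sum-const (suc n) a = trans (cong₂ _+_ (refl {x = a}) (sum-const n a)) (sym (ℤ.suc-* (+ n) a))

sum-0 : ∀ n → sum {n} (λ _ → 0ℤ) ≡ 0ℤ
sum-0 n = trans (sum-const n 0ℤ) (ℤ.*-zeroʳ (+ n))

sum-nonneg : {f : Fin n → ℤ} → (∀ i → 0ℤ ≤ f i) → 0ℤ ≤ sum f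
sum-nonneg {n} {f} 0≤f = subst (_≤ sum f) (sum-0 n) (sum-mono 0≤f)

sum>0⇒∃ : {f : Fin n → ℤ} → 0ℤ < sum f → ∃ λ i → 0ℤ < f i
sum>0⇒∃ {zero}  (+<+ ())
sum>0⇒∃ {suc n} {f} 0<s with 0ℤ ℤ.<? f zero
... | yes 0<f0 = zero , 0<f0
... | no  f0≤0 =
  let i , 0<fi = sum>0⇒∃ {f = f ∘ suc} (ℤ.<-≤-trans 0<s
        (ℤ.≤-trans (ℤ.+-monoˡ-≤ _ (ℤ.≮⇒≥ f0≤0)) (ℤ.≤-reflexive (ℤ.+-identityˡ _))))
  in suc i , 0<fi

term≤sum : {f : Fin n → ℤ} → (∀ i → 0ℤ ≤ f i) → ∀ i → f i ≤ sum f
term≤sum {f = f} 0≤f zero =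
  subst (_≤ sum f) (ℤ.+-identityʳ _) (ℤ.+-monoʳ-≤ (f zero) (sum-nonneg (0≤f ∘ suc)))
term≤sum {f = f} 0≤f (suc i) =
  subst (_≤ sum f) (ℤ.+-identityˡ _) (ℤ.+-mono-≤ (0≤f zero) (term≤sum (0≤f ∘ suc) i))

⟦_⟧ : {P : Set} → Dec P → ℤ
⟦ yes _ ⟧ = 1ℤ
⟦ no _ ⟧  = 0ℤ

⟦⟧≥0 : {P : Set} (P? : Dec P) → 0ℤ ≤ ⟦ P? ⟧
⟦⟧≥0 (yes _) = 0≤+n
⟦⟧≥0 (no _)  = 0≤+n

⟦⟧≤1 : {P : Set} (P? : Dec P) → ⟦ P? ⟧ ≤ 1ℤ
⟦⟧≤1 (yes _) = ℤ.≤-refl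
⟦⟧≤1 (no _)  = 0≤+n

⟦⟧-yes : {P : Set} (P? : Dec P) → P → ⟦ P? ⟧ ≡ 1ℤ
⟦⟧-yes (yes _) p = refl
⟦⟧-yes (no ¬p) p = ⊥-elim (¬p p)

⟦⟧-no : {P : Set} (P? : Dec P) → ¬ P → ⟦ P? ⟧ ≡ 0ℤ
⟦⟧-no (yes p) ¬p = ⊥-elim (¬p p)
⟦⟧-no (no _)  ¬p = refl

⟦⟧-cong : {P Q : Set} (P? : Dec P) (Q? : Dec Q) → (P → Q) → (Q → P) → ⟦ P? ⟧ ≡ ⟦ Q? ⟧
⟦⟧-cong (yes p) Q? to from = sym (⟦⟧-yes Q? (to p))
⟦⟧-cong (no ¬p) Q? to from = sym (⟦⟧-no Q? (¬p ∘ from))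

sum-δ : (j : Fin n) (f : Fin n → ℤ) → sum (λ i → ⟦ j Fin.≟ i ⟧ * f i) ≡ f j
sum-δ {suc n} zero f = begin
  1ℤ * f zero + sum (λ i → 0ℤ * f (suc i))  ≡⟨ cong₂ _+_ (ℤ.*-identityˡ (f zero)) (sum-cong λ i → ℤ.*-zeroˡ (f (suc i))) ⟩
  f zero + sum {n} (λ _ → 0ℤ)               ≡⟨ cong₂ _+_ (refl {x = f zero}) (sum-0 n) ⟩
  f zero + 0ℤ                               ≡⟨ ℤ.+-identityʳ _ ⟩
  f zero                                    ∎
  where open ≡-Reasoning
sum-δ (suc j) f = begin
  0ℤ * f zero + sum (λ i → ⟦ suc j Fin.≟ suc i ⟧ * f (suc i))
    ≡⟨ cong₂ _+_ (ℤ.*-zeroˡ (f zero)) (sum-cong λ i → cong (_* f (suc i))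
         (⟦⟧-cong (suc j Fin.≟ suc i) (j Fin.≟ i) Fin.suc-injective (cong suc))) ⟩
  0ℤ + sum (λ i → ⟦ j Fin.≟ i ⟧ * f (suc i))
    ≡⟨ ℤ.+-identityˡ _ ⟩
  sum (λ i → ⟦ j Fin.≟ i ⟧ * f (suc i))
    ≡⟨ sum-δ j (f ∘ suc) ⟩
  f (suc j) ∎
  where open ≡-Reasoning

-- Averaging over permutations

-- Tuples may have repeated entries; distinctness is imposed by the factor `D`. For k = n the
-- distinct tuples are the permutations.
sumV : ∀ k → (Vec (Fin n) k → ℤ) → ℤ
sumV zero    h = h []
sumV (suc k) h = sum λ j → sumV k λ y → h (j ∷ y)

sumV-cong : ∀ k {h h′ : Vec (Fin n) k → ℤ} → (∀ y → h y ≡ h′ y) → sumV k h ≡ sumV k h′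
sumV-cong zero    eq = eq []
sumV-cong (suc k) eq = sum-cong λ j → sumV-cong k λ y → eq (j ∷ y)

sumV-mono : ∀ k {h h′ : Vec (Fin n) k → ℤ} → (∀ y → h y ≤ h′ y) → sumV k h ≤ sumV k h′
sumV-mono zero    le = le []
sumV-mono (suc k) le = sum-mono λ j → sumV-mono k λ y → le (j ∷ y)

sumV-+ : ∀ k (h h′ : Vec (Fin n) k → ℤ) → sumV k (λ y → h y + h′ y) ≡ sumV k h + sumV k h′
sumV-+ zero    h h′ = refl
sumV-+ (suc k) h h′ = trans
  (sum-cong λ j → sumV-+ k (λ y → h (j ∷ y)) (λ y → h′ (j ∷ y)))
  (∑-distrib-+ (λ j → sumV k λ y → h (j ∷ y)) (λ j → sumV k λ y → h′ (j ∷ y)))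

sumV-* : ∀ k a (h : Vec (Fin n) k → ℤ) → a * sumV k h ≡ sumV k (λ y → a * h y)
sumV-* zero    a h = refl
sumV-* (suc k) a h = trans
  (*-distribˡ-sum a (λ j → sumV k λ y → h (j ∷ y)))
  (sum-cong λ j → sumV-* k a (λ y → h (j ∷ y)))

sumV-const : ∀ k a → sumV {n} k (λ _ → a) ≡ + (n ℕ.^ k) * a
sumV-const zero a = sym (ℤ.*-identityˡ a)
sumV-const {n} (suc k) a = begin
  sum {n} (λ _ → sumV {n} k (λ _ → a))  ≡⟨ sum-cong {n} (λ _ → sumV-const {n} k a) ⟩
  sum {n} (λ _ → + (n ℕ.^ k) * a)       ≡⟨ sum-const n (+ (n ℕ.^ k) * a) ⟩
  + n * (+ (n ℕ.^ k) * a)               ≡⟨ sym (ℤ.*-assoc (+ n) (+ (n ℕ.^ k)) a) ⟩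
  + n * + (n ℕ.^ k) * a                 ≡⟨ cong (_* a) (sym (ℤ.pos-* n (n ℕ.^ k))) ⟩
  + (n ℕ.* n ℕ.^ k) * a                 ∎
  where open ≡-Reasoning

sumV-sum : ∀ k (h : Vec (Fin n) k → Fin m → ℤ) →
           sumV k (λ y → sum λ i → h y i) ≡ sum λ i → sumV k λ y → h y i
sumV-sum zero    h = refl
sumV-sum (suc k) h = trans
  (sum-cong λ j → sumV-sum k λ y → h (j ∷ y))
  (∑-comm λ j i → sumV k λ y → h (j ∷ y) i)

sumV-comm : ∀ k l (h : Vec (Fin n) k → Vec (Fin n) l → ℤ) →
            sumV k (λ y → sumV l λ z → h y z) ≡ sumV l λ z → sumV k λ y → h y z
sumV-comm k zero    h = refl
sumV-comm k (suc l) h = trans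
  (sumV-sum k λ y j → sumV l λ z → h y (j ∷ z))
  (sum-cong λ j → sumV-comm k l λ y z → h y (j ∷ z))

sumV>0⇒∃ : ∀ k {h : Vec (Fin n) k → ℤ} → 0ℤ < sumV k h → ∃ λ y → 0ℤ < h y
sumV>0⇒∃ zero    0<h = [] , 0<h
sumV>0⇒∃ (suc k) 0<s =
  let j , 0<sj = sum>0⇒∃ 0<s
      y , 0<h  = sumV>0⇒∃ k 0<sj
  in j ∷ y , 0<h

sumV-nonneg : ∀ k {h : Vec (Fin n) k → ℤ} → (∀ y → 0ℤ ≤ h y) → 0ℤ ≤ sumV k h
sumV-nonneg zero    0≤h = 0≤h []
sumV-nonneg (suc k) 0≤h = sum-nonneg λ j → sumV-nonneg k λ y → 0≤h (j ∷ y)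

term≤sumV : ∀ k {h : Vec (Fin n) k → ℤ} → (∀ y → 0ℤ ≤ h y) → ∀ y → h y ≤ sumV k h
term≤sumV zero    0≤h [] = ℤ.≤-refl
term≤sumV (suc k) 0≤h (j ∷ y) = ℤ.≤-trans
  (term≤sumV k (λ y → 0≤h (j ∷ y)) y)
  (term≤sum (λ j → sumV-nonneg k λ y → 0≤h (j ∷ y)) j)

sumV-permute : ∀ k (h : Vec (Fin n) k → ℤ) (π : Permutation′ n) →
               sumV k h ≡ sumV k (λ y → h (Vec.map (π ⟨$⟩ʳ_) y))
sumV-permute zero    h π = refl
sumV-permute (suc k) h π = trans
  (sum-permute (λ j → sumV k λ y → h (j ∷ y)) π)
  (sum-cong λ j → sumV-permute k (λ y → h ((π ⟨$⟩ʳ j) ∷ y)) π)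

infix 4 _≟V_
_≟V_ : (y z : Vec (Fin n) k) → Dec (y ≡ z)
_≟V_ = Vec.≡-dec Fin._≟_

sumV-δ : ∀ k (u : Vec (Fin n) k) (g : Vec (Fin n) k → ℤ) →
         sumV k (λ y → ⟦ u ≟V y ⟧ * g y) ≡ g u
sumV-δ zero    []      g = ℤ.*-identityˡ (g [])
sumV-δ (suc k) (a ∷ u) g = begin
  sum (λ j → sumV k λ y → ⟦ a ∷ u ≟V j ∷ y ⟧ * g (j ∷ y))
    ≡⟨ sum-cong (λ j → trans (sumV-cong k λ y → split j y)
                             (sym (sumV-* k ⟦ a Fin.≟ j ⟧ λ y → ⟦ u ≟V y ⟧ * g (j ∷ y)))) ⟩
  sum (λ j → ⟦ a Fin.≟ j ⟧ * sumV k λ y → ⟦ u ≟V y ⟧ * g (j ∷ y))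
    ≡⟨ sum-δ a (λ j → sumV k λ y → ⟦ u ≟V y ⟧ * g (j ∷ y)) ⟩
  sumV k (λ y → ⟦ u ≟V y ⟧ * g (a ∷ y))
    ≡⟨ sumV-δ k u (λ y → g (a ∷ y)) ⟩
  g (a ∷ u) ∎
  where
  open ≡-Reasoning
  split : ∀ j y → ⟦ a ∷ u ≟V j ∷ y ⟧ * g (j ∷ y) ≡ ⟦ a Fin.≟ j ⟧ * (⟦ u ≟V y ⟧ * g (j ∷ y))
  split j y with a Fin.≟ j | u ≟V y
  ... | yes refl | yes refl = sym (ℤ.*-identityˡ (1ℤ * g (a ∷ y)))
  ... | yes refl | no _     = sym (ℤ.*-identityˡ (0ℤ * g (a ∷ y)))
  ... | no _     | yes _    = refl
  ... | no _     | no _     = refl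

Distinct : Vec (Fin n) k → Set
Distinct y = ∀ i j → lookup y i ≡ lookup y j → i ≡ j

distinct? : (y : Vec (Fin n) k) → Dec (Distinct y)
distinct? y = Fin.all? λ i → Fin.all? λ j → (lookup y i Fin.≟ lookup y j) →-dec (i Fin.≟ j)

perm-injective : (π : Permutation′ n) → ∀ {a b} → π ⟨$⟩ʳ a ≡ π ⟨$⟩ʳ b → a ≡ b
perm-injective π eq =
  trans (sym (Perm.inverseˡ π)) (trans (cong (π ⟨$⟩ˡ_) eq) (Perm.inverseˡ π))

distinct-map : {f : Fin n → Fin m} → (∀ {a b} → f a ≡ f b → a ≡ b) →
               (y : Vec (Fin n) k) → Distinct y → Distinct (Vec.map f y)
distinct-map {f = f} f-inj y d i j eq = d i j (f-inj
  (trans (sym (Vec.lookup-map i f y)) (trans eq (Vec.lookup-map j f y))))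

distinct-map⁻¹ : (f : Fin n → Fin m) → (y : Vec (Fin n) k) → Distinct (Vec.map f y) → Distinct y
distinct-map⁻¹ f y d i j eq = d i j
  (trans (Vec.lookup-map i f y) (trans (cong f eq) (sym (Vec.lookup-map j f y))))

lookup-ext : {A : Set} (y z : Vec A k) → (∀ i → lookup y i ≡ lookup z i) → y ≡ z
lookup-ext []      []      eq = refl
lookup-ext (a ∷ y) (b ∷ z) eq = cong₂ _∷_ (eq zero) (lookup-ext y z (eq ∘ suc))

map-injective : {f : Fin n → Fin m} → (∀ {a b} → f a ≡ f b → a ≡ b) →
                (y z : Vec (Fin n) k) → Vec.map f y ≡ Vec.map f z → y ≡ z
map-injective f-inj []      []      eq = refl
map-injective f-inj (a ∷ y) (b ∷ z) eq =
  cong₂ _∷_ (f-inj (Vec.∷-injectiveˡ eq)) (map-injective f-inj y z (Vec.∷-injectiveʳ eq))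

transpose-left : (i j : Fin n) → PC.transpose i j i ≡ j
transpose-left i j with i Fin.≟ i
... | yes _  = refl
... | no i≢i = ⊥-elim (i≢i refl)

transpose-other : (i j k : Fin n) → k ≢ i → k ≢ j → PC.transpose i j k ≡ k
transpose-other i j k k≢i k≢j with k Fin.≟ i
... | yes k≡i = ⊥-elim (k≢i k≡i)
... | no _ with k Fin.≟ j
...   | yes k≡j = ⊥-elim (k≢j k≡j)
...   | no _    = refl

-- A permutation that is right on the tail is corrected at the head by one transposition;
-- distinctness of both tuples keeps the tail fixed.
transitive : (y z : Vec (Fin n) k) → Distinct y → Distinct z →
             ∃ λ (π : Permutation′ n) → Vec.map (π ⟨$⟩ʳ_) y ≡ z
transitive y z dy dz =
  let π , eq = go y z dy dz
  in π , lookup-ext _ z (λ i → trans (Vec.lookup-map i (π ⟨$⟩ʳ_) y) (eq i))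
  where
  go : ∀ {k} (y z : Vec (Fin n) k) → Distinct y → Distinct z →
       ∃ λ (π : Permutation′ n) → ∀ i → π ⟨$⟩ʳ lookup y i ≡ lookup z i
  go []      []      _  _  = Perm.id , λ ()
  go (a ∷ y) (b ∷ z) dy dz = π , eq
    where
    rec = go y z (λ i j e → Fin.suc-injective (dy (suc i) (suc j) e))
                 (λ i j e → Fin.suc-injective (dz (suc i) (suc j) e))
    ρ = proj₁ rec
    π = ρ Perm.∘ₚ Perm.transpose (ρ ⟨$⟩ʳ a) b
    ρ-lookup : ∀ i → ρ ⟨$⟩ʳ lookup y i ≡ lookup z i
    ρ-lookup = proj₂ rec
    eq : ∀ i → π ⟨$⟩ʳ lookup (a ∷ y) i ≡ lookup (b ∷ z) i
    eq zero    = transpose-left (ρ ⟨$⟩ʳ a) b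
    eq (suc i) = trans
      (transpose-other (ρ ⟨$⟩ʳ a) b (ρ ⟨$⟩ʳ lookup y i)
        (λ e → Fin.0≢1+n (sym (dy (suc i) zero (perm-injective ρ e))))
        (λ e → Fin.0≢1+n (sym (dz (suc i) zero (trans (sym (ρ-lookup i)) e)))))
      (ρ-lookup i)

-- An injective endofunction of Fin n is a permutation: a missed value would
-- give an injection into Fin n minus a point.
distinct⇒perm : (φ : Vec (Fin n) n) → Distinct φ →
                ∃ λ (π : Permutation′ n) → ∀ i → π ⟨$⟩ʳ i ≡ lookup φ i
distinct⇒perm {n} φ d = Perm.permutation (lookup φ) (proj₁ ∘ preimage) (proj₂ ∘ preimage)
    (λ i → d _ i (proj₂ (preimage (lookup φ i)))) , λ _ → refl
  where
  surjective : ∀ {n} (f : Fin n → Fin n) → (∀ {i j} → f i ≡ f j → i ≡ j) → ∀ b → ∃ λ a → f a ≡ b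
  surjective {suc n} f f-inj b with Fin.any? (λ a → f a Fin.≟ b)
  ... | yes hit  = hit
  ... | no  miss = ⊥-elim (ℕ.1+n≰n (Fin.injective⇒≤ {f = λ a → Fin.punchOut {i = b} {j = f a} (λ e → miss (a , sym e))}
                     (λ {x} {y} e → f-inj (Fin.punchOut-injective {i = b}
                       (λ q → miss (x , sym q)) (λ q → miss (y , sym q)) e))))
  preimage : ∀ b → ∃ λ a → lookup φ a ≡ b
  preimage = surjective (lookup φ) (d _ _)

module _ {n : ℕ} where

  D : ∀ {k} → Vec (Fin n) k → ℤ
  D y = ⟦ distinct? y ⟧

  D≥0 : ∀ {k} (y : Vec (Fin n) k) → 0ℤ ≤ D y
  D≥0 y = ⟦⟧≥0 (distinct? y)

  D-permute : ∀ {k} (π : Permutation′ n) (y : Vec (Fin n) k) → D (Vec.map (π ⟨$⟩ʳ_) y) ≡ D y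
  D-permute π y = ⟦⟧-cong (distinct? (Vec.map (π ⟨$⟩ʳ_) y)) (distinct? y)
    (distinct-map⁻¹ (π ⟨$⟩ʳ_) y) (distinct-map (perm-injective π) y)

  image : ∀ {k} → Vec (Fin n) n → Vec (Fin n) k → Vec (Fin n) k
  image φ p = Vec.map (lookup φ) p

  image-map : ∀ {k} (f : Fin n → Fin n) (φ : Vec (Fin n) n) (p : Vec (Fin n) k) →
              image (Vec.map f φ) p ≡ Vec.map f (image φ p)
  image-map f φ p = trans (Vec.map-cong (λ i → Vec.lookup-map i f φ) p) (Vec.map-∘ f (lookup φ) p)

  -- The number n! of permutations, kept unevaluated as a normalising factor.
  total : ℤ
  total = sumV n D

  total>0 : 0ℤ < total
  total>0 = ℤ.<-≤-trans
    (subst (0ℤ <_) (sym (⟦⟧-yes (distinct? (Vec.allFin n))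
      (λ i j e → trans (sym (Vec.lookup-allFin i)) (trans e (Vec.lookup-allFin j))))) (+<+ (s≤s z≤n)))
    (term≤sumV n D≥0 (Vec.allFin n))

  module _ {k} (p : Vec (Fin n) k) (dp : Distinct p) where

    -- The number of permutations carrying `p` to `y`. It vanishes unless `y` is distinct, and by
    -- transitivity it is the same for all distinct `y`.
    hits : Vec (Fin n) k → ℤ
    hits y = sumV n λ φ → D φ * ⟦ image φ p ≟V y ⟧

    hits≥0 : ∀ y → 0ℤ ≤ hits y
    hits≥0 y = sumV-nonneg n λ φ → 0≤* (D≥0 φ) (⟦⟧≥0 (image φ p ≟V y))

    hits-permute : ∀ (π : Permutation′ n) y → hits (Vec.map (π ⟨$⟩ʳ_) y) ≡ hits y
    hits-permute π y = trans
      (sumV-permute n (λ φ → D φ * ⟦ image φ p ≟V Vec.map (π ⟨$⟩ʳ_) y ⟧) π)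
      (sumV-cong n λ φ → cong₂ _*_ (D-permute π φ)
        (⟦⟧-cong (image (Vec.map (π ⟨$⟩ʳ_) φ) p ≟V Vec.map (π ⟨$⟩ʳ_) y) (image φ p ≟V y)
          (λ e → map-injective (perm-injective π) (image φ p) y
                   (trans (sym (image-map (π ⟨$⟩ʳ_) φ p)) e))
          (λ e → trans (image-map (π ⟨$⟩ʳ_) φ p) (cong (Vec.map (π ⟨$⟩ʳ_)) e))))

    hits-constant : ∀ y z → Distinct y → Distinct z → hits y ≡ hits z
    hits-constant y z dy dz with transitive y z dy dz
    ... | π , refl = sym (hits-permute π y)

    marginal : (g : Vec (Fin n) k → ℤ) →
               sumV n (λ φ → D φ * g (image φ p)) ≡ sumV k λ y → hits y * g y
    marginal g = begin
      sumV n (λ φ → D φ * g (image φ p))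
        ≡⟨ sumV-cong n (λ φ → trans
             (cong (D φ *_) (sym (sumV-δ k (image φ p) g)))
             (sumV-* k (D φ) (λ y → ⟦ image φ p ≟V y ⟧ * g y))) ⟩
      sumV n (λ φ → sumV k λ y → D φ * (⟦ image φ p ≟V y ⟧ * g y))
        ≡⟨ sumV-comm n k (λ φ y → D φ * (⟦ image φ p ≟V y ⟧ * g y)) ⟩
      sumV k (λ y → sumV n λ φ → D φ * (⟦ image φ p ≟V y ⟧ * g y))
        ≡⟨ sumV-cong k (λ y → trans
             (sumV-cong n λ φ → rotate (D φ) ⟦ image φ p ≟V y ⟧ (g y))
             (trans (sym (sumV-* n (g y) λ φ → D φ * ⟦ image φ p ≟V y ⟧))
                    (ℤ.*-comm (g y) (hits y)))) ⟩
      sumV k (λ y → hits y * g y) ∎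
      where
      open ≡-Reasoning
      rotate : ∀ a b c → a * (b * c) ≡ c * (a * b)
      rotate = solve-∀

    hits-total : total ≡ sumV k hits
    hits-total = trans
      (sumV-cong n λ φ → sym (ℤ.*-identityʳ (D φ)))
      (trans (marginal (λ _ → 1ℤ)) (sumV-cong k λ y → ℤ.*-identityʳ (hits y)))

    hits-distinct : ∀ y → hits y ≤ D y * hits y
    hits-distinct y with distinct? y
    ... | yes _ = ℤ.≤-reflexive (sym (ℤ.*-identityˡ (hits y)))
    ... | no ¬d = ℤ.≤-reflexive (trans
            (trans (sumV-cong n zero-term) (sumV-const {n} n 0ℤ)) (ℤ.*-zeroʳ (+ (n ℕ.^ n))))
      where
      zero-term : ∀ φ → D φ * ⟦ image φ p ≟V y ⟧ ≡ 0ℤ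
      zero-term φ with distinct? φ | image φ p ≟V y
      ... | yes dφ | yes refl = ⊥-elim (¬d (distinct-map (dφ _ _) p dp))
      ... | yes _  | no _     = refl
      ... | no _   | _        = refl

    -- The exact ratio of the two counts is the falling factorial n (n - 1) ⋯ (n - k + 1); n^k is a
    -- simpler upper bound and loses little for large n.
    total≤hits : ∀ z → Distinct z → total ≤ + (n ℕ.^ k) * hits z
    total≤hits z dz = subst₂ _≤_ (sym hits-total) (sumV-const {n} k (hits z))
      (sumV-mono k λ y → ℤ.≤-trans (hits-distinct y) (bound y))
      where
      bound : ∀ y → D y * hits y ≤ hits z
      bound y with distinct? y
      ... | yes dy = ℤ.≤-reflexive (trans (ℤ.*-identityˡ (hits y)) (hits-constant y z dy dz))
      ... | no _   = hits≥0 z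

    marginal-bound : (g : Vec (Fin n) k → ℤ) → (∀ y → 0ℤ ≤ g y) →
      total * sumV k (λ y → D y * g y) ≤ + (n ℕ.^ k) * sumV n (λ φ → D φ * g (image φ p))
    marginal-bound g 0≤g = subst₂ _≤_
      (sym (sumV-* k total λ y → D y * g y))
      (trans (sym (sumV-* k (+ (n ℕ.^ k)) λ y → hits y * g y))
             (cong (+ (n ℕ.^ k) *_) (sym (marginal g))))
      (sumV-mono k bound)
      where
      bound : ∀ y → total * (D y * g y) ≤ + (n ℕ.^ k) * (hits y * g y)
      bound y with distinct? y
      ... | yes dy = subst₂ _≤_ (cong (total *_) (sym (ℤ.*-identityˡ (g y))))
                       (ℤ.*-assoc (+ (n ℕ.^ k)) (hits y) (g y))
                       (ℤ.*-monoʳ-≤-nonNeg (g y) {{ℤ.nonNegative (0≤g y)}} (total≤hits y dy))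
      ... | no _   = subst (_≤ + (n ℕ.^ k) * (hits y * g y)) (sym (ℤ.*-zeroʳ total))
                       (0≤* (0≤+n {n ℕ.^ k}) (0≤* (hits≥0 y) (0≤g y)))

  -- Some permutation does at least as well as a uniformly random one.
  averaging : ∀ {k a} (g : Vec (Fin n) k → ℤ) → (∀ y → 0ℤ ≤ g y) →
    (c : Fin a → ℤ) → (∀ i → 0ℤ ≤ c i) → (p : Fin a → Vec (Fin n) k) → (∀ i → (c i ≡ 0ℤ) ⊎ Distinct (p i)) →
    ∃ λ (π : Permutation′ n) →
      sum c * sumV k (λ y → D y * g y) ≤ + (n ℕ.^ k) * sum λ i → c i * g (Vec.map (π ⟨$⟩ʳ_) (p i))
  averaging {k} {a} g 0≤g c 0≤c p dp = conclude (sumV>0⇒∃ n excess>0)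
    where
    S = sumV k (λ y → D y * g y)
    N = + (n ℕ.^ k)
    E : Vec (Fin n) n → ℤ
    E φ = N * sum (λ i → c i * g (image φ (p i))) - sum c * S

    E-sum : ∀ φ → E φ ≡ sum (λ i → c i * (N * g (image φ (p i)) - S))
    E-sum φ = begin
      N * sum (λ i → c i * g (image φ (p i))) - sum c * S
        ≡⟨ cong₂ _-_ (*-distribˡ-sum N (λ i → c i * g (image φ (p i)))) (*-distribʳ-sum S c) ⟩
      sum (λ i → N * (c i * g (image φ (p i)))) - sum (λ i → c i * S)
        ≡⟨ sym (sum-minus (λ i → N * (c i * g (image φ (p i)))) (λ i → c i * S)) ⟩
      sum (λ i → N * (c i * g (image φ (p i))) - c i * S)
        ≡⟨ sum-cong (λ i → shuffle N (c i) (g (image φ (p i))) S) ⟩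
      sum (λ i → c i * (N * g (image φ (p i)) - S)) ∎
      where
      open ≡-Reasoning
      shuffle : ∀ N c g S → N * (c * g) - c * S ≡ c * (N * g - S)
      shuffle = solve-∀

    one : ∀ i → Distinct (p i) → 0ℤ ≤ sumV n (λ φ → D φ * (N * g (image φ (p i)) - S))
    one i dpi = subst (0ℤ ≤_) eq (diff≥0 (marginal-bound (p i) dpi g 0≤g))
      where
      open ≡-Reasoning
      shuffle : ∀ N d g S → N * (d * g) + - S * d ≡ d * (N * g - S)
      shuffle = solve-∀
      swap : ∀ t S → - (t * S) ≡ - S * t
      swap = solve-∀
      eq : N * sumV n (λ φ → D φ * g (image φ (p i))) - total * S
           ≡ sumV n (λ φ → D φ * (N * g (image φ (p i)) - S))
      eq = begin
        N * sumV n (λ φ → D φ * g (image φ (p i))) - total * S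
          ≡⟨ cong₂ _+_ (sumV-* n N λ φ → D φ * g (image φ (p i)))
               (trans (swap total S) (sumV-* n (- S) D)) ⟩
        sumV n (λ φ → N * (D φ * g (image φ (p i)))) + sumV n (λ φ → - S * D φ)
          ≡⟨ sym (sumV-+ n (λ φ → N * (D φ * g (image φ (p i)))) (λ φ → - S * D φ)) ⟩
        sumV n (λ φ → N * (D φ * g (image φ (p i))) + - S * D φ)
          ≡⟨ sumV-cong n (λ φ → shuffle N (D φ) (g (image φ (p i))) S) ⟩
        sumV n (λ φ → D φ * (N * g (image φ (p i)) - S)) ∎

    E≥0 : 0ℤ ≤ sumV n (λ φ → D φ * E φ)
    E≥0 = subst (0ℤ ≤_) (sym eq) (sum-nonneg λ i → weighted i (dp i))
      where
      open ≡-Reasoning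
      T : Vec (Fin n) n → Fin a → ℤ
      T φ i = N * g (image φ (p i)) - S
      swap : ∀ d c t → d * (c * t) ≡ c * (d * t)
      swap = solve-∀
      weighted : ∀ i → (c i ≡ 0ℤ) ⊎ Distinct (p i) → 0ℤ ≤ c i * sumV n (λ φ → D φ * T φ i)
      weighted i (inj₁ ci≡0) = subst (λ z → 0ℤ ≤ z * sumV n (λ φ → D φ * T φ i)) (sym ci≡0)
        (ℤ.≤-reflexive (sym (ℤ.*-zeroˡ (sumV n λ φ → D φ * T φ i))))
      weighted i (inj₂ dpi) = 0≤* (0≤c i) (one i dpi)
      eq : sumV n (λ φ → D φ * E φ) ≡ sum λ i → c i * sumV n (λ φ → D φ * T φ i)
      eq = begin
        sumV n (λ φ → D φ * E φ)
          ≡⟨ sumV-cong n (λ φ → trans (cong (D φ *_) (E-sum φ))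
               (trans (*-distribˡ-sum (D φ) (λ i → c i * T φ i))
                      (sum-cong λ i → swap (D φ) (c i) (T φ i)))) ⟩
        sumV n (λ φ → sum λ i → c i * (D φ * T φ i))
          ≡⟨ sumV-sum n (λ φ i → c i * (D φ * T φ i)) ⟩
        sum (λ i → sumV n λ φ → c i * (D φ * T φ i))
          ≡⟨ sum-cong (λ i → sym (sumV-* n (c i) λ φ → D φ * T φ i)) ⟩
        sum (λ i → c i * sumV n (λ φ → D φ * T φ i)) ∎

    -- Adding `D φ`, whose sum is n! > 0, turns a nonnegative sum into a positive one. A positive
    -- term has `φ` distinct and E φ + 1 > 0, which over the integers is E φ ≥ 0.
    excess>0 : 0ℤ < sumV n (λ φ → D φ * E φ + D φ)
    excess>0 = subst (0ℤ <_) (sym (sumV-+ n (λ φ → D φ * E φ) D)) (ℤ.+-mono-≤-< E≥0 total>0)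

    conclude : (∃ λ φ → 0ℤ < D φ * E φ + D φ) →
      ∃ λ (π : Permutation′ n) →
        sum c * S ≤ N * sum λ i → c i * g (Vec.map (π ⟨$⟩ʳ_) (p i))
    conclude (φ , 0<e) with distinct? φ
    ... | no _  = ⊥-elim (ℤ.<-irrefl refl 0<e)
    ... | yes d =
      let π , π≗φ = distinct⇒perm φ d
      in π , subst (λ s → sum c * S ≤ N * s)
               (sum-cong λ i → cong (λ y → c i * g y) (Vec.map-cong (λ j → sym (π≗φ j)) (p i)))
               (by-diff 0≤Eφ)
      where
      0≤Eφ : 0ℤ ≤ E φ
      0≤Eφ = subst (0ℤ ≤_) (ℤ.pred-suc (E φ))
        (ℤ.i<j⇒i≤pred[j] (subst (0ℤ <_)
          (trans (cong (_+ 1ℤ) (ℤ.*-identityˡ (E φ))) (ℤ.+-comm (E φ) 1ℤ)) 0<e))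

-- Copies and their signed weight

bit : Bool → ℤ
bit true  = 1ℤ
bit false = 0ℤ

-- The symmetric matrix of the colouring with zero diagonal; a `Coloring` is indexed only by pairs
-- in increasing order.
color : Coloring n → Fin n → Fin n → ℤ
color f i j with i Fin.<? j | j Fin.<? i
... | yes i<j | _       = f (i , j , i<j) ℤ.◃ 1
... | no _    | yes j<i = f (j , i , j<i) ℤ.◃ 1
... | no _    | no _    = 0ℤ

color-sym : (f : Coloring n) → ∀ i j → color f i j ≡ color f j i
color-sym f i j with i Fin.<? j | j Fin.<? i
... | yes i<j | yes j<i = ⊥-elim (Fin.<-asym i<j j<i)
... | yes _   | no _    = refl
... | no _    | yes _   = refl
... | no _    | no _    = refl

color-diag : (f : Coloring n) → ∀ i → color f i i ≡ 0ℤ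
color-diag f i with i Fin.<? i
... | yes i<i = ⊥-elim (Fin.<-irrefl refl i<i)
... | no _    = refl

unit-sign : ∀ s → (s ℤ.◃ 1 ≡ 1ℤ) ⊎ (s ℤ.◃ 1 ≡ - 1ℤ)
unit-sign Sign.+ = inj₁ refl
unit-sign Sign.- = inj₂ refl

color-±1 : (f : Coloring n) → ∀ i j → i ≢ j → (color f i j ≡ 1ℤ) ⊎ (color f i j ≡ - 1ℤ)
color-±1 f i j i≢j with i Fin.<? j | j Fin.<? i
... | yes i<j | _       = unit-sign (f (i , j , i<j))
... | no _    | yes j<i = unit-sign (f (j , i , j<i))
... | no i≮j  | no j≮i  with Fin.<-cmp i j
...   | tri< i<j _ _ = ⊥-elim (i≮j i<j)
...   | tri≈ _ i≡j _ = ⊥-elim (i≢j i≡j)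
...   | tri> _ _ j<i = ⊥-elim (j≮i j<i)

edge : Graph n → Fin n → Fin n → ℤ
edge F v w = bit (adj F v w)

edgeValue-color : (f : Coloring n) (G : Graph n) → ∀ i j →
                  edgeValue f G i j + edgeValue f G j i ≡ edge G i j * color f i j
edgeValue-color f G i j with i Fin.<? j | j Fin.<? i
... | yes i<j | yes j<i = ⊥-elim (Fin.<-asym i<j j<i)
... | no _    | no _    = sym (ℤ.*-zeroʳ (edge G i j))
... | yes i<j | no _    with adj G i j
...   | true  = trans (ℤ.+-identityʳ _) (sym (ℤ.*-identityˡ _))
...   | false = refl
edgeValue-color f G i j | no _ | yes j<i rewrite adj-sym G j i with adj G i j
... | true  = trans (ℤ.+-identityˡ (f (j , i , j<i) ℤ.◃ 1)) (sym (ℤ.*-identityˡ (f (j , i , j<i) ℤ.◃ 1)))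
... | false = refl

copy : (F : Graph n) → Permutation′ n → Copy F
copy F π = record
  { graph = record
    { adj        = λ a b → adj F (π ⟨$⟩ˡ a) (π ⟨$⟩ˡ b)
    ; adj-sym    = λ a b → adj-sym F (π ⟨$⟩ˡ a) (π ⟨$⟩ˡ b)
    ; adj-irrefl = λ a → adj-irrefl F (π ⟨$⟩ˡ a)
    }
  ; iso = record
    { bijection    = π
    ; preservesAdj = λ i j → cong₂ (adj F) (Perm.inverseˡ π) (Perm.inverseˡ π)
    }
  }

-- Every edge is counted twice, once in each direction.
weight : (Fin n → Fin n → ℤ) → (Fin n → Fin n → ℤ) → Permutation′ n → ℤ
weight F f π = sum λ v → sum λ w → F v w * f (π ⟨$⟩ʳ v) (π ⟨$⟩ʳ w)

weight-copy : (f : Coloring n) (F : Graph n) (π : Permutation′ n) →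
  let s = sum λ i → sum λ j → edgeValue f (graph (copy F π)) i j
  in weight (edge F) (color f) π ≡ s + s
weight-copy {n} f F π = begin
  sum (λ v → sum λ w → edge F v w * color f (π ⟨$⟩ʳ v) (π ⟨$⟩ʳ w))
    ≡⟨ sum-cong (λ v → sum-cong λ w → cong (λ b → bit b * color f (π ⟨$⟩ʳ v) (π ⟨$⟩ʳ w))
         (sym (cong₂ (adj F) (Perm.inverseˡ π) (Perm.inverseˡ π)))) ⟩
  sum (λ v → sum λ w → h (π ⟨$⟩ʳ v) (π ⟨$⟩ʳ w))
    ≡⟨ sum-cong (λ v → sym (sum-permute (h (π ⟨$⟩ʳ v)) π)) ⟩
  sum (λ v → sum λ b → h (π ⟨$⟩ʳ v) b)
    ≡⟨ sym (sum-permute (λ a → sum λ b → h a b) π) ⟩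
  sum (λ a → sum λ b → h a b)
    ≡⟨ sum-cong (λ a → sum-cong λ b → sym (edgeValue-color f G a b)) ⟩
  sum (λ a → sum λ b → e a b + e b a)
    ≡⟨ sum-cong (λ a → ∑-distrib-+ (e a) (λ b → e b a)) ⟩
  sum (λ a → sum (λ b → e a b) + sum (λ b → e b a))
    ≡⟨ ∑-distrib-+ (λ a → sum λ b → e a b) (λ a → sum λ b → e b a) ⟩
  sum (λ a → sum λ b → e a b) + sum (λ a → sum λ b → e b a)
    ≡⟨ cong₂ _+_ (refl {x = sum (λ a → sum λ b → e a b)}) (∑-comm (λ a b → e b a)) ⟩
  sum (λ a → sum λ b → e a b) + sum (λ a → sum λ b → e a b) ∎
  where
  open ≡-Reasoning
  G = graph (copy F π)
  h e : Fin n → Fin n → ℤ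
  h a b = edge G a b * color f a b
  e a b = edgeValue f G a b

i≤∣i∣ : ∀ i → i ≤ + ℤ.∣ i ∣
i≤∣i∣ (+ i)    = ℤ.≤-refl
i≤∣i∣ -[1+ i ] = -≤+

-i≤∣i∣ : ∀ i → - i ≤ + ℤ.∣ i ∣
-i≤∣i∣ i = subst (λ k → - i ≤ + k) (ℤ.∣-i∣≡∣i∣ i) (i≤∣i∣ (- i))

module _ (f : Coloring n) (F : Graph n) (π : Permutation′ n) where
  private
    disc = + discrepancy f (graph (copy F π))

  weight≤disc : weight (edge F) (color f) π ≤ disc + disc
  weight≤disc = subst (_≤ disc + disc) (sym (weight-copy f F π)) (ℤ.+-mono-≤ (i≤∣i∣ s) (i≤∣i∣ s))
    where s = sum λ i → sum λ j → edgeValue f (graph (copy F π)) i j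

  -weight≤disc : - weight (edge F) (color f) π ≤ disc + disc
  -weight≤disc = subst (_≤ disc + disc)
    (trans (sym (ℤ.neg-distrib-+ s s)) (cong -_ (sym (weight-copy f F π))))
    (ℤ.+-mono-≤ (-i≤∣i∣ s) (-i≤∣i∣ s))
    where s = sum λ i → sum λ j → edgeValue f (graph (copy F π)) i j

-- Swapping within pairs of vertices

sum-split : ∀ m (h : Fin (m ℕ.+ n) → ℤ) →
            sum h ≡ sum (λ i → h (i ↑ˡ n)) + sum (λ j → h (m ↑ʳ j))
sum-split zero    h = sym (ℤ.+-identityˡ (sum h))
sum-split (suc m) h = trans
  (cong₂ _+_ (refl {x = h zero}) (sum-split m (h ∘ suc)))
  (sym (ℤ.+-assoc (h zero) _ _))

sum-pairs : ∀ m {n} (h : Fin (m ℕ.* n) → ℤ) → sum h ≡ sum λ i → sum λ j → h (Fin.combine {m} {n} i j)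
sum-pairs zero h = refl
sum-pairs (suc m) {n} h = trans (sum-split n h)
  (cong₂ _+_ (refl {x = sum λ j → h (j ↑ˡ (m ℕ.* n))}) (sum-pairs m (λ i → h (n ↑ʳ i))))

-- A partition of the vertices into m pairs of type U, m pairs of type W, with a Boolean naming the
-- member of a pair, and r remaining vertices.
data Cell (m r : ℕ) : Set where
  U W : Fin m → Bool → Cell m r
  R   : Fin r → Cell m r

module _ {m r : ℕ} where

  size : ℕ
  size = m ℕ.+ (m ℕ.+ (m ℕ.+ (m ℕ.+ r)))

  position : Cell m r → Fin size
  position (U i false) = i ↑ˡ _
  position (U i true)  = m ↑ʳ (i ↑ˡ _)
  position (W i false) = m ↑ʳ (m ↑ʳ (i ↑ˡ _))
  position (W i true)  = m ↑ʳ (m ↑ʳ (m ↑ʳ (i ↑ˡ _)))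
  position (R j)       = m ↑ʳ (m ↑ʳ (m ↑ʳ (m ↑ʳ j)))

  cell : Fin size → Cell m r
  cell v with Fin.splitAt m v
  ... | inj₁ i = U i false
  ... | inj₂ v with Fin.splitAt m v
  ...   | inj₁ i = U i true
  ...   | inj₂ v with Fin.splitAt m v
  ...     | inj₁ i = W i false
  ...     | inj₂ v with Fin.splitAt m v
  ...       | inj₁ i = W i true
  ...       | inj₂ j = R j

  cell-position : ∀ c → cell (position c) ≡ c
  cell-position (U i false)
    rewrite Fin.splitAt-↑ˡ m i (m ℕ.+ (m ℕ.+ (m ℕ.+ r))) = refl
  cell-position (U i true)
    rewrite Fin.splitAt-↑ʳ m (m ℕ.+ (m ℕ.+ (m ℕ.+ r))) (i ↑ˡ _)
          | Fin.splitAt-↑ˡ m i (m ℕ.+ (m ℕ.+ r)) = refl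
  cell-position (W i false)
    rewrite Fin.splitAt-↑ʳ m (m ℕ.+ (m ℕ.+ (m ℕ.+ r))) (m ↑ʳ (i ↑ˡ _))
          | Fin.splitAt-↑ʳ m (m ℕ.+ (m ℕ.+ r)) (i ↑ˡ _)
          | Fin.splitAt-↑ˡ m i (m ℕ.+ r) = refl
  cell-position (W i true)
    rewrite Fin.splitAt-↑ʳ m (m ℕ.+ (m ℕ.+ (m ℕ.+ r))) (m ↑ʳ (m ↑ʳ (i ↑ˡ _)))
          | Fin.splitAt-↑ʳ m (m ℕ.+ (m ℕ.+ r)) (m ↑ʳ (i ↑ˡ _))
          | Fin.splitAt-↑ʳ m (m ℕ.+ r) (i ↑ˡ _)
          | Fin.splitAt-↑ˡ m i r = refl
  cell-position (R j)
    rewrite Fin.splitAt-↑ʳ m (m ℕ.+ (m ℕ.+ (m ℕ.+ r))) (m ↑ʳ (m ↑ʳ (m ↑ʳ j)))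
          | Fin.splitAt-↑ʳ m (m ℕ.+ (m ℕ.+ r)) (m ↑ʳ (m ↑ʳ j))
          | Fin.splitAt-↑ʳ m (m ℕ.+ r) (m ↑ʳ j)
          | Fin.splitAt-↑ʳ m r j = refl

  position-injective : ∀ {c c′} → position c ≡ position c′ → c ≡ c′
  position-injective {c} {c′} eq = trans (sym (cell-position c)) (trans (cong cell eq) (cell-position c′))

  position-cell : ∀ v → position (cell v) ≡ v
  position-cell v with Fin.splitAt m v in e₁
  ... | inj₁ i = Fin.splitAt⁻¹-↑ˡ e₁
  ... | inj₂ v′ with Fin.splitAt m v′ in e₂
  ...   | inj₁ i = trans (cong (m ↑ʳ_) (Fin.splitAt⁻¹-↑ˡ e₂)) (Fin.splitAt⁻¹-↑ʳ e₁)
  ...   | inj₂ v″ with Fin.splitAt m v″ in e₃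
  ...     | inj₁ i = trans (cong (m ↑ʳ_) (trans (cong (m ↑ʳ_) (Fin.splitAt⁻¹-↑ˡ e₃)) (Fin.splitAt⁻¹-↑ʳ e₂))) (Fin.splitAt⁻¹-↑ʳ e₁)
  ...     | inj₂ v‴ with Fin.splitAt m v‴ in e₄
  ...       | inj₁ i = trans (cong (m ↑ʳ_) (trans (cong (m ↑ʳ_) (trans (cong (m ↑ʳ_) (Fin.splitAt⁻¹-↑ˡ e₄)) (Fin.splitAt⁻¹-↑ʳ e₃))) (Fin.splitAt⁻¹-↑ʳ e₂))) (Fin.splitAt⁻¹-↑ʳ e₁)
  ...       | inj₂ j = trans (cong (m ↑ʳ_) (trans (cong (m ↑ʳ_) (trans (cong (m ↑ʳ_) (Fin.splitAt⁻¹-↑ʳ e₄)) (Fin.splitAt⁻¹-↑ʳ e₃))) (Fin.splitAt⁻¹-↑ʳ e₂))) (Fin.splitAt⁻¹-↑ʳ e₁)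

  sumU sumW sumC : (Cell m r → ℤ) → ℤ
  sumU h = sum λ i → h (U i false) + h (U i true)
  sumW h = sum λ i → h (W i false) + h (W i true)
  sumC h = sumU h + (sumW h + sum λ j → h (R j))

  sum-position : (h : Fin size → ℤ) → sum h ≡ sumC (h ∘ position)
  sum-position h = begin
    sum h
      ≡⟨ sum-split m h ⟩
    s₁ + sum (λ v → h (m ↑ʳ v))
      ≡⟨ cong₂ _+_ (refl {x = s₁}) (sum-split m (λ v → h (m ↑ʳ v))) ⟩
    s₁ + (s₂ + sum (λ v → h (m ↑ʳ (m ↑ʳ v))))
      ≡⟨ cong (λ s → s₁ + (s₂ + s)) (sum-split m (λ v → h (m ↑ʳ (m ↑ʳ v)))) ⟩
    s₁ + (s₂ + (s₃ + sum (λ v → h (m ↑ʳ (m ↑ʳ (m ↑ʳ v))))))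
      ≡⟨ cong (λ s → s₁ + (s₂ + (s₃ + s))) (sum-split m (λ v → h (m ↑ʳ (m ↑ʳ (m ↑ʳ v))))) ⟩
    s₁ + (s₂ + (s₃ + (s₄ + s₅)))
      ≡⟨ regroup s₁ s₂ s₃ s₄ s₅ ⟩
    (s₁ + s₂) + ((s₃ + s₄) + s₅)
      ≡⟨ sym (cong₂ _+_ (∑-distrib-+ (λ i → h (position (U i false))) (λ i → h (position (U i true))))
           (cong (_+ s₅) (∑-distrib-+ (λ i → h (position (W i false))) (λ i → h (position (W i true)))))) ⟩
    sumC (h ∘ position) ∎
    where
    open ≡-Reasoning
    s₁ = sum λ i → h (position (U i false))
    s₂ = sum λ i → h (position (U i true))
    s₃ = sum λ i → h (position (W i false))
    s₄ = sum λ i → h (position (W i true))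
    s₅ = sum λ j → h (position (R j))
    regroup : ∀ a b c d e → a + (b + (c + (d + e))) ≡ (a + b) + ((c + d) + e)
    regroup = solve-∀

  swap : (s t : Fin m → Bool) → Cell m r → Cell m r
  swap s t (U i b) = U i (b xor s i)
  swap s t (W k b) = W k (b xor t k)
  swap s t (R j)   = R j

  xor-twice : ∀ a b → (a xor b) xor b ≡ a
  xor-twice false false = refl
  xor-twice false true  = refl
  xor-twice true  false = refl
  xor-twice true  true  = refl

  swap-involutive : ∀ s t c → swap s t (swap s t c) ≡ c
  swap-involutive s t (U i b) = cong (U i) (xor-twice b (s i))
  swap-involutive s t (W k b) = cong (W k) (xor-twice b (t k))
  swap-involutive s t (R j)   = refl

  swapPerm : (s t : Fin m → Bool) → Permutation′ size
  swapPerm s t = Perm.permutation σ σ σσ σσ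
    where
    σ : Fin size → Fin size
    σ v = position (swap s t (cell v))
    σσ : ∀ v → σ (σ v) ≡ v
    σσ v = trans (cong (position ∘ swap s t) (cell-position (swap s t (cell v))))
      (trans (cong position (swap-involutive s t (cell v))) (position-cell v))

sgn : Bool → ℤ
sgn false = 1ℤ
sgn true  = - 1ℤ

-- Flipping either Boolean exchanges the two values of `e`, so the difference is odd in each of
-- them.
flip-difference : ∀ (e : Bool → ℤ) b s →
                  e (b xor s) - e (b xor not s) ≡ sgn b * sgn s * (e false - e true)
flip-difference e false false = sym (ℤ.*-identityˡ (e false - e true))
flip-difference e false true  = lemma (e true) (e false)
  where
  lemma : ∀ a b → a - b ≡ - 1ℤ * (b - a)
  lemma = solve-∀
flip-difference e true  false = lemma (e true) (e false)
  where
  lemma : ∀ a b → a - b ≡ - 1ℤ * (b - a)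
  lemma = solve-∀
flip-difference e true  true  = sym (ℤ.*-identityˡ (e false - e true))

alt : {V : Set} → (V → V → ℤ) → V → V → V → V → ℤ
alt M x y z w = M x z - M x w - M y z + M y w

sum-alternating : (a b c d : Fin n → ℤ) →
  sum (λ i → a i - b i - c i + d i) ≡ sum a - sum b - sum c + sum d
sum-alternating a b c d = trans (∑-distrib-+ (λ i → a i - b i - c i) d) (cong (_+ sum d)
  (trans (sum-minus (λ i → a i - b i) c) (cong (_- sum c) (sum-minus a b))))

module Bilinear {m r : ℕ} (F f : Fin (size {m} {r}) → Fin (size {m} {r}) → ℤ)
  (F-sym : ∀ v w → F v w ≡ F w v) (f-sym : ∀ v w → f v w ≡ f w v) where

  private
    V = Fin (size {m} {r})
    C = Cell m r

    pos : C → V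
    pos = position

  u-alt : (V → V → ℤ) → Fin m → Fin m → ℤ
  u-alt M i k = alt M (position (U i false)) (position (U i true))
                      (position (W k false)) (position (W k true))

  form : (s t : Fin m → Bool) → ℤ
  form s t = sum λ i → sum λ k → sgn (s i) * sgn (t k) * (u-alt F i k * u-alt f i k)

  module _ (s t : Fin m → Bool) where
    private
      s̄ t̄ : Fin m → Bool
      s̄ i = not (s i)
      t̄ k = not (t k)

      σ : (s t : Fin m → Bool) → V → V
      σ s t = swapPerm {m} {r} s t ⟨$⟩ʳ_

      -- The mixed difference under reversing all of `s` and all of `t`. It kills every entry that
      -- depends on `s` alone, on `t` alone or on neither, even where it is quadratic in `s`; only
      -- entries between a U-pair and a W-pair survive, through their part bilinear in the two
      -- signs.
      four : ∀ {A : Set} → ((s t : Fin m → Bool) → A → A → ℤ) → A → A → ℤ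
      four h v w = h s t v w - h s̄ t v w - h s t̄ v w + h s̄ t̄ v w

      fσ : (s t : Fin m → Bool) → V → V → ℤ
      fσ s t v w = f (σ s t v) (σ s t w)

      fc : (s t : Fin m → Bool) → C → C → ℤ
      fc s t c c′ = f (position (swap s t c)) (position (swap s t c′))

      K : C → C → ℤ
      K c c′ = F (position c) (position c′) * four fc c c′

      distribute : ∀ p a b c d → p * a - p * b - p * c + p * d ≡ p * (a - b - c + d)
      distribute = solve-∀

      alternating : weight F f (swapPerm s t) - weight F f (swapPerm s̄ t)
                      - weight F f (swapPerm s t̄) + weight F f (swapPerm s̄ t̄)
                    ≡ sum λ v → sum λ w → F v w * four fσ v w
      alternating = begin
        weight F f (swapPerm s t) - weight F f (swapPerm s̄ t)
          - weight F f (swapPerm s t̄) + weight F f (swapPerm s̄ t̄)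
          ≡⟨ sym (sum-alternating (λ v → row s t v) (λ v → row s̄ t v) (λ v → row s t̄ v) (λ v → row s̄ t̄ v)) ⟩
        sum (λ v → row s t v - row s̄ t v - row s t̄ v + row s̄ t̄ v)
          ≡⟨ sum-cong (λ v → trans
               (sym (sum-alternating (λ w → F v w * fσ s t v w) (λ w → F v w * fσ s̄ t v w)
                                     (λ w → F v w * fσ s t̄ v w) (λ w → F v w * fσ s̄ t̄ v w)))
               (sum-cong λ w → distribute (F v w) (fσ s t v w) (fσ s̄ t v w) (fσ s t̄ v w) (fσ s̄ t̄ v w))) ⟩
        sum (λ v → sum λ w → F v w * four fσ v w) ∎
        where
        open ≡-Reasoning
        row : (s t : Fin m → Bool) → V → ℤ
        row s t v = sum λ w → F v w * fσ s t v w

      to-cells : sum (λ v → sum λ w → F v w * four fσ v w) ≡ sumC λ c → sumC λ c′ → K c c′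
      to-cells = trans (sum-position {m} {r} (λ v → sum λ w → F v w * four fσ v w))
        (sumC-cong λ c → trans (sum-position {m} {r} (λ w → F (position c) w * four fσ (position c) w))
          (sumC-cong λ c′ → cong (F (position c) (position c′) *_) (eq c c′)))
        where
        sumC-cong : {h h′ : C → ℤ} → (∀ c → h c ≡ h′ c) → sumC h ≡ sumC h′
        sumC-cong e = cong₂ _+_ (sum-cong λ i → cong₂ _+_ (e (U i false)) (e (U i true)))
          (cong₂ _+_ (sum-cong λ i → cong₂ _+_ (e (W i false)) (e (W i true))) (sum-cong λ j → e (R j)))
        eq : ∀ c c′ → four fσ (position c) (position c′) ≡ four fc c c′
        eq c c′ rewrite cell-position c | cell-position c′ = refl

      a-b-a+b : ∀ p a b → p * (a - b - a + b) ≡ 0ℤ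
      a-b-a+b = solve-∀
      a-a-b+b : ∀ p a b → p * (a - a - b + b) ≡ 0ℤ
      a-a-b+b = solve-∀

      KUU : ∀ i b i′ b′ → K (U i b) (U i′ b′) ≡ 0ℤ
      KUU i b i′ b′ = a-b-a+b (F (pos (U i b)) (pos (U i′ b′))) (fc s t (U i b) (U i′ b′)) (fc s̄ t (U i b) (U i′ b′))
      KUR : ∀ i b j → K (U i b) (R j) ≡ 0ℤ
      KUR i b j = a-b-a+b (F (pos (U i b)) (pos (R j))) (fc s t (U i b) (R j)) (fc s̄ t (U i b) (R j))
      KRU : ∀ i b j → K (R j) (U i b) ≡ 0ℤ
      KRU i b j = a-b-a+b (F (pos (R j)) (pos (U i b))) (fc s t (R j) (U i b)) (fc s̄ t (R j) (U i b))
      KWW : ∀ i b i′ b′ → K (W i b) (W i′ b′) ≡ 0ℤ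
      KWW i b i′ b′ = a-a-b+b (F (pos (W i b)) (pos (W i′ b′))) (fc s t (W i b) (W i′ b′)) (fc s t̄ (W i b) (W i′ b′))
      KWR : ∀ i b j → K (W i b) (R j) ≡ 0ℤ
      KWR i b j = a-a-b+b (F (pos (W i b)) (pos (R j))) (fc s t (W i b) (R j)) (fc s t̄ (W i b) (R j))
      KRW : ∀ i b j → K (R j) (W i b) ≡ 0ℤ
      KRW i b j = a-a-b+b (F (pos (R j)) (pos (W i b))) (fc s t (R j) (W i b)) (fc s t̄ (R j) (W i b))
      KRR : ∀ i j → K (R i) (R j) ≡ 0ℤ
      KRR i j = a-a-b+b (F (pos (R i)) (pos (R j))) (fc s t (R i) (R j)) (fc s t (R i) (R j))

      K-sym : ∀ c c′ → K c c′ ≡ K c′ c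
      K-sym c c′ = cong₂ _*_ (F-sym (position c) (position c′))
        (cong₂ _+_ (cong₂ _-_ (cong₂ _-_ (e s t) (e s̄ t)) (e s t̄)) (e s̄ t̄))
        where
        e : ∀ s t → fc s t c c′ ≡ fc s t c′ c
        e s t = f-sym (position (swap s t c)) (position (swap s t c′))

      sumU-0 : {h : C → ℤ} → (∀ i b → h (U i b) ≡ 0ℤ) → sumU h ≡ 0ℤ
      sumU-0 e = trans (sum-cong λ i → cong₂ _+_ (e i false) (e i true)) (sum-0 m)
      sumW-0 : {h : C → ℤ} → (∀ i b → h (W i b) ≡ 0ℤ) → sumW h ≡ 0ℤ
      sumW-0 e = trans (sum-cong λ i → cong₂ _+_ (e i false) (e i true)) (sum-0 m)
      sumR-0 : {h : C → ℤ} → (∀ j → h (R j) ≡ 0ℤ) → sum (λ j → h (R j)) ≡ 0ℤ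
      sumR-0 e = trans (sum-cong e) (sum-0 r)

      rowU : ∀ i b → sumC (K (U i b)) ≡ sumW (K (U i b))
      rowU i b = trans (cong₂ _+_ (sumU-0 {K (U i b)} (KUU i b))
          (cong₂ _+_ (refl {x = sumW (K (U i b))}) (sumR-0 {K (U i b)} (KUR i b))))
        (trans (ℤ.+-identityˡ (sumW (K (U i b)) + 0ℤ)) (ℤ.+-identityʳ (sumW (K (U i b)))))
      rowW : ∀ k b → sumC (K (W k b)) ≡ sumU (K (W k b))
      rowW k b = trans (cong₂ _+_ (refl {x = sumU (K (W k b))})
          (cong₂ _+_ (sumW-0 {K (W k b)} (KWW k b)) (sumR-0 {K (W k b)} (KWR k b))))
        (ℤ.+-identityʳ (sumU (K (W k b))))
      rowR : ∀ j → sumC (K (R j)) ≡ 0ℤ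
      rowR j = cong₂ _+_ (sumU-0 {K (R j)} (λ i b → KRU i b j))
        (cong₂ _+_ (sumW-0 {K (R j)} (λ i b → KRW i b j)) (sumR-0 {K (R j)} (KRR j)))

      block : Fin m → Fin m → ℤ
      block i k = K (U i false) (W k false) + K (U i false) (W k true)
                  + (K (U i true) (W k false) + K (U i true) (W k true))

      UW : sumU (λ c → sumW (K c)) ≡ sum λ i → sum λ k → block i k
      UW = sum-cong λ i → sym (∑-distrib-+
        (λ k → K (U i false) (W k false) + K (U i false) (W k true))
        (λ k → K (U i true) (W k false) + K (U i true) (W k true)))

      WU : sumW (λ c → sumU (K c)) ≡ sum λ i → sum λ k → block i k
      WU = trans (sum-cong λ k → sym (∑-distrib-+
          (λ i → K (W k false) (U i false) + K (W k false) (U i true))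
          (λ i → K (W k true) (U i false) + K (W k true) (U i true))))
        (trans (∑-comm λ k i → K (W k false) (U i false) + K (W k false) (U i true)
                               + (K (W k true) (U i false) + K (W k true) (U i true)))
        (sum-cong λ i → sum-cong λ k → trans
          (exchange (K (W k false) (U i false)) (K (W k false) (U i true))
                    (K (W k true) (U i false)) (K (W k true) (U i true)))
          (cong₂ _+_ (cong₂ _+_ (K-sym (W k false) (U i false)) (K-sym (W k true) (U i false)))
                     (cong₂ _+_ (K-sym (W k false) (U i true)) (K-sym (W k true) (U i true))))))
        where
        exchange : ∀ a b c d → a + b + (c + d) ≡ a + c + (b + d)
        exchange = solve-∀

      K-block : ∀ i b k c → K (U i b) (W k c) ≡
        F (position (U i b)) (position (W k c)) * (sgn b * sgn c * (sgn (s i) * sgn (t k) * u-alt f i k))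
      K-block i b k c = cong (F (position (U i b)) (position (W k c)) *_) (begin
        e (b xor s i) (c xor t k) - e (b xor not (s i)) (c xor t k)
          - e (b xor s i) (c xor not (t k)) + e (b xor not (s i)) (c xor not (t k))
          ≡⟨ pair (e (b xor s i) (c xor t k)) (e (b xor not (s i)) (c xor t k))
                  (e (b xor s i) (c xor not (t k))) (e (b xor not (s i)) (c xor not (t k))) ⟩
        (e (b xor s i) (c xor t k) - e (b xor s i) (c xor not (t k)))
          - (e (b xor not (s i)) (c xor t k) - e (b xor not (s i)) (c xor not (t k)))
          ≡⟨ flip-difference (λ b → e b (c xor t k) - e b (c xor not (t k))) b (s i) ⟩
        sgn b * sgn (s i) * ((e false (c xor t k) - e false (c xor not (t k)))
                             - (e true (c xor t k) - e true (c xor not (t k))))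
          ≡⟨ cong (sgn b * sgn (s i) *_) (cong₂ _-_ (flip-difference (e false) c (t k))
                                                    (flip-difference (e true) c (t k))) ⟩
        sgn b * sgn (s i) * (sgn c * sgn (t k) * (e false false - e false true)
                             - sgn c * sgn (t k) * (e true false - e true true))
          ≡⟨ collect (sgn b) (sgn (s i)) (sgn c) (sgn (t k)) (e false false) (e false true) (e true false) (e true true) ⟩
        sgn b * sgn c * (sgn (s i) * sgn (t k) * u-alt f i k) ∎)
        where
        open ≡-Reasoning
        e : Bool → Bool → ℤ
        e b c = f (position (U i b)) (position (W k c))
        pair : ∀ a b c d → a - b - c + d ≡ (a - c) - (b - d)
        pair = solve-∀
        collect : ∀ β σ γ τ p q u v → β * σ * (γ * τ * (p - q) - γ * τ * (u - v))
                  ≡ β * γ * (σ * τ * (p - q - u + v))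
        collect = solve-∀

      block-value : ∀ i k → block i k ≡ sgn (s i) * sgn (t k) * (u-alt F i k * u-alt f i k)
      block-value i k = trans
        (cong₂ _+_ (cong₂ _+_ (K-block i false k false) (K-block i false k true))
                   (cong₂ _+_ (K-block i true k false) (K-block i true k true)))
        (collect (G false false) (G false true) (G true false) (G true true)
                 (sgn (s i) * sgn (t k)) (u-alt f i k))
        where
        G : Bool → Bool → ℤ
        G b c = F (position (U i b)) (position (W k c))
        collect : ∀ p q u v τ B →
          p * (1ℤ * 1ℤ * (τ * B)) + q * (1ℤ * - 1ℤ * (τ * B))
            + (u * (- 1ℤ * 1ℤ * (τ * B)) + v * (- 1ℤ * - 1ℤ * (τ * B)))
          ≡ τ * ((p - q - u + v) * B)
        collect = solve-∀

    -- The surviving entries form a U-W block and its transpose; both matrices are symmetric, hence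
    -- the factor 2.
    bilinear : weight F f (swapPerm s t) - weight F f (swapPerm (λ i → not (s i)) t)
                 - weight F f (swapPerm s (λ k → not (t k)))
                 + weight F f (swapPerm (λ i → not (s i)) (λ k → not (t k)))
               ≡ form s t + form s t
    bilinear = begin
      _ ≡⟨ trans alternating to-cells ⟩
      sumC (λ c → sumC (K c))
        ≡⟨ cong₂ _+_ (sum-cong λ i → cong₂ _+_ (rowU i false) (rowU i true))
             (cong₂ _+_ (sum-cong λ k → cong₂ _+_ (rowW k false) (rowW k true))
                        (trans (sum-cong rowR) (sum-0 r))) ⟩
      sumU (λ c → sumW (K c)) + (sumW (λ c → sumU (K c)) + 0ℤ)
        ≡⟨ cong₂ _+_ UW (trans (ℤ.+-identityʳ (sumW λ c → sumU (K c))) WU) ⟩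
      sum (λ i → sum λ k → block i k) + sum (λ i → sum λ k → block i k)
        ≡⟨ cong₂ _+_ eq eq ⟩
      form s t + form s t ∎
      where
      open ≡-Reasoning
      eq : sum (λ i → sum λ k → block i k) ≡ form s t
      eq = sum-cong λ i → sum-cong λ k → block-value i k

-- Choosing the signs

-- Averaged over the signs of the terms still to be added to s, whose squares
-- sum to S, the expectation of x² is s² + S and that of x⁴ is at most
-- s⁴ + 6 s² S + 3 S².
potential : ℤ → ℤ → ℤ → ℤ
potential l s S = l * l * (s * s + S) - (s * s * (s * s) + + 6 * (s * s) * S + + 3 * (S * S))

-- The second moment is propagated exactly. In the fourth moment `3 (a² + S)²` allows 3 a⁴ where
-- averaging over the sign of `a` produces only a⁴; the surplus of 2 a⁴ for each sign is the last
-- term. As it is nonnegative, one of the two signs does not lower a sum of potentials.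
potential-step : ∀ l s a S →
  potential l (s + a) S + potential l (s - a) S
  ≡ potential l s (a * a + S) + potential l s (a * a + S) + + 4 * (a * a * (a * a))
potential-step = unfolded
  where
  unfolded : ∀ l s a S →
    l * l * ((s + a) * (s + a) + S) - ((s + a) * (s + a) * ((s + a) * (s + a)) + + 6 * ((s + a) * (s + a)) * S + + 3 * (S * S))
    + (l * l * ((s - a) * (s - a) + S) - ((s - a) * (s - a) * ((s - a) * (s - a)) + + 6 * ((s - a) * (s - a)) * S + + 3 * (S * S)))
    ≡ l * l * (s * s + (a * a + S)) - (s * s * (s * s) + + 6 * (s * s) * (a * a + S) + + 3 * ((a * a + S) * (a * a + S)))
      + (l * l * (s * s + (a * a + S)) - (s * s * (s * s) + + 6 * (s * s) * (a * a + S) + + 3 * ((a * a + S) * (a * a + S))))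
      + + 4 * (a * a * (a * a))
  unfolded = solve-∀

∣∣-sgn : ∀ x → ∃ λ b → sgn b * x ≡ + ℤ.∣ x ∣
∣∣-sgn (+ x)    = false , ℤ.*-identityˡ (+ x)
∣∣-sgn -[1+ x ] = true , ℤ.-1*i≡-i -[1+ x ]

-- The hypothesis makes the fourth-moment term 3 S² at most half of l² S.
potential-initial : ∀ l S → 0ℤ ≤ S → + 6 * S ≤ l * l → l * l * S ≤ + 2 * potential l 0ℤ S
potential-initial l S 0≤S 6S≤ll = by-diff (subst (0ℤ ≤_) (eq l S) (0≤* 0≤S (diff≥0 6S≤ll)))
  where
  eq : ∀ l S → S * (l * l - + 6 * S)
       ≡ + 2 * (l * l * (0ℤ * 0ℤ + S) - (0ℤ * 0ℤ * (0ℤ * 0ℤ) + + 6 * (0ℤ * 0ℤ) * S + + 3 * (S * S))) - l * l * S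
  eq = solve-∀

-- Multiplied by `y` this is 2 (l² y² - y⁴) ≤ l³ y, the pointwise inequality through which second
-- and fourth moments bound a first moment from below. The case split at l = 2 y gives a certificate
-- on each side.
cubic : ∀ l y → 0ℤ ≤ l → 0ℤ ≤ y → 0ℤ ≤ l * l * l - + 2 * (l * l) * y + + 2 * (y * y * y)
cubic l y 0≤l 0≤y with ℤ.≤-total l (+ 2 * y)
... | inj₁ l≤2y = subst (0ℤ ≤_) (eq l y)
    (0≤+ (0≤* 0≤l (0≤square (l - y))) (0≤* (0≤square y) (diff≥0 l≤2y)))
  where
  eq : ∀ l y → l * ((l - y) * (l - y)) + y * y * (+ 2 * y - l)
       ≡ l * l * l - + 2 * (l * l) * y + + 2 * (y * y * y)
  eq = solve-∀
... | inj₂ 2y≤l = subst (0ℤ ≤_) (eq l y)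
    (0≤+ (0≤* (0≤square l) (diff≥0 2y≤l)) (0≤* (0≤+n {2}) (0≤* (0≤square y) 0≤y)))
  where
  eq : ∀ l y → l * l * (l - + 2 * y) + + 2 * (y * y * y)
       ≡ l * l * l - + 2 * (l * l) * y + + 2 * (y * y * y)
  eq = solve-∀

potential-final : ∀ l x → 0ℤ ≤ l → + 2 * potential l x 0ℤ ≤ l * l * l * + ℤ.∣ x ∣
potential-final l x 0≤l = by-diff (subst (0ℤ ≤_)
  (trans (eq l y x) (cong (λ z → l * l * l * y - + 2 * (l * l * (z + 0ℤ) - (z * z + + 6 * z * 0ℤ + + 3 * (0ℤ * 0ℤ)))) y²))
  (0≤* (0≤+n {ℤ.∣ x ∣}) (cubic l y 0≤l 0≤+n)))
  where
  y = + ℤ.∣ x ∣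
  y² : y * y ≡ x * x
  y² with ∣∣-sgn x
  ... | false , e = cong (λ z → z * z) (trans (sym e) (ℤ.*-identityˡ x))
  ... | true  , e = trans (cong (λ z → z * z) (sym e)) (neg² x)
    where
    neg² : ∀ x → (- 1ℤ * x) * (- 1ℤ * x) ≡ x * x
    neg² = solve-∀
  eq : ∀ l y x → y * (l * l * l - + 2 * (l * l) * y + + 2 * (y * y * y))
       ≡ l * l * l * y - + 2 * (l * l * (y * y + 0ℤ) - (y * y * (y * y) + + 6 * (y * y) * 0ℤ + + 3 * (0ℤ * 0ℤ)))
  eq = solve-∀

half-≤ : ∀ {a b c} → c + c ≤ a + b → (c ≤ a) ⊎ (c ≤ b)
half-≤ {a} {b} {c} h with c ℤ.≤? a
... | yes c≤a = inj₁ c≤a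
... | no  c≰a = inj₂ (ℤ.≮⇒≥ λ b<c → ℤ.<-irrefl refl (ℤ.≤-<-trans h (ℤ.+-mono-< (ℤ.≰⇒> c≰a) b<c)))

module _ (l : ℤ) where

  -- The method of conditional expectations, one column at a time. A column has the same sign in all
  -- rows, so it is the sum of the potentials over the rows that must not decrease.
  greedy : ∀ {m} k (a : Fin m → Fin k → ℤ) (s : Fin m → ℤ) → ∃ λ (t : Fin k → Bool) →
    sum (λ i → potential l (s i) (sum λ j → a i j * a i j))
    ≤ sum (λ i → potential l (s i + sum λ j → sgn (t j) * a i j) 0ℤ)
  greedy zero    a s = (λ ()) ,
    ℤ.≤-reflexive (sum-cong λ i → cong (λ z → potential l z 0ℤ) (sym (ℤ.+-identityʳ (s i))))
  greedy {m} (suc k) a s = choose (half-≤ two-signs)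
    where
    S : Fin m → ℤ
    S i = sum λ j → a i (suc j) * a i (suc j)
    G : Fin m → ℤ
    G i = potential l (s i) (a i zero * a i zero + S i)
    goal = sum G

    two-signs : goal + goal ≤ sum (λ i → potential l (s i + a i zero) (S i))
                              + sum (λ i → potential l (s i - a i zero) (S i))
    two-signs = subst₂ _≤_
      (∑-distrib-+ G G)
      (∑-distrib-+ (λ i → potential l (s i + a i zero) (S i)) (λ i → potential l (s i - a i zero) (S i)))
      (sum-mono λ i → subst₂ _≤_
        (ℤ.+-identityʳ (G i + G i)) (sym (potential-step l (s i) (a i zero) (S i)))
        (ℤ.+-monoʳ-≤ (G i + G i) (0≤* (0≤+n {4}) (0≤square (a i zero * a i zero)))))

    extend : ∀ b (s′ : Fin m → ℤ) → (∀ i → s′ i ≡ s i + sgn b * a i zero) →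
      goal ≤ sum (λ i → potential l (s′ i) (S i)) →
      ∃ λ (t : Fin (suc k) → Bool) →
        goal ≤ sum (λ i → potential l (s i + sum λ j → sgn (t j) * a i j) 0ℤ)
    extend b s′ s′≡ le =
      let t , le′ = greedy k (λ i j → a i (suc j)) s′
      in (λ { zero → b ; (suc j) → t j }) , ℤ.≤-trans le (ℤ.≤-trans le′ (ℤ.≤-reflexive
           (sum-cong λ i → cong (λ z → potential l z 0ℤ)
             (trans (cong (_+ sum (λ j → sgn (t j) * a i (suc j))) (s′≡ i))
                    (ℤ.+-assoc (s i) (sgn b * a i zero) (sum λ j → sgn (t j) * a i (suc j)))))))

    choose : (goal ≤ sum λ i → potential l (s i + a i zero) (S i))
             ⊎ (goal ≤ sum λ i → potential l (s i - a i zero) (S i)) →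
      ∃ λ (t : Fin (suc k) → Bool) →
        goal ≤ sum (λ i → potential l (s i + sum λ j → sgn (t j) * a i j) 0ℤ)
    choose (inj₁ le) = extend false (λ i → s i + a i zero)
      (λ i → cong (λ z → s i + z) (sym (ℤ.*-identityˡ (a i zero)))) le
    choose (inj₂ le) = extend true (λ i → s i - a i zero)
      (λ i → cong (λ z → s i + z) (sym (ℤ.-1*i≡-i (a i zero)))) le

  -- A derandomised Khintchine inequality.
  signs : ∀ {m k} (a : Fin m → Fin k → ℤ) → 0ℤ < l →
    (∀ i → + 6 * sum (λ j → a i j * a i j) ≤ l * l) →
    ∃₂ λ (s : Fin m → Bool) (t : Fin k → Bool) →
      sum (λ i → sum λ j → a i j * a i j)
      ≤ l * sum λ i → sum λ j → sgn (s i) * sgn (t j) * a i j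
  signs {m} {k} a 0<l small = s , t , subst (λ z → T ≤ l * z) (sum-cong absolute)
      (≤-*-cancelˡ (l * l) 0<ll (subst (l * l * T ≤_) (rearrange l M) chain))
    where
    rearrange : ∀ l M → l * l * l * M ≡ l * l * (l * M)
    rearrange = solve-∀
    0≤l = ℤ.<⇒≤ 0<l
    0<ll : 0ℤ < l * l
    0<ll = subst (_< l * l) (ℤ.*-zeroʳ l) (ℤ.*-monoˡ-<-pos l {{ℤ.positive 0<l}} 0<l)
    chosen = greedy k a (λ _ → 0ℤ)
    t = proj₁ chosen
    S L : Fin m → ℤ
    S i = sum λ j → a i j * a i j
    L i = sum λ j → sgn (t j) * a i j
    s : Fin m → Bool
    s i = proj₁ (∣∣-sgn (L i))
    T = sum S
    M = sum λ i → + ℤ.∣ L i ∣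
    absolute : ∀ i → + ℤ.∣ L i ∣ ≡ sum λ j → sgn (s i) * sgn (t j) * a i j
    absolute i = trans (sym (proj₂ (∣∣-sgn (L i))))
      (trans (*-distribˡ-sum (sgn (s i)) (λ j → sgn (t j) * a i j))
             (sum-cong λ j → sym (ℤ.*-assoc (sgn (s i)) (sgn (t j)) (a i j))))
    -- Twice the potential of a row is at least l² S at the start and at most l³ |L| at the end; the
    -- common factor l² is cancelled afterwards.
    chain : l * l * T ≤ l * l * l * M
    chain = begin
      l * l * T
        ≡⟨ *-distribˡ-sum (l * l) S ⟩
      sum (λ i → l * l * S i)
        ≤⟨ sum-mono (λ i → potential-initial l (S i) (sum-nonneg λ j → 0≤square (a i j)) (small i)) ⟩
      sum (λ i → + 2 * potential l 0ℤ (S i))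
        ≡⟨ sym (*-distribˡ-sum (+ 2) λ i → potential l 0ℤ (S i)) ⟩
      + 2 * sum (λ i → potential l 0ℤ (S i))
        ≤⟨ *-monoˡ (0≤+n {2}) (proj₂ chosen) ⟩
      + 2 * sum (λ i → potential l (0ℤ + L i) 0ℤ)
        ≡⟨ *-distribˡ-sum (+ 2) (λ i → potential l (0ℤ + L i) 0ℤ) ⟩
      sum (λ i → + 2 * potential l (0ℤ + L i) 0ℤ)
        ≤⟨ sum-mono (λ i → subst (λ z → + 2 * potential l z 0ℤ ≤ l * l * l * + ℤ.∣ L i ∣)
             (sym (ℤ.+-identityˡ (L i))) (potential-final l (L i) 0≤l)) ⟩
      sum (λ i → l * l * l * + ℤ.∣ L i ∣)
        ≡⟨ sym (*-distribˡ-sum (l * l * l) λ i → + ℤ.∣ L i ∣) ⟩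
      l * l * l * M ∎
      where open ℤ.≤-Reasoning

-- Alternating sums of a regular graph

-- Cauchy-Schwarz for four terms with signs + - - +; the six squares are those of Lagrange's
-- identity.
alt²≤ : ∀ a b c d → (a - b - c + d) * (a - b - c + d) ≤ + 4 * (a * a + b * b + c * c + d * d)
alt²≤ a b c d = by-diff (subst (0ℤ ≤_) (identity a b c d)
  (0≤+ (0≤+ (0≤+ (0≤square (a + b)) (0≤square (a + c))) (0≤+ (0≤square (a - d)) (0≤square (b - c))))
       (0≤+ (0≤square (b + d)) (0≤square (c + d)))))
  where
  identity : ∀ p q u v →
    (p + q) * (p + q) + (p + u) * (p + u) + ((p - v) * (p - v) + (q - u) * (q - u)) + ((q + v) * (q + v) + (u + v) * (u + v))
    ≡ + 4 * (p * p + q * q + u * u + v * v) - (p - q - u + v) * (p - q - u + v)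
  identity = solve-∀

quad : {V : Set} → (V → V → ℤ) → Vec V 4 → ℤ
quad M (x ∷ y ∷ z ∷ w ∷ []) = alt M x y z w * alt M x y z w

quad≥0 : {V : Set} (M : V → V → ℤ) → ∀ y → 0ℤ ≤ quad M y
quad≥0 M (x ∷ y ∷ z ∷ w ∷ []) = 0≤square (alt M x y z w)

distinct-quads : (Fin n → Fin n → ℤ) → ℤ
distinct-quads M = sumV 4 λ y → D y * quad M y

distinct₄ : (x y z w : Fin n) → x ≢ y → x ≢ z → x ≢ w → y ≢ z → y ≢ w → z ≢ w →
            Distinct (x ∷ y ∷ z ∷ w ∷ [])
distinct₄ x y z w xy xz xw yz yw zw = λ where
  zero zero e → refl
  zero (suc zero) e → ⊥-elim (xy e)
  zero (suc (suc zero)) e → ⊥-elim (xz e)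
  zero (suc (suc (suc zero))) e → ⊥-elim (xw e)
  (suc zero) zero e → ⊥-elim (xy (sym e))
  (suc zero) (suc zero) e → refl
  (suc zero) (suc (suc zero)) e → ⊥-elim (yz e)
  (suc zero) (suc (suc (suc zero))) e → ⊥-elim (yw e)
  (suc (suc zero)) zero e → ⊥-elim (xz (sym e))
  (suc (suc zero)) (suc zero) e → ⊥-elim (yz (sym e))
  (suc (suc zero)) (suc (suc zero)) e → refl
  (suc (suc zero)) (suc (suc (suc zero))) e → ⊥-elim (zw e)
  (suc (suc (suc zero))) zero e → ⊥-elim (xw (sym e))
  (suc (suc (suc zero))) (suc zero) e → ⊥-elim (yw (sym e))
  (suc (suc (suc zero))) (suc (suc zero)) e → ⊥-elim (zw (sym e))
  (suc (suc (suc zero))) (suc (suc (suc zero))) e → refl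

δ : Fin n → Fin n → ℤ
δ i j = ⟦ i Fin.≟ j ⟧

δ≥0 : (i j : Fin n) → 0ℤ ≤ δ i j
δ≥0 i j = ⟦⟧≥0 (i Fin.≟ j)

coincidences : Fin n → Fin n → Fin n → Fin n → ℤ
coincidences x y z w = δ x z + δ y z + (δ x w + δ y w)

module _ (M : Fin n → Fin n → ℤ) where

  -- For x = y or z = w the alternating sum itself is zero, so `coincidences` has to count only
  -- equalities between the two pairs; each of these makes the left side nonpositive.
  distinct-lower : ∀ x y z w →
    quad M (x ∷ y ∷ z ∷ w ∷ []) - coincidences x y z w * quad M (x ∷ y ∷ z ∷ w ∷ [])
    ≤ D (x ∷ y ∷ z ∷ w ∷ []) * quad M (x ∷ y ∷ z ∷ w ∷ [])
  distinct-lower x y z w = by-cases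
    (x Fin.≟ y) (z Fin.≟ w) (x Fin.≟ z) (x Fin.≟ w) (y Fin.≟ z) (y Fin.≟ w)
    where
    Q = quad M (x ∷ y ∷ z ∷ w ∷ [])
    c = coincidences x y z w
    d = D (x ∷ y ∷ z ∷ w ∷ [])
    0≤Q : 0ℤ ≤ Q
    0≤Q = 0≤square (alt M x y z w)
    0≤c : 0ℤ ≤ c
    0≤c = 0≤+ (0≤+ (δ≥0 x z) (δ≥0 y z)) (0≤+ (δ≥0 x w) (δ≥0 y w))
    0≤dQ : 0ℤ ≤ d * Q
    0≤dQ = 0≤* (D≥0 (x ∷ y ∷ z ∷ w ∷ [])) 0≤Q
    vanishing : alt M x y z w ≡ 0ℤ → Q - c * Q ≤ d * Q
    vanishing e = ℤ.≤-trans (ℤ.≤-reflexive Q-cQ≡0) 0≤dQ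
      where
      Q-cQ≡0 : Q - c * Q ≡ 0ℤ
      Q-cQ≡0 = trans (cong (λ a → a * a - c * (a * a)) e) (cong (λ q → 0ℤ - q) (ℤ.*-zeroʳ c))
    coincident : 1ℤ ≤ c → Q - c * Q ≤ d * Q
    coincident 1≤c = ℤ.≤-trans (by-diff (subst (0ℤ ≤_) (eq c Q) (0≤* (diff≥0 1≤c) 0≤Q))) 0≤dQ
      where
      eq : ∀ c Q → (c - 1ℤ) * Q ≡ 0ℤ - (Q - c * Q)
      eq = solve-∀
    ≤-left : ∀ {a b} → 0ℤ ≤ b → 1ℤ ≤ a → 1ℤ ≤ a + b
    ≤-left 0≤b 1≤a = ℤ.+-mono-≤ 1≤a 0≤b
    ≤-right : ∀ {a b} → 0ℤ ≤ a → 1ℤ ≤ b → 1ℤ ≤ a + b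
    ≤-right 0≤a 1≤b = ℤ.+-mono-≤ 0≤a 1≤b
    hit : {i j : Fin n} → i ≡ j → 1ℤ ≤ δ i j
    hit {i} {j} e = ℤ.≤-reflexive (sym (⟦⟧-yes (i Fin.≟ j) e))
    by-cases : Dec (x ≡ y) → Dec (z ≡ w) → Dec (x ≡ z) → Dec (x ≡ w) → Dec (y ≡ z) → Dec (y ≡ w) →
               Q - c * Q ≤ d * Q
    by-cases (yes e) _ _ _ _ _ = vanishing (trans
      (cong (λ v → M x z - M x w - M v z + M v w) (sym e)) (rows (M x z) (M x w)))
      where
      rows : ∀ a b → a - b - a + b ≡ 0ℤ
      rows = solve-∀
    by-cases _ (yes e) _ _ _ _ = vanishing (trans
      (cong (λ v → M x z - M x v - M y z + M y v) (sym e)) (columns (M x z) (M y z)))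
      where
      columns : ∀ a b → a - a - b + b ≡ 0ℤ
      columns = solve-∀
    by-cases _ _ (yes e) _ _ _ = coincident (≤-left (0≤+ (δ≥0 x w) (δ≥0 y w)) (≤-left (δ≥0 y z) (hit e)))
    by-cases _ _ _ (yes e) _ _ = coincident (≤-right (0≤+ (δ≥0 x z) (δ≥0 y z)) (≤-left (δ≥0 y w) (hit e)))
    by-cases _ _ _ _ (yes e) _ = coincident (≤-left (0≤+ (δ≥0 x w) (δ≥0 y w)) (≤-right (δ≥0 x z) (hit e)))
    by-cases _ _ _ _ _ (yes e) = coincident (≤-right (0≤+ (δ≥0 x z) (δ≥0 y z)) (≤-right (δ≥0 x w) (hit e)))
    by-cases (no xy) (no zw) (no xz) (no xw) (no yz) (no yw) = subst (Q - c * Q ≤_)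
      (sym (trans (cong (_* Q) (⟦⟧-yes (distinct? (x ∷ y ∷ z ∷ w ∷ [])) (distinct₄ x y z w xy xz xw yz yw zw)))
                  (ℤ.*-identityˡ Q)))
      (by-diff (subst (0ℤ ≤_) (eq c Q) (0≤* 0≤c 0≤Q)))
      where
      eq : ∀ c Q → c * Q ≡ Q - (Q - c * Q)
      eq = solve-∀

variance : (a : Fin n → ℤ) →
  sum (λ z → sum λ w → (a z - a w) * (a z - a w))
  ≡ + 2 * (+ n * sum (λ z → a z * a z) - sum a * sum a)
variance {n} a = begin
  sum (λ z → sum λ w → (a z - a w) * (a z - a w))
    ≡⟨ sum-cong (λ z → trans (sum-cong λ w → expand (a z) (a w)) (row z)) ⟩
  sum (λ z → + n * (a z * a z) + S + c * a z)
    ≡⟨ trans (∑-distrib-+ (λ z → + n * (a z * a z) + S) (λ z → c * a z))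
        (cong₂ _+_ (∑-distrib-+ (λ z → + n * (a z * a z)) (λ _ → S)) (sym (*-distribˡ-sum c a))) ⟩
  sum (λ z → + n * (a z * a z)) + sum {n} (λ _ → S) + c * s
    ≡⟨ cong (_+ c * s) (cong₂ _+_ (sym (*-distribˡ-sum (+ n) (λ z → a z * a z))) (sum-const n S)) ⟩
  + n * S + + n * S + c * s
    ≡⟨ collect (+ n) S s ⟩
  + 2 * (+ n * S - s * s) ∎
  where
  open ≡-Reasoning
  s = sum a
  S = sum λ z → a z * a z
  c = - (+ 2) * s
  expand : ∀ p q → (p - q) * (p - q) ≡ p * p + q * q + - (+ 2) * p * q
  expand = solve-∀
  collect : ∀ n S s → n * S + n * S + - (+ 2) * s * s ≡ + 2 * (n * S - s * s)
  collect = solve-∀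
  row : ∀ z → sum (λ w → a z * a z + a w * a w + - (+ 2) * a z * a w) ≡ + n * (a z * a z) + S + c * a z
  row z = begin
    sum (λ w → a z * a z + a w * a w + - (+ 2) * a z * a w)
      ≡⟨ ∑-distrib-+ (λ w → a z * a z + a w * a w) (λ w → - (+ 2) * a z * a w) ⟩
    sum (λ w → a z * a z + a w * a w) + sum (λ w → - (+ 2) * a z * a w)
      ≡⟨ cong₂ _+_ (∑-distrib-+ (λ _ → a z * a z) (λ w → a w * a w))
                   (sym (*-distribˡ-sum (- (+ 2) * a z) a)) ⟩
    sum {n} (λ _ → a z * a z) + S + - (+ 2) * a z * s
      ≡⟨ cong₂ (λ p q → p + S + q) (sum-const n (a z * a z)) (turn (a z) s) ⟩
    + n * (a z * a z) + S + c * a z ∎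
    where
    turn : ∀ p s → - (+ 2) * p * s ≡ - (+ 2) * s * p
    turn = solve-∀

module RegularMatrix {n : ℕ} (F : Fin n → Fin n → ℤ) (d : ℤ)
  (idem : ∀ v w → F v w * F v w ≡ F v w) (F-sym : ∀ v w → F v w ≡ F w v)
  (diag : ∀ v → F v v ≡ 0ℤ) (row : ∀ v → sum (F v) ≡ d) where

  private
    N = + n

  F≥0 : ∀ v w → 0ℤ ≤ F v w
  F≥0 v w = subst (0ℤ ≤_) (idem v w) (0≤square (F v w))

  column : ∀ w → sum (λ v → F v w) ≡ d
  column w = trans (sum-cong λ v → F-sym v w) (row w)

  -- Regularity enters twice. The difference `b x y` of two rows has sum zero, so the square of the
  -- mean drops out of the variance; equal row and column sums then make the sum of `b²` over y and
  -- z equal to 2 d (N - d) for every x.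
  all-quads : sum (λ x → sum λ y → sum λ z → sum λ w → quad F (x ∷ y ∷ z ∷ w ∷ []))
              ≡ + 4 * (N * N * (d * (N - d)))
  all-quads = begin
    sum (λ x → sum λ y → sum λ z → sum λ w → quad F (x ∷ y ∷ z ∷ w ∷ []))
      ≡⟨ sum-cong (λ x → sum-cong λ y → pair x y) ⟩
    sum (λ x → sum λ y → + 2 * N * sum λ z → b x y z * b x y z)
      ≡⟨ sum-cong (λ x → trans (sym (*-distribˡ-sum (+ 2 * N) λ y → sum λ z → b x y z * b x y z))
           (cong (+ 2 * N *_) (one x))) ⟩
    sum {n} (λ x → + 2 * N * (+ 2 * (d * (N - d))))
      ≡⟨ sum-const n _ ⟩
    N * (+ 2 * N * (+ 2 * (d * (N - d))))
      ≡⟨ collect N (d * (N - d)) ⟩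
    + 4 * (N * N * (d * (N - d))) ∎
    where
    open ≡-Reasoning
    collect : ∀ N e → N * (+ 2 * N * (+ 2 * e)) ≡ + 4 * (N * N * e)
    collect = solve-∀
    b : Fin n → Fin n → Fin n → ℤ
    b x y z = F x z - F y z
    pair : ∀ x y → sum (λ z → sum λ w → quad F (x ∷ y ∷ z ∷ w ∷ []))
                   ≡ + 2 * N * sum λ z → b x y z * b x y z
    pair x y = begin
      sum (λ z → sum λ w → quad F (x ∷ y ∷ z ∷ w ∷ []))
        ≡⟨ sum-cong (λ z → sum-cong λ w → cong (λ a → a * a) (regroup (F x z) (F x w) (F y z) (F y w))) ⟩
      sum (λ z → sum λ w → (b x y z - b x y w) * (b x y z - b x y w))
        ≡⟨ variance (b x y) ⟩
      + 2 * (N * B - sum (b x y) * sum (b x y))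
        ≡⟨ cong (λ s → + 2 * (N * B - s * s)) (trans (sum-minus (F x) (F y))
             (trans (cong₂ _-_ (row x) (row y)) (ℤ.+-inverseʳ d))) ⟩
      + 2 * (N * B - 0ℤ * 0ℤ)
        ≡⟨ drop N B ⟩
      + 2 * N * B ∎
      where
      B = sum λ z → b x y z * b x y z
      regroup : ∀ p q u v → p - q - u + v ≡ (p - u) - (q - v)
      regroup = solve-∀
      drop : ∀ N B → + 2 * (N * B - 0ℤ * 0ℤ) ≡ + 2 * N * B
      drop = solve-∀
    one : ∀ x → sum (λ y → sum λ z → b x y z * b x y z) ≡ + 2 * (d * (N - d))
    one x = begin
      sum (λ y → sum λ z → b x y z * b x y z)
        ≡⟨ ∑-comm (λ y z → b x y z * b x y z) ⟩
      sum (λ z → sum λ y → b x y z * b x y z)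
        ≡⟨ sum-cong (λ z → trans (sum-cong λ y → square z y) (inner z)) ⟩
      sum (λ z → (N - + 2 * d) * F x z + d)
        ≡⟨ ∑-distrib-+ (λ z → (N - + 2 * d) * F x z) (λ _ → d) ⟩
      sum (λ z → (N - + 2 * d) * F x z) + sum {n} (λ _ → d)
        ≡⟨ cong₂ _+_ (trans (sym (*-distribˡ-sum (N - + 2 * d) (F x))) (cong ((N - + 2 * d) *_) (row x)))
             (sum-const n d) ⟩
      (N - + 2 * d) * d + N * d
        ≡⟨ finish N d ⟩
      + 2 * (d * (N - d)) ∎
      where
      finish : ∀ N d → (N - + 2 * d) * d + N * d ≡ + 2 * (d * (N - d))
      finish = solve-∀
      square : ∀ z y → b x y z * b x y z ≡ F x z + (1ℤ - + 2 * F x z) * F y z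
      square z y = trans (expand (F x z) (F y z)) (trans
        (cong₂ (λ p q → p + q - + 2 * (F x z * F y z)) (idem x z) (idem y z))
        (factor (F x z) (F y z)))
        where
        expand : ∀ p q → (p - q) * (p - q) ≡ p * p + q * q - + 2 * (p * q)
        expand = solve-∀
        factor : ∀ p q → p + q - + 2 * (p * q) ≡ p + (1ℤ - + 2 * p) * q
        factor = solve-∀
      inner : ∀ z → sum (λ y → F x z + (1ℤ - + 2 * F x z) * F y z) ≡ (N - + 2 * d) * F x z + d
      inner z = begin
        sum (λ y → F x z + (1ℤ - + 2 * F x z) * F y z)
          ≡⟨ ∑-distrib-+ (λ _ → F x z) (λ y → (1ℤ - + 2 * F x z) * F y z) ⟩
        sum {n} (λ _ → F x z) + sum (λ y → (1ℤ - + 2 * F x z) * F y z)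
          ≡⟨ cong₂ _+_ (sum-const n (F x z)) (trans (sym (*-distribˡ-sum (1ℤ - + 2 * F x z) λ y → F y z))
               (cong ((1ℤ - + 2 * F x z) *_) (column z))) ⟩
        N * F x z + (1ℤ - + 2 * F x z) * d
          ≡⟨ tidy N (F x z) d ⟩
        (N - + 2 * d) * F x z + d ∎
        where
        tidy : ∀ N p d → N * p + (1ℤ - + 2 * p) * d ≡ (N - + 2 * d) * p + d
        tidy = solve-∀

  quad≤ : ∀ x y z w → quad F (x ∷ y ∷ z ∷ w ∷ []) ≤ + 4 * (F x z + F x w + F y z + F y w)
  quad≤ x y z w = ℤ.≤-trans (alt²≤ (F x z) (F x w) (F y z) (F y w)) (ℤ.≤-reflexive (cong (+ 4 *_)
    (cong₂ _+_ (cong₂ _+_ (cong₂ _+_ (idem x z) (idem x w)) (idem y z)) (idem y w))))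

  -- A coincidence removes one of the four summations. Bounding `quad F` by entries of F keeps the
  -- factor d, so the loss is smaller than the main term by a factor of order N - d.
  coincident-quads :
    sum (λ x → sum λ y → sum λ z → sum λ w → coincidences x y z w * quad F (x ∷ y ∷ z ∷ w ∷ []))
    ≤ + 48 * (N * N * d)
  coincident-quads = begin
    sum (λ x → sum λ y → sum λ z → sum λ w → coincidences x y z w * quad F (x ∷ y ∷ z ∷ w ∷ []))
      ≤⟨ sum-mono (λ x → sum-mono λ y → pair x y) ⟩
    sum (λ x → sum λ y → + 32 * d + + 16 * N * F x y)
      ≡⟨ sum-cong (λ x → trans (∑-distrib-+ (λ _ → + 32 * d) (λ y → + 16 * N * F x y))
           (cong₂ _+_ (sum-const n (+ 32 * d))
             (trans (sym (*-distribˡ-sum (+ 16 * N) (F x))) (cong (+ 16 * N *_) (row x))))) ⟩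
    sum {n} (λ x → N * (+ 32 * d) + + 16 * N * d)
      ≡⟨ sum-const n _ ⟩
    N * (N * (+ 32 * d) + + 16 * N * d)
      ≡⟨ collect N d ⟩
    + 48 * (N * N * d) ∎
    where
    open ℤ.≤-Reasoning
    collect : ∀ N d → N * (N * (+ 32 * d) + + 16 * N * d) ≡ + 48 * (N * N * d)
    collect = solve-∀
    module _ (x y : Fin n) where
      Q : Fin n → Fin n → ℤ
      Q z w = quad F (x ∷ y ∷ z ∷ w ∷ [])
      bound : Fin n → Fin n → ℤ
      bound z w = + 4 * (F x z + F x w + F y z + F y w)
      sum-bound : ∀ z → sum (bound z) ≡ + 4 * (N * (F x z + F y z) + + 2 * d)
      sum-bound z = trans (sym (*-distribˡ-sum (+ 4) (λ w → F x z + F x w + F y z + F y w)))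
        (cong (+ 4 *_) (trans (sum-cong λ w → shuffle (F x z) (F x w) (F y z) (F y w))
          (trans (∑-distrib-+ (λ _ → F x z + F y z) (λ w → F x w + F y w))
            (cong₂ _+_ (sum-const n (F x z + F y z))
              (trans (∑-distrib-+ (F x) (F y)) (trans (cong₂ _+_ (row x) (row y)) (double d)))))))
        where
        shuffle : ∀ p q u v → p + q + u + v ≡ p + u + (q + v)
        shuffle = solve-∀
        double : ∀ d → d + d ≡ + 2 * d
        double = solve-∀
      bound-sym : ∀ z w → bound z w ≡ bound w z
      bound-sym z w = shuffle (F x z) (F x w) (F y z) (F y w)
        where
        shuffle : ∀ p q u v → + 4 * (p + q + u + v) ≡ + 4 * (q + p + v + u)
        shuffle = solve-∀
      pick : Fin n → ℤ
      pick z = δ x z + δ y z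
      pick≥0 : ∀ z → 0ℤ ≤ pick z
      pick≥0 z = 0≤+ (δ≥0 x z) (δ≥0 y z)
      sum-pick : (g : Fin n → ℤ) → sum (λ z → pick z * g z) ≡ g x + g y
      sum-pick g = trans (sum-cong λ z → ℤ.*-distribʳ-+ (g z) (δ x z) (δ y z))
        (trans (∑-distrib-+ (λ z → δ x z * g z) (λ z → δ y z * g z)) (cong₂ _+_ (sum-δ x g) (sum-δ y g)))
      half = + 16 * d + + 8 * N * F x y
      picked : sum (λ z → pick z * sum (bound z)) ≡ half
      picked = trans (sum-pick (λ z → sum (bound z)))
        (trans (cong₂ _+_ (sum-bound x) (sum-bound y))
        (trans (cong₂ (λ p q → + 4 * (N * p + + 2 * d) + + 4 * (N * q + + 2 * d))
                 (cong₂ _+_ (diag x) (F-sym y x)) (cong₂ _+_ (refl {x = F x y}) (diag y)))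
               (tidy N d (F x y))))
        where
        tidy : ∀ N d p → + 4 * (N * (0ℤ + p) + + 2 * d) + + 4 * (N * (p + 0ℤ) + + 2 * d)
               ≡ + 16 * d + + 8 * N * p
        tidy = solve-∀
      pair : sum (λ z → sum λ w → coincidences x y z w * Q z w) ≤ + 32 * d + + 16 * N * F x y
      pair = begin
        sum (λ z → sum λ w → (pick z + pick w) * Q z w)
          ≤⟨ sum-mono (λ z → sum-mono λ w → *-monoˡ (0≤+ (pick≥0 z) (pick≥0 w)) (quad≤ x y z w)) ⟩
        sum (λ z → sum λ w → (pick z + pick w) * bound z w)
          ≡⟨ sum-cong (λ z → trans (sum-cong λ w → ℤ.*-distribʳ-+ (bound z w) (pick z) (pick w))
               (∑-distrib-+ (λ w → pick z * bound z w) (λ w → pick w * bound z w))) ⟩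
        sum (λ z → sum (λ w → pick z * bound z w) + sum (λ w → pick w * bound z w))
          ≡⟨ ∑-distrib-+ (λ z → sum λ w → pick z * bound z w) (λ z → sum λ w → pick w * bound z w) ⟩
        sum (λ z → sum λ w → pick z * bound z w) + sum (λ z → sum λ w → pick w * bound z w)
          ≡⟨ cong₂ _+_ first (trans (∑-comm λ z w → pick w * bound z w)
               (trans (sum-cong λ w → sum-cong λ z → cong (pick w *_) (bound-sym z w)) first)) ⟩
        half + half
          ≡⟨ tidy d N (F x y) ⟩
        + 32 * d + + 16 * N * F x y ∎
        where
        first : sum (λ z → sum λ w → pick z * bound z w) ≡ half
        first = trans (sum-cong λ z → sym (*-distribˡ-sum (pick z) (bound z))) picked
        tidy : ∀ d N p → + 16 * d + + 8 * N * p + (+ 16 * d + + 8 * N * p) ≡ + 32 * d + + 16 * N * p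
        tidy = solve-∀

  -- The number 24 is exactly what makes the coincident part 48 N² d at most half of the full sum 4
  -- N² d (N - d).
  distinct-quads≥ : 0ℤ ≤ d → + 24 ≤ N - d → + 2 * (N * N * (d * (N - d))) ≤ distinct-quads F
  distinct-quads≥ 0≤d 24≤k = begin
    + 2 * (N * N * (d * (N - d)))
      ≤⟨ by-diff (subst (0ℤ ≤_) (eq N d) (0≤* (0≤* (0≤+n {2}) (0≤* (0≤square N) 0≤d)) (diff≥0 24≤k))) ⟩
    + 4 * (N * N * (d * (N - d))) - + 48 * (N * N * d)
      ≤⟨ ℤ.+-monoʳ-≤ (+ 4 * (N * N * (d * (N - d)))) (ℤ.neg-mono-≤ coincident-quads) ⟩
    + 4 * (N * N * (d * (N - d))) - sum (λ x → sum λ y → sum λ z → sum λ w → c x y z w)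
      ≡⟨ cong (_- sum (λ x → sum λ y → sum λ z → sum λ w → c x y z w)) (sym all-quads) ⟩
    sum (λ x → sum λ y → sum λ z → sum λ w → q x y z w) - sum (λ x → sum λ y → sum λ z → sum λ w → c x y z w)
      ≡⟨ sym (trans (sum-cong λ x → trans (sum-cong λ y → trans (sum-cong λ z → sum-minus (q x y z) (c x y z))
           (sum-minus (λ z → sum (q x y z)) (λ z → sum (c x y z))))
           (sum-minus (λ y → sum λ z → sum (q x y z)) (λ y → sum λ z → sum (c x y z))))
           (sum-minus (λ x → sum λ y → sum λ z → sum (q x y z)) (λ x → sum λ y → sum λ z → sum (c x y z)))) ⟩
    sum (λ x → sum λ y → sum λ z → sum λ w → q x y z w - c x y z w)
      ≤⟨ sum-mono (λ x → sum-mono λ y → sum-mono λ z → sum-mono λ w → distinct-lower F x y z w) ⟩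
    distinct-quads F ∎
    where
    open ℤ.≤-Reasoning
    q c : Fin n → Fin n → Fin n → Fin n → ℤ
    q x y z w = quad F (x ∷ y ∷ z ∷ w ∷ [])
    c x y z w = coincidences x y z w * q x y z w
    eq : ∀ N d → + 2 * (N * N * d) * (N - d - + 24)
         ≡ + 4 * (N * N * (d * (N - d))) - + 48 * (N * N * d) - + 2 * (N * N * (d * (N - d)))
    eq = solve-∀

  -- Two rows differ in at most 2 d places and, by looking at the complement, in at most 2 (N - d)
  -- places. Writing N = d + (N - d) and using the better suited bound on each part keeps the
  -- product d (N - d).
  row-difference : ∀ x y → N * sum (λ v → (F x v - F y v) * (F x v - F y v)) ≤ + 4 * (d * (N - d))
  row-difference x y = begin
    N * E                                        ≡⟨ split N d E ⟩
    d * E + (N - d) * E                          ≤⟨ ℤ.+-mono-≤ (*-monoˡ 0≤d E≤k) (*-monoˡ 0≤k E≤d) ⟩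
    d * (+ 2 * (N - d)) + (N - d) * (+ 2 * d)    ≡⟨ collect N d ⟩
    + 4 * (d * (N - d))                          ∎
    where
    open ℤ.≤-Reasoning
    E = sum λ v → (F x v - F y v) * (F x v - F y v)
    split : ∀ N d E → N * E ≡ d * E + (N - d) * E
    split = solve-∀
    collect : ∀ N d → d * (+ 2 * (N - d)) + (N - d) * (+ 2 * d) ≡ + 4 * (d * (N - d))
    collect = solve-∀
    F≤1 : ∀ v w → 0ℤ ≤ 1ℤ - F v w
    F≤1 v w = subst (0ℤ ≤_) (trans (expand (F v w)) (trans (cong (λ s → 1ℤ - + 2 * F v w + s) (idem v w)) (tidy (F v w))))
      (0≤square (1ℤ - F v w))
      where
      expand : ∀ p → (1ℤ - p) * (1ℤ - p) ≡ 1ℤ - + 2 * p + p * p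
      expand = solve-∀
      tidy : ∀ p → 1ℤ - + 2 * p + p ≡ 1ℤ - p
      tidy = solve-∀
    sum-1-F : ∀ v → sum (λ w → 1ℤ - F v w) ≡ N - d
    sum-1-F v = trans (sum-minus (λ _ → 1ℤ) (F v))
      (cong₂ _-_ (trans (sum-const n 1ℤ) (ℤ.*-identityʳ N)) (row v))
    0≤d = subst (0ℤ ≤_) (row x) (sum-nonneg (F≥0 x))
    0≤k = subst (0ℤ ≤_) (sum-1-F x) (sum-nonneg (F≤1 x))
    double : ∀ d → d + d ≡ + 2 * d
    double = solve-∀
    E≤d : E ≤ + 2 * d
    E≤d = subst (E ≤_) (trans (∑-distrib-+ (F x) (F y)) (trans (cong₂ _+_ (row x) (row y)) (double d)))
      (sum-mono λ v → by-diff (subst (0ℤ ≤_) (eq v) (0≤* (0≤+n {2}) (0≤* (F≥0 x v) (F≥0 y v)))))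
      where
      sq : ∀ p q → + 2 * (p * q) ≡ p * p + q * q - (p - q) * (p - q)
      sq = solve-∀
      eq : ∀ v → + 2 * (F x v * F y v) ≡ F x v + F y v - (F x v - F y v) * (F x v - F y v)
      eq v = trans (sq (F x v) (F y v))
        (cong (_- (F x v - F y v) * (F x v - F y v)) (cong₂ _+_ (idem x v) (idem y v)))
    E≤k : E ≤ + 2 * (N - d)
    E≤k = subst (E ≤_) (trans (∑-distrib-+ (λ v → 1ℤ - F x v) (λ v → 1ℤ - F y v))
        (trans (cong₂ _+_ (sum-1-F x) (sum-1-F y)) (double (N - d))))
      (sum-mono λ v → by-diff (subst (0ℤ ≤_) (eq v) (0≤* (0≤+n {2}) (0≤* (F≤1 x v) (F≤1 y v)))))
      where
      sq : ∀ p q → + 2 * ((1ℤ - p) * (1ℤ - q))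
           ≡ 1ℤ - p + (1ℤ - q) - (p - q) * (p - q) + (p * p - p) + (q * q - q)
      sq = solve-∀
      vanish : ∀ s p q → s + (p - p) + (q - q) ≡ s
      vanish = solve-∀
      eq : ∀ v → + 2 * ((1ℤ - F x v) * (1ℤ - F y v))
           ≡ 1ℤ - F x v + (1ℤ - F y v) - (F x v - F y v) * (F x v - F y v)
      eq v = trans (sq (F x v) (F y v)) (trans
        (cong₂ (λ a b → s + (a - F x v) + (b - F y v)) (idem x v) (idem y v))
        (vanish s (F x v) (F y v)))
        where s = 1ℤ - F x v + (1ℤ - F y v) - (F x v - F y v) * (F x v - F y v)

-- Alternating sums of a colouring

-- The indices are an entry of the colouring and the indicators of the signs + and -. Negation
-- exchanges the indicators, so whatever is shown for one sign applies to the other.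
data SignAt {n} (v w : Fin n) : ℤ → ℤ → ℤ → Set where
  diagonal : v ≡ w → SignAt v w 0ℤ 0ℤ 0ℤ
  plus     : v ≢ w → SignAt v w 1ℤ 1ℤ 0ℤ
  minus    : v ≢ w → SignAt v w (- 1ℤ) 0ℤ 1ℤ

negate-sign : {v w : Fin n} {a p q : ℤ} → SignAt v w a p q → SignAt v w (- a) q p
negate-sign (diagonal e) = diagonal e
negate-sign (plus v≢w)   = minus v≢w
negate-sign (minus v≢w)  = plus v≢w

square-≤⇒≤ : ∀ {a b} → 0ℤ ≤ a → 0ℤ ≤ b → a * a ≤ b * b → a ≤ b
square-≤⇒≤ {+ a} {+ b} _ _ aa≤bb with ℕ.≤-total a b
... | inj₁ a≤b = +≤+ a≤b
... | inj₂ b≤a with ℕ.m≤n⇒m<n∨m≡n b≤a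
...   | inj₂ refl = ℤ.≤-refl
...   | inj₁ b<a  = ⊥-elim (ℕ.<⇒≱ (ℕ.*-mono-< b<a b<a)
          (ℤ.drop‿+≤+ (subst₂ _≤_ (sym (ℤ.pos-* a a)) (sym (ℤ.pos-* b b)) aa≤bb)))

module Signed {n : ℕ} (f p q : Fin n → Fin n → ℤ)
  (f-sym : ∀ v w → f v w ≡ f w v)
  (signAt : ∀ v w → SignAt v w (f v w) (p v w) (q v w)) where

  N = + n

  0≤N : 0ℤ ≤ N
  0≤N = 0≤+n

  p≥0 : ∀ v w → 0ℤ ≤ p v w
  p≥0 v w with f v w | p v w | q v w | signAt v w
  ... | _ | _ | _ | diagonal _ = 0≤+n
  ... | _ | _ | _ | plus _     = 0≤+n
  ... | _ | _ | _ | minus _    = 0≤+n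

  p≤1 : ∀ v w → p v w ≤ 1ℤ
  p≤1 v w with f v w | p v w | q v w | signAt v w
  ... | _ | _ | _ | diagonal _ = 0≤+n
  ... | _ | _ | _ | plus _     = ℤ.≤-refl
  ... | _ | _ | _ | minus _    = 0≤+n

  q≥0 : ∀ v w → 0ℤ ≤ q v w
  q≥0 v w with f v w | p v w | q v w | signAt v w
  ... | _ | _ | _ | diagonal _ = 0≤+n
  ... | _ | _ | _ | plus _     = 0≤+n
  ... | _ | _ | _ | minus _    = 0≤+n

  q≤1 : ∀ v w → q v w ≤ 1ℤ
  q≤1 v w with f v w | p v w | q v w | signAt v w
  ... | _ | _ | _ | diagonal _ = 0≤+n
  ... | _ | _ | _ | plus _     = 0≤+n
  ... | _ | _ | _ | minus _    = ℤ.≤-refl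

  p-q≡f : ∀ v w → p v w - q v w ≡ f v w
  p-q≡f v w with f v w | p v w | q v w | signAt v w
  ... | _ | _ | _ | diagonal _ = refl
  ... | _ | _ | _ | plus _     = refl
  ... | _ | _ | _ | minus _    = refl

  p+q≡f² : ∀ v w → p v w + q v w ≡ f v w * f v w
  p+q≡f² v w with f v w | p v w | q v w | signAt v w
  ... | _ | _ | _ | diagonal _ = refl
  ... | _ | _ | _ | plus _     = refl
  ... | _ | _ | _ | minus _    = refl

  p+q≡1-δ : ∀ v w → p v w + q v w ≡ 1ℤ - δ v w
  p+q≡1-δ v w with f v w | p v w | q v w | signAt v w
  ... | _ | _ | _ | diagonal e = cong (λ z → 1ℤ - z) (sym (⟦⟧-yes (v Fin.≟ w) e))
  ... | _ | _ | _ | plus ≢     = cong (λ z → 1ℤ - z) (sym (⟦⟧-no (v Fin.≟ w) ≢))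
  ... | _ | _ | _ | minus ≢    = cong (λ z → 1ℤ - z) (sym (⟦⟧-no (v Fin.≟ w) ≢))

  f²≤1 : ∀ v w → f v w * f v w ≤ 1ℤ
  f²≤1 v w with f v w | p v w | q v w | signAt v w
  ... | _ | _ | _ | diagonal _ = 0≤+n
  ... | _ | _ | _ | plus _     = ℤ.≤-refl
  ... | _ | _ | _ | minus _    = ℤ.≤-refl

  sum-δ-row : (v : Fin n) → sum (δ v) ≡ 1ℤ
  sum-δ-row v = trans (sum-cong λ w → sym (ℤ.*-identityʳ (δ v w))) (sum-δ v (λ _ → 1ℤ))

  P Q r : Fin n → ℤ
  P v = sum (p v)
  Q v = sum (q v)
  r v = sum (f v)

  -- `P x` and `Q x` are the degrees of x in the two colours, so `P x * Q x` counts the two-edge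
  -- paths centred at x with one edge of each sign.
  cherries total-sign : ℤ
  cherries   = sum λ x → P x * Q x
  total-sign = sum r

  Q≥0 : ∀ v → 0ℤ ≤ Q v
  Q≥0 v = sum-nonneg (q≥0 v)

  Q≤N : ∀ v → Q v ≤ N
  Q≤N v = subst (Q v ≤_) (trans (sum-const n 1ℤ) (ℤ.*-identityʳ N)) (sum-mono (q≤1 v))

  P-Q≡r : ∀ v → P v - Q v ≡ r v
  P-Q≡r v = trans (sym (sum-minus (p v) (q v))) (sum-cong (p-q≡f v))

  P+Q≡N-1 : ∀ v → P v + Q v ≡ N - 1ℤ
  P+Q≡N-1 v = trans (sym (∑-distrib-+ (p v) (q v))) (trans (sum-cong (p+q≡1-δ v))
    (trans (sum-minus (λ _ → 1ℤ) (δ v))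
      (cong₂ _-_ (trans (sum-const n 1ℤ) (ℤ.*-identityʳ N)) (sum-δ-row v))))

  -- α z counts the paths z, x, z′ with edge signs +, −.
  α : Fin n → ℤ
  α z = sum λ x → p x z * Q x

  α≥0 : ∀ z → 0ℤ ≤ α z
  α≥0 z = sum-nonneg λ x → 0≤* (p≥0 x z) (Q≥0 x)

  α≤NN : ∀ z → α z ≤ N * N
  α≤NN z = subst (α z ≤_) (sum-const n N)
    (sum-mono λ x → subst (p x z * Q x ≤_) (ℤ.*-identityˡ N) (*-mono (p≥0 x z) 0≤N (p≤1 x z) (Q≤N x)))

  sum-α : sum α ≡ cherries
  sum-α = trans (∑-comm λ z x → p x z * Q x) (sum-cong λ x → sym (*-distribʳ-sum (Q x) (p x)))

  -- On a path z′, x, z, w with edge signs −, +, − the alternating sum is at least 2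
  -- unless the path closes up.
  path-quad : ∀ x w z z′ →
    + 4 * (p x z * q x z′ * q z w) ≤ D (x ∷ w ∷ z ∷ z′ ∷ []) * quad f (x ∷ w ∷ z ∷ z′ ∷ []) + + 4 * δ z′ w
  path-quad x w z z′ = main
    where
    Dq = D (x ∷ w ∷ z ∷ z′ ∷ []) * quad f (x ∷ w ∷ z ∷ z′ ∷ [])
    0≤Dq : 0ℤ ≤ Dq
    0≤Dq = 0≤* (D≥0 (x ∷ w ∷ z ∷ z′ ∷ [])) (quad≥0 f (x ∷ w ∷ z ∷ z′ ∷ []))
    trivial : ∀ {s} → s ≡ 0ℤ → + 4 * s ≤ Dq + + 4 * δ z′ w
    trivial refl = 0≤+ 0≤Dq (0≤* (0≤+n {4}) (δ≥0 z′ w))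

    value : ∀ {a p₀ q₀} → SignAt w z′ a p₀ q₀ → w ≢ z′ →
      + 4 ≤ (1ℤ - - 1ℤ - - 1ℤ + a) * (1ℤ - - 1ℤ - - 1ℤ + a)
    value (diagonal e) w≢z′ = ⊥-elim (w≢z′ e)
    value (plus _)  _ = +≤+ (s≤s (s≤s (s≤s (s≤s z≤n))))
    value (minus _) _ = ℤ.≤-refl

    contributes : f x z ≡ 1ℤ → f x z′ ≡ - 1ℤ → f z w ≡ - 1ℤ → x ≢ z → x ≢ z′ → z ≢ w →
                  + 4 ≤ Dq + + 4 * δ z′ w
    contributes fxz fxz′ fzw x≢z x≢z′ z≢w = by-cases (z′ Fin.≟ w)
      where
      1≢-1 : 1ℤ ≢ - 1ℤ
      1≢-1 ()
      x≢w : x ≢ w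
      x≢w e = 1≢-1 (trans (sym fxz) (trans (f-sym x z) (trans (cong (f z) e) fzw)))
      z≢z′ : z ≢ z′
      z≢z′ e = 1≢-1 (trans (sym fxz) (trans (cong (f x) e) fxz′))
      distinct : z′ ≢ w → Distinct (x ∷ w ∷ z ∷ z′ ∷ [])
      distinct z′≢w = distinct₄ x w z z′ x≢w x≢z x≢z′ (z≢w ∘ sym) (z′≢w ∘ sym) z≢z′
      alt-value : alt f x w z z′ ≡ 1ℤ - - 1ℤ - - 1ℤ + f w z′
      alt-value = cong (_+ f w z′) (cong₂ _-_ (cong₂ _-_ fxz fxz′) (trans (f-sym w z) fzw))
      by-cases : Dec (z′ ≡ w) → + 4 ≤ Dq + + 4 * δ z′ w
      by-cases (yes e) = subst (λ s → + 4 ≤ Dq + + 4 * s) (sym (⟦⟧-yes (z′ Fin.≟ w) e))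
        (ℤ.+-mono-≤ {0ℤ} {Dq} {+ 4} {+ 4} 0≤Dq ℤ.≤-refl)
      by-cases (no z′≢w) = subst₂ (λ s t → + 4 ≤ s + + 4 * t)
        (sym (trans (cong (_* quad f (x ∷ w ∷ z ∷ z′ ∷ [])) (⟦⟧-yes (distinct? (x ∷ w ∷ z ∷ z′ ∷ [])) (distinct z′≢w)))
                    (ℤ.*-identityˡ (quad f (x ∷ w ∷ z ∷ z′ ∷ [])))))
        (sym (⟦⟧-no (z′ Fin.≟ w) z′≢w))
        (subst (+ 4 ≤_) (trans (cong (λ a → a * a) (sym alt-value)) (sym (ℤ.+-identityʳ (quad f (x ∷ w ∷ z ∷ z′ ∷ [])))))
          (value (signAt w z′) (z′≢w ∘ sym)))

    go : ∀ {a₁ p₁ q₁ a₂ p₂ q₂ a₃ p₃ q₃} →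
         f x z ≡ a₁ → f x z′ ≡ a₂ → f z w ≡ a₃ →
         SignAt x z a₁ p₁ q₁ → SignAt x z′ a₂ p₂ q₂ → SignAt z w a₃ p₃ q₃ →
         + 4 * (p₁ * q₂ * q₃) ≤ Dq + + 4 * δ z′ w
    go _ _ _ (diagonal _) _ _ = trivial refl
    go _ _ _ (minus _)    _ _ = trivial refl
    go _ _ _ (plus _) (diagonal _) _ = trivial refl
    go _ _ _ (plus _) (plus _)     _ = trivial refl
    go _ _ _ (plus _) (minus _) (diagonal _) = trivial refl
    go _ _ _ (plus _) (minus _) (plus _)     = trivial refl
    go e₁ e₂ e₃ (plus x≢z) (minus x≢z′) (minus z≢w) = contributes e₁ e₂ e₃ x≢z x≢z′ z≢w

    main = go refl refl refl (signAt x z) (signAt x z′) (signAt z w)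

  paths : + 4 * sum (λ z → sum λ w → α z * q z w) ≤ distinct-quads f + + 4 * (N * N * N)
  paths = begin
    + 4 * sum (λ z → sum λ w → α z * q z w)
      ≡⟨ cong (+ 4 *_) reorder ⟩
    + 4 * sum (λ x → sum λ w → sum λ z → sum λ z′ → p x z * q x z′ * q z w)
      ≡⟨ trans (*-distribˡ-sum (+ 4) (λ x → sum λ w → sum λ z → sum λ z′ → p x z * q x z′ * q z w))
          (sum-cong λ x → trans (*-distribˡ-sum (+ 4) (λ w → sum λ z → sum λ z′ → p x z * q x z′ * q z w))
          (sum-cong λ w → trans (*-distribˡ-sum (+ 4) (λ z → sum λ z′ → p x z * q x z′ * q z w))
          (sum-cong λ z → *-distribˡ-sum (+ 4) (λ z′ → p x z * q x z′ * q z w)))) ⟩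
    sum (λ x → sum λ w → sum λ z → sum λ z′ → + 4 * (p x z * q x z′ * q z w))
      ≤⟨ sum-mono (λ x → sum-mono λ w → sum-mono λ z → sum-mono λ z′ → path-quad x w z z′) ⟩
    sum (λ x → sum λ w → sum λ z → sum λ z′ → dq x w z z′ + + 4 * δ z′ w)
      ≡⟨ sum-cong (λ x → trans (sum-cong λ w → trans (sum-cong λ z →
             trans (∑-distrib-+ (dq x w z) (λ z′ → + 4 * δ z′ w)) (cong (λ s → sum (dq x w z) + s) (δ-sum w)))
             (∑-distrib-+ (λ z → sum (dq x w z)) (λ _ → + 4)))
             (∑-distrib-+ (λ w → sum λ z → sum (dq x w z)) (λ _ → sum {n} λ _ → + 4))) ⟩
    sum (λ x → sum (λ w → sum λ z → sum (dq x w z)) + sum {n} (λ w → sum {n} λ z → + 4))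
      ≡⟨ ∑-distrib-+ (λ x → sum λ w → sum λ z → sum (dq x w z)) (λ x → sum {n} λ w → sum {n} λ z → + 4) ⟩
    distinct-quads f + sum {n} (λ x → sum {n} λ w → sum {n} λ z → + 4)
      ≡⟨ cong (λ s → distinct-quads f + s) (trans
           (trans (sum-cong {n} λ x → trans (sum-cong {n} λ w → sum-const n (+ 4)) (sum-const n (N * + 4)))
                  (sum-const n (N * (N * + 4)))) (cube N)) ⟩
    distinct-quads f + + 4 * (N * N * N) ∎
    where
    open ℤ.≤-Reasoning
    cube : ∀ N → N * (N * (N * + 4)) ≡ + 4 * (N * N * N)
    cube = solve-∀
    dq : Fin n → Fin n → Fin n → Fin n → ℤ
    dq x w z z′ = D (x ∷ w ∷ z ∷ z′ ∷ []) * quad f (x ∷ w ∷ z ∷ z′ ∷ [])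
    δ-sum : ∀ w → sum (λ z′ → + 4 * δ z′ w) ≡ + 4
    δ-sum w = trans (sym (*-distribˡ-sum (+ 4) (λ z′ → δ z′ w))) (cong (+ 4 *_)
      (trans (sum-cong λ z′ → ⟦⟧-cong (z′ Fin.≟ w) (w Fin.≟ z′) sym sym) (sum-δ-row w)))
    term : ∀ z w x → p x z * Q x * q z w ≡ sum λ z′ → p x z * q x z′ * q z w
    term z w x = trans (cong (_* q z w) (*-distribˡ-sum (p x z) (q x)))
      (*-distribʳ-sum (q z w) (λ z′ → p x z * q x z′))
    reorder : sum (λ z → sum λ w → α z * q z w)
              ≡ sum λ x → sum λ w → sum λ z → sum λ z′ → p x z * q x z′ * q z w
    reorder = trans
      (trans (sum-cong λ z → sum-cong λ w → trans (*-distribʳ-sum (q z w) (λ x → p x z * Q x)) (sum-cong (term z w)))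
        (trans (∑-comm λ z w → sum λ x → sum λ z′ → p x z * q x z′ * q z w)
          (sum-cong λ w → ∑-comm λ z x → sum λ z′ → p x z * q x z′ * q z w)))
      (∑-comm λ w x → sum λ z → sum λ z′ → p x z * q x z′ * q z w)

  -- Few cherries make almost every vertex nearly monochromatic; then
  -- 0 ≤ Σ (r x + r y − n f x y)² forces nearly all vertices to the same sign.
  few-cherries : + 12 ≤ N → + 32 * cherries ≤ N * N * N →
                 N * N * (N * N) ≤ + 4 * (total-sign * total-sign)
  few-cherries 12≤N few = ≤-*-cancelˡ (+ 2) (+<+ (s≤s z≤n))
    (by-diff (subst (0ℤ ≤_) (final N cherries total-sign) (0≤+ (0≤+ (0≤* (0≤+n {4}) square-sum≥0)
      (0≤* 0≤N (diff≥0 few))) (0≤+ (0≤* (0≤* (0≤* 0≤N 0≤N) 0≤N) (diff≥0 12≤N)) (0≤* (0≤+n {8}) (0≤* 0≤N 0≤N))))))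
    where
    open ≡-Reasoning
    μ = total-sign
    R₂ = sum λ x → r x * r x
    R-value : R₂ ≡ N * ((N - 1ℤ) * (N - 1ℤ)) - + 4 * cherries
    R-value = begin
      sum (λ x → r x * r x)
        ≡⟨ sum-cong (λ x → trans (cong₂ _*_ (sym (P-Q≡r x)) (sym (P-Q≡r x)))
             (trans (polarise (P x) (Q x)) (cong (λ s → s * s - + 4 * (P x * Q x)) (P+Q≡N-1 x)))) ⟩
      sum (λ x → (N - 1ℤ) * (N - 1ℤ) - + 4 * (P x * Q x))
        ≡⟨ sum-minus (λ _ → (N - 1ℤ) * (N - 1ℤ)) (λ x → + 4 * (P x * Q x)) ⟩
      sum {n} (λ _ → (N - 1ℤ) * (N - 1ℤ)) - sum (λ x → + 4 * (P x * Q x))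
        ≡⟨ cong₂ _-_ (sum-const n ((N - 1ℤ) * (N - 1ℤ))) (sym (*-distribˡ-sum (+ 4) λ x → P x * Q x)) ⟩
      N * ((N - 1ℤ) * (N - 1ℤ)) - + 4 * cherries ∎
      where
      polarise : ∀ p q → (p - q) * (p - q) ≡ (p + q) * (p + q) - + 4 * (p * q)
      polarise = solve-∀
    square-sum : sum (λ x → sum λ y → (r x + r y - N * f x y) * (r x + r y - N * f x y))
                 ≡ N * N * (N * (N - 1ℤ)) + + 2 * (μ * μ) - + 2 * (N * R₂)
    square-sum = begin
      sum (λ x → sum λ y → (r x + r y - N * f x y) * (r x + r y - N * f x y))
        ≡⟨ sum-cong (λ x → trans (sum-cong λ y → trans (expand (r x) (r y) N (f x y))
             (cong₂ _+_ (cong (λ s → r x * r x + r y * r y + + 2 * r x * r y + - (+ 2) * N * r x * f x y + s)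
               (cong (N * N *_) (sym (p+q≡f² x y)))) (refl {x = - (+ 2) * N * (r y * f x y)}))) (inner x)) ⟩
      sum (λ x → N * (r x * r x) + R₂ + + 2 * r x * μ + - (+ 2) * N * r x * r x + N * N * (N - 1ℤ)
                 + - (+ 2) * N * sum (λ y → r y * f x y))
        ≡⟨ sum-cong (λ x → gather N (r x) R₂ μ (sum λ y → r y * f x y)) ⟩
      sum (λ x → (- N * (r x * r x) + + 2 * μ * r x) + (R₂ + N * N * (N - 1ℤ) + - (+ 2) * N * sum (λ y → r y * f x y)))
        ≡⟨ ∑-distrib-+ (λ x → - N * (r x * r x) + + 2 * μ * r x) (λ x → R₂ + N * N * (N - 1ℤ) + - (+ 2) * N * sum (λ y → r y * f x y)) ⟩
      sum (λ x → - N * (r x * r x) + + 2 * μ * r x) + sum (λ x → R₂ + N * N * (N - 1ℤ) + - (+ 2) * N * sum (λ y → r y * f x y))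
        ≡⟨ cong₂ _+_
             (trans (∑-distrib-+ (λ x → - N * (r x * r x)) (λ x → + 2 * μ * r x))
               (cong₂ _+_ (sym (*-distribˡ-sum (- N) λ x → r x * r x)) (sym (*-distribˡ-sum (+ 2 * μ) r))))
             (trans (∑-distrib-+ (λ _ → R₂ + N * N * (N - 1ℤ)) (λ x → - (+ 2) * N * sum (λ y → r y * f x y)))
               (cong₂ _+_ (sum-const n (R₂ + N * N * (N - 1ℤ)))
                 (trans (sym (*-distribˡ-sum (- (+ 2) * N) λ x → sum λ y → r y * f x y))
                        (cong (- (+ 2) * N *_) cross)))) ⟩
      (- N * R₂ + + 2 * μ * μ) + (N * (R₂ + N * N * (N - 1ℤ)) + - (+ 2) * N * R₂)
        ≡⟨ collect N R₂ μ ⟩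
      N * N * (N * (N - 1ℤ)) + + 2 * (μ * μ) - + 2 * (N * R₂) ∎
      where
      expand : ∀ a b N c → (a + b - N * c) * (a + b - N * c)
        ≡ a * a + b * b + + 2 * a * b + - (+ 2) * N * a * c + N * N * (c * c) + - (+ 2) * N * (b * c)
      expand = solve-∀
      gather : ∀ N a R₂ μ s → N * (a * a) + R₂ + + 2 * a * μ + - (+ 2) * N * a * a + N * N * (N - 1ℤ) + - (+ 2) * N * s
        ≡ (- N * (a * a) + + 2 * μ * a) + (R₂ + N * N * (N - 1ℤ) + - (+ 2) * N * s)
      gather = solve-∀
      collect : ∀ N R₂ μ → (- N * R₂ + + 2 * μ * μ) + (N * (R₂ + N * N * (N - 1ℤ)) + - (+ 2) * N * R₂)
        ≡ N * N * (N * (N - 1ℤ)) + + 2 * (μ * μ) - + 2 * (N * R₂)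
      collect = solve-∀
      cross : sum (λ x → sum λ y → r y * f x y) ≡ R₂
      cross = trans (∑-comm λ x y → r y * f x y) (sum-cong λ y → trans (sym (*-distribˡ-sum (r y) λ x → f x y))
        (cong (r y *_) (sum-cong λ x → f-sym x y)))
      inner : ∀ x → sum (λ y → r x * r x + r y * r y + + 2 * r x * r y + - (+ 2) * N * r x * f x y
                              + N * N * (p x y + q x y) + - (+ 2) * N * (r y * f x y))
        ≡ N * (r x * r x) + R₂ + + 2 * r x * μ + - (+ 2) * N * r x * r x + N * N * (N - 1ℤ)
          + - (+ 2) * N * sum (λ y → r y * f x y)
      inner x =
        trans (∑-distrib-+ (λ y → r x * r x + r y * r y + + 2 * r x * r y + - (+ 2) * N * r x * f x y + N * N * (p x y + q x y))
                           (λ y → - (+ 2) * N * (r y * f x y)))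
        (cong₂ _+_
          (trans (∑-distrib-+ (λ y → r x * r x + r y * r y + + 2 * r x * r y + - (+ 2) * N * r x * f x y) (λ y → N * N * (p x y + q x y)))
          (cong₂ _+_
            (trans (∑-distrib-+ (λ y → r x * r x + r y * r y + + 2 * r x * r y) (λ y → - (+ 2) * N * r x * f x y))
            (cong₂ _+_
              (trans (∑-distrib-+ (λ y → r x * r x + r y * r y) (λ y → + 2 * r x * r y))
              (cong₂ _+_
                (trans (∑-distrib-+ (λ y → r x * r x) (λ y → r y * r y)) (cong (_+ R₂) (sum-const n (r x * r x))))
                (sym (*-distribˡ-sum (+ 2 * r x) r))))
              (sym (*-distribˡ-sum (- (+ 2) * N * r x) (f x)))))
            (trans (sym (*-distribˡ-sum (N * N) λ y → p x y + q x y))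
              (cong (N * N *_) (trans (∑-distrib-+ (p x) (q x)) (P+Q≡N-1 x))))))
          (sym (*-distribˡ-sum (- (+ 2) * N) λ y → r y * f x y)))
    square-sum≥0 : 0ℤ ≤ N * N * (N * (N - 1ℤ)) + + 2 * (μ * μ) - + 2 * (N * (N * ((N - 1ℤ) * (N - 1ℤ)) - + 4 * cherries))
    square-sum≥0 = subst (0ℤ ≤_) (trans square-sum (cong (λ R₂ → N * N * (N * (N - 1ℤ)) + + 2 * (μ * μ) - + 2 * (N * R₂)) R-value))
      (sum-nonneg λ x → sum-nonneg λ y → 0≤square (r x + r y - N * f x y))
    -- Four times the square sum is 8 μ² - 4 N⁴ + 32 N C + 12 N³ - 8 N². One N⁴ pays for 32 N C
    -- because there are few cherries, another for 12 N³ because N is at least 12.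
    final : ∀ N C μ →
      + 4 * (N * N * (N * (N - 1ℤ)) + + 2 * (μ * μ) - + 2 * (N * (N * ((N - 1ℤ) * (N - 1ℤ)) - + 4 * C)))
      + N * (N * N * N - + 32 * C) + (N * N * N * (N - + 12) + + 8 * (N * N))
      ≡ + 2 * (+ 4 * (μ * μ)) - + 2 * (N * N * (N * N))
    final = solve-∀

alt-neg : {V : Set} (M : V → V → ℤ) → ∀ x y z w → alt (λ v u → - M v u) x y z w ≡ - alt M x y z w
alt-neg M x y z w = eq (M x z) (M x w) (M y z) (M y w)
  where
  eq : ∀ a b c d → - a - - b - - c + - d ≡ - (a - b - c + d)
  eq = solve-∀

quad-neg : {V : Set} (M : V → V → ℤ) → ∀ y → quad (λ v u → - M v u) y ≡ quad M y
quad-neg M (x ∷ y ∷ z ∷ w ∷ []) = trans (cong (λ a → a * a) (alt-neg M x y z w)) (eq (alt M x y z w))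
  where
  eq : ∀ a → - a * - a ≡ a * a
  eq = solve-∀

-- From C ≥ N³ / 32, that is N⁶ ≤ 1024 C², the three bounds give N⁶ ≤ 1024 (N² V / 2 + 3 N⁵), hence
-- N⁴ ≤ 512 V + 3072 N³. The threshold 6144 = 2 · 3072 absorbs the last term into half of N⁴.
many-cherries-bound : ∀ N V C pp qq dd → + 6144 ≤ N → N * N * N ≤ + 32 * C → C * C ≡ pp + qq + dd →
  + 4 * pp ≤ N * N * (V + + 4 * (N * N * N)) → + 4 * qq ≤ N * N * (V + + 4 * (N * N * N)) →
  dd ≤ N * (N * N * (N * N)) → N * N * (N * N) ≤ + 1024 * V
many-cherries-bound N V C pp qq dd 6144≤N many C² pp≤ qq≤ dd≤ =
  by-diff (subst (0ℤ ≤_) (final (+ 256) (+ 1024) (+ 6144) N V refl refl)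
    (0≤+ (0≤* (0≤+n {2}) key) (0≤* N³≥0 (diff≥0 6144≤N))))
  where
  0<N : 0ℤ < N
  0<N = ℤ.<-≤-trans (+<+ (s≤s z≤n)) 6144≤N
  0≤N = ℤ.<⇒≤ 0<N
  0<NN : 0ℤ < N * N
  0<NN = subst (_< N * N) (ℤ.*-zeroʳ N) (ℤ.*-monoˡ-<-pos N {{ℤ.positive 0<N}} 0<N)
  N³≥0 : 0ℤ ≤ N * N * N
  N³≥0 = 0≤* (0≤* 0≤N 0≤N) 0≤N
  squares : N * N * N * (N * N * N) ≤ + 32 * C * (+ 32 * C)
  squares = *-mono N³≥0 (ℤ.≤-trans N³≥0 many) many many
  -- Large numerals enter the ring identities as variables related by equations, so that only small
  -- coefficients are normalised.
  combine : ∀ a e N V C² pp qq dd → e ≡ + 4 * a → C² ≡ pp + qq + dd →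
    (e * C² - N * N * N * (N * N * N))
    + (a * (N * N * (V + + 4 * (N * N * N)) - + 4 * pp)
    + (a * (N * N * (V + + 4 * (N * N * N)) - + 4 * qq)
    + e * (N * (N * N * (N * N)) - dd)))
    ≡ N * N * (+ 2 * a * V + + 12 * a * (N * N * N) - N * N * (N * N)) - N * N * 0ℤ
  combine a _ N V _ pp qq dd refl refl = identity a N V pp qq dd
    where
    identity : ∀ a N V pp qq dd → (+ 4 * a * (pp + qq + dd) - N * N * N * (N * N * N))
      + (a * (N * N * (V + + 4 * (N * N * N)) - + 4 * pp)
      + (a * (N * N * (V + + 4 * (N * N * N)) - + 4 * qq)
      + + 4 * a * (N * (N * N * (N * N)) - dd)))
      ≡ N * N * (+ 2 * a * V + + 12 * a * (N * N * N) - N * N * (N * N)) - N * N * 0ℤ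
    identity = solve-∀
  square-product : ∀ b e C → e ≡ b * b → b * C * (b * C) ≡ e * (C * C)
  square-product b _ C refl = identity b C
    where
    identity : ∀ b C → b * C * (b * C) ≡ b * b * (C * C)
    identity = solve-∀
  key : 0ℤ ≤ + 2 * + 256 * V + + 12 * + 256 * (N * N * N) - N * N * (N * N)
  key = ≤-*-cancelˡ (N * N) 0<NN (by-diff (subst (0ℤ ≤_) (combine (+ 256) (+ 1024) N V (C * C) pp qq dd refl C²)
    (0≤+ (diff≥0 (subst (N * N * N * (N * N * N) ≤_) (square-product (+ 32) (+ 1024) C refl) squares))
      (0≤+ (0≤* (0≤+n {256}) (diff≥0 pp≤))
      (0≤+ (0≤* (0≤+n {256}) (diff≥0 qq≤)) (0≤* (0≤+n {1024}) (diff≥0 dd≤)))))))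
  final : ∀ a b c N V → b ≡ + 4 * a → c ≡ + 24 * a →
    + 2 * (+ 2 * a * V + + 12 * a * (N * N * N) - N * N * (N * N)) + N * N * N * (N - c)
    ≡ b * V - N * N * (N * N)
  final a _ _ N V refl refl = identity a N V
    where
    identity : ∀ a N V → + 2 * (+ 2 * a * V + + 12 * a * (N * N * N) - N * N * (N * N)) + N * N * N * (N - + 24 * a)
               ≡ + 4 * a * V - N * N * (N * N)
    identity = solve-∀

module Cherries {n : ℕ} (f p q : Fin n → Fin n → ℤ)
  (f-sym : ∀ v w → f v w ≡ f w v) (p-sym : ∀ v w → p v w ≡ p w v)
  (signAt : ∀ v w → SignAt v w (f v w) (p v w) (q v w)) where

  module A = Signed f p q f-sym signAt
  -- The colouring with its signs reversed: its `α`, called β below, counts cherries whose edge at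
  -- the given end is negative.
  module B = Signed (λ v w → - f v w) q p (λ v w → cong -_ (f-sym v w)) (λ v w → negate-sign (signAt v w))
  open A using (N; 0≤N; cherries; α; total-sign)
  β = B.α
  V = distinct-quads f

  sum-β : sum β ≡ cherries
  sum-β = trans B.sum-α (sum-cong λ x → ℤ.*-comm (A.Q x) (A.P x))

  partition : ∀ z w → p z w + q z w + δ z w ≡ 1ℤ
  partition z w = trans (cong (_+ δ z w) (A.p+q≡1-δ z w)) (cancel (δ z w))
    where
    cancel : ∀ d → 1ℤ - d + d ≡ 1ℤ
    cancel = solve-∀

  -- Take a cherry ending at z with a positive edge and one ending at w with a negative edge. If zw
  -- is negative, it extends the first cherry to a path - + -, and the second cherry is only
  -- counted, by N². If zw is positive, the roles are exchanged, as in `p-part`. Thus every pair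
  -- with z ≠ w is charged to an alternating path.
  q-part : + 4 * sum (λ z → sum λ w → α z * β w * q z w) ≤ N * N * (V + + 4 * (N * N * N))
  q-part = begin
    + 4 * sum (λ z → sum λ w → α z * β w * q z w)
      ≤⟨ *-monoˡ (0≤+n {4}) (sum-mono λ z → sum-mono λ w → bound z w) ⟩
    + 4 * sum (λ z → sum λ w → N * N * (α z * q z w))
      ≡⟨ cong (+ 4 *_) (sym (trans (*-distribˡ-sum (N * N) λ z → sum λ w → α z * q z w)
           (sum-cong λ z → *-distribˡ-sum (N * N) λ w → α z * q z w))) ⟩
    + 4 * (N * N * sum (λ z → sum λ w → α z * q z w))
      ≡⟨ turn (N * N) (sum λ z → sum λ w → α z * q z w) ⟩
    N * N * (+ 4 * sum (λ z → sum λ w → α z * q z w))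
      ≤⟨ *-monoˡ (0≤* 0≤N 0≤N) A.paths ⟩
    N * N * (V + + 4 * (N * N * N)) ∎
    where
    open ℤ.≤-Reasoning
    turn : ∀ a s → + 4 * (a * s) ≡ a * (+ 4 * s)
    turn = solve-∀
    rearrange : ∀ a b c → b * (a * c) ≡ a * b * c
    rearrange = solve-∀
    bound : ∀ z w → α z * β w * q z w ≤ N * N * (α z * q z w)
    bound z w = subst (_≤ N * N * (α z * q z w)) (rearrange (α z) (β w) (q z w))
      (ℤ.*-monoʳ-≤-nonNeg (α z * q z w) {{ℤ.nonNegative (0≤* (A.α≥0 z) (A.q≥0 z w))}} (B.α≤NN w))

  p-part : + 4 * sum (λ z → sum λ w → α z * β w * p z w) ≤ N * N * (V + + 4 * (N * N * N))
  p-part = begin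
    + 4 * sum (λ z → sum λ w → α z * β w * p z w)
      ≤⟨ *-monoˡ (0≤+n {4}) (sum-mono λ z → sum-mono λ w → bound z w) ⟩
    + 4 * sum (λ z → sum λ w → N * N * (β w * p w z))
      ≡⟨ cong (+ 4 *_) (trans (∑-comm λ z w → N * N * (β w * p w z))
           (sym (trans (*-distribˡ-sum (N * N) λ z → sum λ w → β z * p z w)
           (sum-cong λ z → *-distribˡ-sum (N * N) λ w → β z * p z w)))) ⟩
    + 4 * (N * N * sum (λ z → sum λ w → β z * p z w))
      ≡⟨ turn (N * N) (sum λ z → sum λ w → β z * p z w) ⟩
    N * N * (+ 4 * sum (λ z → sum λ w → β z * p z w))
      ≤⟨ *-monoˡ (0≤* 0≤N 0≤N) B.paths ⟩
    N * N * (distinct-quads (λ v w → - f v w) + + 4 * (N * N * N))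
      ≡⟨ cong (λ s → N * N * (s + + 4 * (N * N * N)))
           (sumV-cong 4 {λ y → D y * quad (λ v w → - f v w) y} {λ y → D y * quad f y}
             λ y → cong (D y *_) (quad-neg f y)) ⟩
    N * N * (V + + 4 * (N * N * N)) ∎
    where
    open ℤ.≤-Reasoning
    turn : ∀ a s → + 4 * (a * s) ≡ a * (+ 4 * s)
    turn = solve-∀
    bound : ∀ z w → α z * β w * p z w ≤ N * N * (β w * p w z)
    bound z w = subst₂ _≤_ (sym (ℤ.*-assoc (α z) (β w) (p z w))) (cong (λ s → N * N * (β w * s)) (p-sym z w))
      (ℤ.*-monoʳ-≤-nonNeg (β w * p z w) {{ℤ.nonNegative (0≤* (B.α≥0 w) (A.p≥0 z w))}} (A.α≤NN z))

  δ-part : sum (λ z → sum λ w → α z * β w * δ z w) ≤ N * (N * N * (N * N))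
  δ-part = begin
    sum (λ z → sum λ w → α z * β w * δ z w)
      ≡⟨ sum-cong (λ z → trans (sum-cong λ w → ℤ.*-comm (α z * β w) (δ z w)) (sum-δ z (λ w → α z * β w))) ⟩
    sum (λ z → α z * β z)
      ≤⟨ sum-mono (λ z → *-mono (A.α≥0 z) (0≤* 0≤N 0≤N) (A.α≤NN z) (B.α≤NN z)) ⟩
    sum {n} (λ z → N * N * (N * N))
      ≡⟨ sum-const n (N * N * (N * N)) ⟩
    N * (N * N * (N * N)) ∎
    where open ℤ.≤-Reasoning

  cherries² : cherries * cherries ≡
    sum (λ z → sum λ w → α z * β w * p z w) + sum (λ z → sum λ w → α z * β w * q z w)
    + sum (λ z → sum λ w → α z * β w * δ z w)
  cherries² = begin
    cherries * cherries
      ≡⟨ cong₂ _*_ (sym A.sum-α) (sym sum-β) ⟩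
    sum α * sum β
      ≡⟨ trans (*-distribʳ-sum (sum β) α) (sum-cong λ z → *-distribˡ-sum (α z) β) ⟩
    sum (λ z → sum λ w → α z * β w)
      ≡⟨ sum-cong (λ z → trans (sum-cong λ w → split z w)
           (trans (∑-distrib-+ (λ w → α z * β w * p z w + α z * β w * q z w) (λ w → α z * β w * δ z w))
                  (cong (_+ sum (λ w → α z * β w * δ z w)) (∑-distrib-+ (λ w → α z * β w * p z w) (λ w → α z * β w * q z w))))) ⟩
    sum (λ z → sum (λ w → α z * β w * p z w) + sum (λ w → α z * β w * q z w) + sum (λ w → α z * β w * δ z w))
      ≡⟨ trans (∑-distrib-+ (λ z → sum (λ w → α z * β w * p z w) + sum (λ w → α z * β w * q z w)) (λ z → sum (λ w → α z * β w * δ z w)))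
               (cong (_+ sum (λ z → sum λ w → α z * β w * δ z w)) (∑-distrib-+ (λ z → sum (λ w → α z * β w * p z w)) (λ z → sum (λ w → α z * β w * q z w)))) ⟩
    sum (λ z → sum λ w → α z * β w * p z w) + sum (λ z → sum λ w → α z * β w * q z w)
      + sum (λ z → sum λ w → α z * β w * δ z w) ∎
    where
    open ≡-Reasoning
    expand : ∀ a p q d → a * (p + q + d) ≡ a * p + a * q + a * d
    expand = solve-∀
    split : ∀ z w → α z * β w ≡ α z * β w * p z w + α z * β w * q z w + α z * β w * δ z w
    split z w = trans (sym (ℤ.*-identityʳ (α z * β w)))
      (trans (cong (α z * β w *_) (sym (partition z w))) (expand (α z * β w) (p z w) (q z w) (δ z w)))

  many-cherries : + 6144 ≤ N → N * N * N ≤ + 32 * cherries → N * N * (N * N) ≤ + 1024 * V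
  many-cherries 6144≤N many = many-cherries-bound N V cherries
    (sum λ z → sum λ w → α z * β w * p z w) (sum λ z → sum λ w → α z * β w * q z w)
    (sum λ z → sum λ w → α z * β w * δ z w) 6144≤N many cherries² p-part q-part δ-part

  dichotomy : + 6144 ≤ N →
    (N * N * (N * N) ≤ + 4 * (total-sign * total-sign)) ⊎ (N * N * (N * N) ≤ + 1024 * V)
  dichotomy 6144≤N = Sum.map
    (A.few-cherries (ℤ.≤-trans (+≤+ (ℕ.≤ᵇ⇒≤ 12 6144 _)) 6144≤N)) (many-cherries 6144≤N)
    (ℤ.≤-total (+ 32 * cherries) (N * N * N))

-- Averaging over pairs of indices, and colourings of large mean

averaging₂ : ∀ {k a b} (g : Vec (Fin n) k → ℤ) → (∀ y → 0ℤ ≤ g y) →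
  (c : Fin a → Fin b → ℤ) → (∀ i j → 0ℤ ≤ c i j) →
  (p : Fin a → Fin b → Vec (Fin n) k) → (∀ i j → (c i j ≡ 0ℤ) ⊎ Distinct (p i j)) →
  ∃ λ (π : Permutation′ n) →
    sum (λ i → sum λ j → c i j) * sumV k (λ y → D y * g y)
    ≤ + (n ℕ.^ k) * sum λ i → sum λ j → c i j * g (Vec.map (π ⟨$⟩ʳ_) (p i j))
averaging₂ {n} {k} {a} {b} g 0≤g c 0≤c p dp =
  let π , le = averaging g 0≤g (λ e → c (row e) (column e)) (λ e → 0≤c (row e) (column e))
                 (λ e → p (row e) (column e)) (λ e → dp (row e) (column e))
  in π , subst₂ _≤_ (cong (_* sumV k (λ y → D y * g y)) (double c))
           (cong (+ (n ℕ.^ k) *_) (double λ i j → c i j * g (Vec.map (π ⟨$⟩ʳ_) (p i j)))) le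
  where
  row : Fin (a ℕ.* b) → Fin a
  row e = proj₁ (Fin.remQuot b e)
  column : Fin (a ℕ.* b) → Fin b
  column e = proj₂ (Fin.remQuot {a} b e)
  double : (h : Fin a → Fin b → ℤ) → sum (λ e → h (row e) (column e)) ≡ sum λ i → sum λ j → h i j
  double h = trans (sum-pairs a λ e → h (row e) (column e))
    (sum-cong λ i → sum-cong λ j → cong (λ ij → h (proj₁ ij) (proj₂ ij)) (Fin.remQuot-combine i j))

distinct₂ : (v w : Fin n) → v ≢ w → Distinct (v ∷ w ∷ [])
distinct₂ v w v≢w = λ where
  zero zero _ → refl
  zero (suc zero) e → ⊥-elim (v≢w e)
  (suc zero) zero e → ⊥-elim (v≢w (sym e))
  (suc zero) (suc zero) _ → refl

-- The terms N³ d cancel and leave N d (τ - N) ≤ N² X, where τ - N ≥ N² / 2 - N ≥ N² / 4 since N is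
-- at least 4.
large-mean-bound : ∀ N d τ X → + 4 ≤ N → 0ℤ ≤ d → N * N ≤ + 2 * τ →
  N * d * (N * N - N + τ) ≤ N * N * (N * d + X) → N * d ≤ + 4 * X
large-mean-bound N d τ X 4≤N 0≤d large averaged = ≤-*-cancelˡ (N * N) 0<NN
  (by-diff (subst (0ℤ ≤_) (identity N d τ X) (0≤+ (0≤* (0≤+n {4}) (diff≥0 averaged))
    (0≤+ (0≤* (0≤* (0≤+n {2}) 0≤Nd) (diff≥0 large)) (0≤* 0≤Nd (0≤* 0≤N (diff≥0 4≤N)))))))
  where
  0<N : 0ℤ < N
  0<N = ℤ.<-≤-trans (+<+ (s≤s z≤n)) 4≤N
  0≤N = ℤ.<⇒≤ 0<N
  0≤Nd = 0≤* 0≤N 0≤d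
  0<NN : 0ℤ < N * N
  0<NN = subst (_< N * N) (ℤ.*-zeroʳ N) (ℤ.*-monoˡ-<-pos N {{ℤ.positive 0<N}} 0<N)
  identity : ∀ N d τ X → + 4 * (N * N * (N * d + X) - N * d * (N * N - N + τ))
    + (+ 2 * (N * d) * (+ 2 * τ - N * N) + N * d * (N * (N - + 4)))
    ≡ N * N * (+ 4 * X) - N * N * (N * d)
  identity = solve-∀

module LargeMean {n : ℕ} (F : Fin n → Fin n → ℤ) (d : ℤ)
  (F≥0 : ∀ v w → 0ℤ ≤ F v w) (diag : ∀ v → F v v ≡ 0ℤ) (row : ∀ v → sum (F v) ≡ d)
  (f : Fin n → Fin n → ℤ) (f-diag : ∀ v → f v v ≡ 0ℤ)
  (s : Bool) (bounded : ∀ v w → 0ℤ ≤ 1ℤ + sgn s * f v w) where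

  private
    N = + n
    μ = sum λ v → sum λ w → f v w

    -- The shift by 1 makes the signed colour nonnegative, as `averaging` requires; on a copy it
    -- contributes the constant N d.
    g : Vec (Fin n) 2 → ℤ
    g (v ∷ w ∷ []) = 1ℤ + sgn s * f v w

    g≥0 : ∀ y → 0ℤ ≤ g y
    g≥0 (v ∷ w ∷ []) = bounded v w

    sum-F : sum (λ v → sum λ w → F v w) ≡ N * d
    sum-F = trans (sum-cong row) (sum-const n d)

    sum-g : sumV 2 (λ y → D y * g y) ≡ N * N - N + sgn s * μ
    sum-g = begin
      sum (λ v → sum λ w → D (v ∷ w ∷ []) * (1ℤ + sgn s * f v w))
        ≡⟨ sum-cong (λ v → trans (sum-cong λ w → term v w (v Fin.≟ w)) (inner v)) ⟩
      sum (λ v → N - 1ℤ + sgn s * sum (f v))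
        ≡⟨ ∑-distrib-+ (λ _ → N - 1ℤ) (λ v → sgn s * sum (f v)) ⟩
      sum {n} (λ _ → N - 1ℤ) + sum (λ v → sgn s * sum (f v))
        ≡⟨ cong₂ _+_ (trans (sum-const n (N - 1ℤ)) (expand N)) (sym (*-distribˡ-sum (sgn s) λ v → sum (f v))) ⟩
      N * N - N + sgn s * μ ∎
      where
      open ≡-Reasoning
      expand : ∀ N → N * (N - 1ℤ) ≡ N * N - N
      expand = solve-∀
      ones : ∀ a → 0ℤ * (1ℤ + a * 0ℤ) ≡ 1ℤ - 1ℤ + a * 0ℤ
      ones = solve-∀
      term : ∀ v w → Dec (v ≡ w) → D (v ∷ w ∷ []) * (1ℤ + sgn s * f v w) ≡ 1ℤ - δ v w + sgn s * f v w
      term v w (no v≢w) = trans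
        (cong (_* (1ℤ + sgn s * f v w)) (⟦⟧-yes (distinct? (v ∷ w ∷ [])) (distinct₂ v w v≢w)))
        (trans (ℤ.*-identityˡ (1ℤ + sgn s * f v w))
          (cong (λ e → 1ℤ - e + sgn s * f v w) (sym (⟦⟧-no (v Fin.≟ w) v≢w))))
      term v w (yes v≡w) = trans
        (cong₂ (λ a b → a * (1ℤ + sgn s * b))
          (⟦⟧-no (distinct? (v ∷ w ∷ [])) (λ dist → 0≢1 (dist zero (suc zero) v≡w))) fvw)
        (trans (ones (sgn s)) (cong₂ (λ a b → 1ℤ - a + sgn s * b) (sym (⟦⟧-yes (v Fin.≟ w) v≡w)) (sym fvw)))
        where
        0≢1 : _≢_ {A = Fin 2} zero (suc zero)
        0≢1 ()
        fvw : f v w ≡ 0ℤ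
        fvw = trans (cong (f v) (sym v≡w)) (f-diag v)
      inner : ∀ v → sum (λ w → 1ℤ - δ v w + sgn s * f v w) ≡ N - 1ℤ + sgn s * sum (f v)
      inner v = trans (∑-distrib-+ (λ w → 1ℤ - δ v w) (λ w → sgn s * f v w))
        (cong₂ _+_ (trans (sum-minus (λ _ → 1ℤ) (δ v))
            (cong₂ _-_ (trans (sum-const n 1ℤ) (ℤ.*-identityʳ N))
              (trans (sum-cong λ w → sym (ℤ.*-identityʳ (δ v w))) (sum-δ v (λ _ → 1ℤ)))))
          (sym (*-distribˡ-sum (sgn s) (f v))))

  sum-F-g : (π : Permutation′ n) →
    sum (λ v → sum λ w → F v w * (1ℤ + sgn s * f (π ⟨$⟩ʳ v) (π ⟨$⟩ʳ w))) ≡ N * d + sgn s * weight F f π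
  sum-F-g π = begin
    sum (λ v → sum λ w → F v w * (1ℤ + sgn s * fπ v w))
      ≡⟨ sum-cong (λ v → trans (sum-cong λ w → expand (F v w) (sgn s) (fπ v w))
           (trans (∑-distrib-+ (F v) (λ w → sgn s * (F v w * fπ v w)))
             (cong (λ z → sum (F v) + z) (sym (*-distribˡ-sum (sgn s) λ w → F v w * fπ v w))))) ⟩
    sum (λ v → sum (F v) + sgn s * sum (λ w → F v w * fπ v w))
      ≡⟨ trans (∑-distrib-+ (λ v → sum (F v)) (λ v → sgn s * sum (λ w → F v w * fπ v w)))
          (cong₂ _+_ sum-F (sym (*-distribˡ-sum (sgn s) λ v → sum (λ w → F v w * fπ v w)))) ⟩
    N * d + sgn s * weight F f π ∎
    where
    open ≡-Reasoning
    fπ : Fin n → Fin n → ℤ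
    fπ v w = f (π ⟨$⟩ʳ v) (π ⟨$⟩ʳ w)
    expand : ∀ a s b → a * (1ℤ + s * b) ≡ a + s * (a * b)
    expand = solve-∀

  large-mean : + 4 ≤ N → 0ℤ ≤ d → N * N ≤ + 2 * (sgn s * μ) →
    ∃ λ (π : Permutation′ n) → N * d ≤ + 4 * (sgn s * weight F f π)
  large-mean 4≤N 0≤d large =
    let π , le = averaging₂ g g≥0 F F≥0 (λ v w → v ∷ w ∷ []) edge-distinct
    in π , large-mean-bound N d (sgn s * μ) (sgn s * weight F f π) 4≤N 0≤d large
             (subst₂ _≤_ (cong₂ _*_ sum-F sum-g) (cong₂ _*_ n² (sum-F-g π)) le)
    where
    n² : + (n ℕ.^ 2) ≡ N * N
    n² = trans (cong (λ z → + (n ℕ.* z)) (ℕ.*-identityʳ n)) (ℤ.pos-* n n)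
    edge-distinct : ∀ v w → (F v w ≡ 0ℤ) ⊎ Distinct (v ∷ w ∷ [])
    edge-distinct v w = case (v Fin.≟ w)
      where
      case : Dec (v ≡ w) → (F v w ≡ 0ℤ) ⊎ Distinct (v ∷ w ∷ [])
      case (yes e)  = inj₁ (trans (cong (F v) (sym e)) (diag v))
      case (no v≢w) = inj₂ (distinct₂ v w v≢w)

-- Combining the estimates

-- The least l with K ≤ N l² satisfies N l² ≤ 4 K, as l ≤ 2 (l − 1) unless l = 1.
root-search : ∀ N K → 0ℤ ≤ N → ∀ fuel l → 0ℤ < l → N * (l * l) ≤ + 4 * K →
  K ≤ N * ((l + + fuel) * (l + + fuel)) →
  ∃ λ l → 0ℤ < l × K ≤ N * (l * l) × N * (l * l) ≤ + 4 * K
root-search N K 0≤N zero l 0<l upper lower =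
  l , 0<l , subst (λ z → K ≤ N * (z * z)) (ℤ.+-identityʳ l) lower , upper
root-search N K 0≤N (suc fuel) l 0<l upper lower with K ℤ.≤? N * (l * l)
... | yes K≤ = l , 0<l , K≤ , upper
... | no K≰  = root-search N K 0≤N fuel (l + 1ℤ) (ℤ.+-mono-<-≤ 0<l (0≤+n {1}))
    (by-diff (subst (0ℤ ≤_) (identity N K l) (0≤+ (0≤* (0≤+n {4}) (diff≥0 (ℤ.<⇒≤ (ℤ.≰⇒> K≰))))
      (0≤* 0≤N (0≤* (diff≥0 1≤l) (0≤+ (0≤* (0≤+n {3}) 0≤l) (0≤+n {1})))))))
    (subst (λ z → K ≤ N * (z * z)) (shift l (+ fuel)) lower)
  where
  0≤l = ℤ.<⇒≤ 0<l
  1≤l : 1ℤ ≤ l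
  1≤l = ℤ.i<j⇒suc[i]≤j 0<l
  identity : ∀ N K l → + 4 * (K - N * (l * l)) + N * ((l - 1ℤ) * (+ 3 * l + 1ℤ))
             ≡ + 4 * K - N * ((l + 1ℤ) * (l + 1ℤ))
  identity = solve-∀
  shift : ∀ l f → l + (1ℤ + f) ≡ l + 1ℤ + f
  shift = solve-∀

-- An integer stand-in for √(K / N). The search may start at l = 1 because N ≤ 4 K, and K steps are
-- enough because K ≤ (1 + K)².
root : ∀ N K → 0ℤ ≤ N → N ≤ + 4 * K → 0ℤ ≤ K → 0ℤ < N →
  ∃ λ l → 0ℤ < l × K ≤ N * (l * l) × N * (l * l) ≤ + 4 * K
root N K 0≤N N≤4K 0≤K 0<N = root-search N K 0≤N ℤ.∣ K ∣ 1ℤ (+<+ (s≤s z≤n))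
  (subst (_≤ + 4 * K) (sym (ℤ.*-identityʳ N)) N≤4K)
  (subst (λ z → K ≤ N * ((1ℤ + z) * (1ℤ + z))) (sym (ℤ.0≤i⇒+∣i∣≡i 0≤K))
    (by-diff (subst (0ℤ ≤_) (identity N K) (0≤+ (0≤* (diff≥0 1≤N) (0≤square (1ℤ + K)))
      (0≤+ (0≤+ (0≤+n {1}) 0≤K) (0≤square K))))))
  where
  1≤N : 1ℤ ≤ N
  1≤N = ℤ.i<j⇒suc[i]≤j 0<N
  identity : ∀ N K → (N - 1ℤ) * ((1ℤ + K) * (1ℤ + K)) + (1ℤ + K + K * K) ≡ N * ((1ℤ + K) * (1ℤ + K)) - K
  identity = solve-∀

0<product : ∀ {a b} → 0ℤ < a → 0ℤ < b → 0ℤ < a * b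
0<product {a} {b} 0<a 0<b = subst (_< a * b) (ℤ.*-zeroʳ a) (ℤ.*-monoˡ-<-pos a {{ℤ.positive 0<a}} 0<b)

-- Placing F gives C ≥ 2 e / b, since M is at least N² / b of the available pairs of pairs; placing
-- f with weights summing to C gives T ≥ C / a. All powers of N cancel.
double-average-bound : ∀ a b N M e VF Vf C T → 0ℤ < N → 0ℤ ≤ a → 0ℤ ≤ b → 0ℤ ≤ M → 0ℤ ≤ C → 0ℤ ≤ e →
  N * N ≤ b * M → N * N * (N * N) ≤ a * Vf → + 2 * (N * N * e) ≤ VF →
  M * VF ≤ N * N * (N * N) * C → C * Vf ≤ N * N * (N * N) * T → + 2 * e ≤ a * b * T
double-average-bound a b N M e VF Vf C T 0<N 0≤a 0≤b 0≤M 0≤C 0≤e N²≤ N⁴≤ VF≥ first second =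
  ≤-*-cancelˡ N⁴ 0<N⁴ (by-diff (subst (0ℤ ≤_) (identity₂ a b N M e VF C T)
    (0≤+ (0≤+ (0≤* (0≤* (0≤+n {2}) (0≤* 0≤N² 0≤e)) (diff≥0 N²≤)) (0≤* (0≤* 0≤b 0≤M) (diff≥0 VF≥)))
         (0≤+ (0≤* 0≤b (diff≥0 first)) (0≤* (0≤* 0≤N⁴ 0≤b) (diff≥0 C≤aT))))))
  where
  N⁴ = N * N * (N * N)
  0<N² = 0<product 0<N 0<N
  0≤N² = ℤ.<⇒≤ 0<N²
  0<N⁴ : 0ℤ < N⁴
  0<N⁴ = 0<product 0<N² 0<N²
  0≤N⁴ = ℤ.<⇒≤ 0<N⁴
  identity₁ : ∀ a N Vf C T → C * (a * Vf - N * N * (N * N)) + a * (N * N * (N * N) * T - C * Vf)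
              ≡ N * N * (N * N) * (a * T) - N * N * (N * N) * C
  identity₁ = solve-∀
  C≤aT : C ≤ a * T
  C≤aT = ≤-*-cancelˡ N⁴ 0<N⁴ (by-diff (subst (0ℤ ≤_) (identity₁ a N Vf C T)
    (0≤+ (0≤* 0≤C (diff≥0 N⁴≤)) (0≤* 0≤a (diff≥0 second)))))
  identity₂ : ∀ a b N M e VF C T →
    + 2 * (N * N * e) * (b * M - N * N) + b * M * (VF - + 2 * (N * N * e))
    + (b * (N * N * (N * N) * C - M * VF) + N * N * (N * N) * b * (a * T - C))
    ≡ N * N * (N * N) * (a * b * T) - N * N * (N * N) * (+ 2 * e)
  identity₂ = solve-∀

-- The first three bounds chain to e ≤ 2 A l x. Squaring brings in l², which the last bound replaces
-- by h e / N; one factor e then cancels.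
discrepancy-bound : ∀ A h N e T l Y x → 0ℤ < e → 0ℤ ≤ A → 0ℤ ≤ N → 0ℤ < l → 0ℤ ≤ x →
  + 2 * e ≤ A * T → T ≤ l * Y → Y ≤ + 4 * x → N * (l * l) ≤ h * e →
  N * e ≤ + 4 * (A * A) * h * (x * x)
discrepancy-bound A h N e T l Y x 0<e 0≤A 0≤N 0<l 0≤x 2e≤AT T≤lY Y≤4x Nl²≤he =
  ≤-*-cancelˡ e 0<e (by-diff (subst (0ℤ ≤_) (identity₂ A h N e l x)
    (0≤+ (0≤* 0≤N (diff≥0 e²≤)) (0≤* (0≤* (0≤* (0≤+n {4}) (0≤* 0≤A 0≤A)) (0≤* 0≤x 0≤x)) (diff≥0 Nl²≤he)))))
  where
  0≤e = ℤ.<⇒≤ 0<e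
  0≤l = ℤ.<⇒≤ 0<l
  b = + 2 * (A * l * x)
  e≤b : e ≤ b
  e≤b = ≤-*-cancelˡ (+ 2) (+<+ (s≤s z≤n)) (by-diff (subst (0ℤ ≤_) (identity₁ A e T l Y x)
    (0≤+ (diff≥0 2e≤AT) (0≤+ (0≤* 0≤A (diff≥0 T≤lY)) (0≤* (0≤* 0≤A 0≤l) (diff≥0 Y≤4x))))))
    where
    identity₁ : ∀ A e T l Y x → (A * T - + 2 * e) + (A * (l * Y - T) + A * l * (+ 4 * x - Y))
                ≡ + 2 * (+ 2 * (A * l * x)) - + 2 * e
    identity₁ = solve-∀
  e²≤ : e * e ≤ b * b
  e²≤ = *-mono 0≤e (ℤ.≤-trans 0≤e e≤b) e≤b e≤b
  identity₂ : ∀ A h N e l x →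
    N * (+ 2 * (A * l * x) * (+ 2 * (A * l * x)) - e * e) + + 4 * (A * A) * (x * x) * (h * e - N * (l * l))
    ≡ e * (+ 4 * (A * A) * h * (x * x)) - e * (N * e)
  identity₂ = solve-∀

-- Only the position of F relative to the colouring matters, so independent relabellings of the two
-- matrices still describe a copy of F in the original colouring.
weight-relabel : (F f : Fin n → Fin n → ℤ) (π₁ π₂ σ : Permutation′ n) →
  weight (λ v w → F (π₁ ⟨$⟩ʳ v) (π₁ ⟨$⟩ʳ w)) (λ v w → f (π₂ ⟨$⟩ʳ v) (π₂ ⟨$⟩ʳ w)) σ
  ≡ weight F f (Perm.flip π₁ Perm.∘ₚ (σ Perm.∘ₚ π₂))
weight-relabel {n} F f π₁ π₂ σ = sym (trans (sum-permute (λ v → sum λ w → h v w) π₁)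
  (sum-cong λ v → trans (sum-permute (h (π₁ ⟨$⟩ʳ v)) π₁)
    (sum-cong λ w → cong₂ (λ a b → F (π₁ ⟨$⟩ʳ v) (π₁ ⟨$⟩ʳ w) * f (π₂ ⟨$⟩ʳ (σ ⟨$⟩ʳ a)) (π₂ ⟨$⟩ʳ (σ ⟨$⟩ʳ b)))
                      (Perm.inverseˡ π₁) (Perm.inverseˡ π₁))))
  where
  ρ = Perm.flip π₁ Perm.∘ₚ (σ Perm.∘ₚ π₂)
  h : Fin n → Fin n → ℤ
  h v w = F v w * f (ρ ⟨$⟩ʳ v) (ρ ⟨$⟩ʳ w)

four-terms : ∀ a b c d {w₁ w₂ w₃ w₄ Y} → w₁ ≤ a + a → - w₂ ≤ b + b → - w₃ ≤ c + c → w₄ ≤ d + d →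
  w₁ - w₂ - w₃ + w₄ ≡ Y + Y →
  (Y ≤ + 4 * a) ⊎ (Y ≤ + 4 * b) ⊎ (Y ≤ + 4 * c) ⊎ (Y ≤ + 4 * d)
four-terms a b c d {w₁} {w₂} {w₃} {w₄} {Y} ha hb hc hd e
  with Y ℤ.≤? + 4 * a | Y ℤ.≤? + 4 * b | Y ℤ.≤? + 4 * c
... | yes y | _     | _     = inj₁ y
... | no _  | yes y | _     = inj₂ (inj₁ y)
... | no _  | no _  | yes y = inj₂ (inj₂ (inj₁ y))
... | no na | no nb | no nc = inj₂ (inj₂ (inj₂ (by-diff (subst (0ℤ ≤_) (identity a b c d Y)
    (0≤+ (0≤* (0≤+n {2}) sum≥0) (0≤+ (strict na) (0≤+ (strict nb) (strict nc))))))))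
  where
  strict : ∀ {z} → ¬ (Y ≤ z) → 0ℤ ≤ Y - z
  strict n = diff≥0 (ℤ.<⇒≤ (ℤ.≰⇒> n))
  sum≥0 : 0ℤ ≤ (a + a) + (b + b) + (c + c) + (d + d) - (Y + Y)
  sum≥0 = diff≥0 (subst (_≤ (a + a) + (b + b) + (c + c) + (d + d)) e (ℤ.+-mono-≤ (ℤ.+-mono-≤ (ℤ.+-mono-≤ ha hb) hc) hd))
  identity : ∀ a b c d Y → + 2 * ((a + a) + (b + b) + (c + c) + (d + d) - (Y + Y))
    + ((Y - + 4 * a) + ((Y - + 4 * b) + (Y - + 4 * c))) ≡ + 4 * d - Y
  identity = solve-∀

scale-bound : ∀ b κ N S e l → κ ≡ + 6 * b → 0ℤ < N → N * S ≤ b * e → κ * e ≤ N * (l * l) → + 6 * S ≤ l * l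
scale-bound b _ N S e l refl 0<N NS≤ κe≤ = ≤-*-cancelˡ N 0<N (by-diff (subst (0ℤ ≤_) (identity b N S e l)
  (0≤+ (0≤* (0≤+n {6}) (diff≥0 NS≤)) (diff≥0 κe≤))))
  where
  identity : ∀ b N S e l → + 6 * (b * e - N * S) + (N * (l * l) - + 6 * b * e) ≡ N * (l * l) - N * (+ 6 * S)
  identity = solve-∀

-- For d and N - d at least 1, N = d + (N - d) ≤ 2 d (N - d). This is the condition under which
-- `root` can start from 1.
order-bound : ∀ κ N d → 1ℤ ≤ κ → 1ℤ ≤ d → 1ℤ ≤ N - d → N ≤ + 4 * (κ * (d * (N - d)))
order-bound κ N d 1≤κ 1≤d 1≤k = by-diff (subst (0ℤ ≤_) (identity κ N d)
  (0≤+ (0≤+ (0≤* (0≤* (0≤+n {4}) (diff≥0 1≤κ)) (0≤* 0≤d 0≤k)) (0≤* (0≤+n {2}) (0≤* 0≤d 0≤k)))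
       (0≤+ (0≤* 0≤d (diff≥0 1≤k)) (0≤* 0≤k (diff≥0 1≤d)))))
  where
  0≤d = ℤ.≤-trans (0≤+n {1}) 1≤d
  0≤k = ℤ.≤-trans (0≤+n {1}) 1≤k
  identity : ∀ κ N d → + 4 * (κ - 1ℤ) * (d * (N - d)) + + 2 * (d * (N - d)) + (d * (N - d - 1ℤ) + (N - d) * (d - 1ℤ))
             ≡ + 4 * (κ * (d * (N - d))) - N
  identity = solve-∀

module LargeAlternation {m r : ℕ} (F f : Fin (size {m} {r}) → Fin (size {m} {r}) → ℤ) (d : ℤ)
  (idem : ∀ v w → F v w * F v w ≡ F v w) (F-sym : ∀ v w → F v w ≡ F w v)
  (diag : ∀ v → F v v ≡ 0ℤ) (row : ∀ v → sum (F v) ≡ d)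
  (f-sym : ∀ v w → f v w ≡ f w v) (f²≤1 : ∀ v w → f v w * f v w ≤ 1ℤ)
  (disc : Permutation′ (size {m} {r}) → ℤ) (disc≥0 : ∀ π → 0ℤ ≤ disc π)
  (weight≤ : ∀ π → weight F f π ≤ disc π + disc π) (-weight≤ : ∀ π → - weight F f π ≤ disc π + disc π) where

  private
    n′ = size {m} {r}
    V = Fin n′
    N = + n′
    e = d * (N - d)

    pos : Cell m r → V
    pos = position

    corners : Fin m → Fin m → Vec V 4
    corners i k = pos (U i false) ∷ pos (U i true) ∷ pos (W k false) ∷ pos (W k true) ∷ []

    corners-distinct : ∀ i k → Distinct (corners i k)
    corners-distinct i k = distinct₄ (pos (U i false)) (pos (U i true)) (pos (W k false)) (pos (W k true))
      (λ q → U≢U (inj {U i false} {U i true} q)) (λ q → U≢W (inj {U i false} {W k false} q))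
      (λ q → U≢W (inj {U i false} {W k true} q)) (λ q → U≢W (inj {U i true} {W k false} q))
      (λ q → U≢W (inj {U i true} {W k true} q)) (λ q → W≢W (inj {W k false} {W k true} q))
      where
      inj : ∀ {c c′} → pos c ≡ pos c′ → c ≡ c′
      inj = position-injective
      U≢U : ∀ {i} → _≢_ {A = Cell m r} (U i false) (U i true)
      U≢U ()
      W≢W : ∀ {i} → _≢_ {A = Cell m r} (W i false) (W i true)
      W≢W ()
      U≢W : ∀ {i k b c} → _≢_ {A = Cell m r} (U i b) (W k c)
      U≢W ()

    n⁴ : + (n′ ℕ.^ 4) ≡ N * N * (N * N)
    n⁴ = trans (ℤ.pos-* n′ (n′ ℕ.^ 3)) (trans (cong (N *_) (trans (ℤ.pos-* n′ (n′ ℕ.^ 2))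
      (cong (N *_) (trans (ℤ.pos-* n′ (n′ ℕ.^ 1)) (cong (λ z → N * + z) (ℕ.*-identityʳ n′)))))) (regroup N))
      where
      regroup : ∀ N → N * (N * (N * N)) ≡ N * N * (N * N)
      regroup = solve-∀

    relabel : (V → V → ℤ) → Permutation′ n′ → V → V → ℤ
    relabel M π v w = M (π ⟨$⟩ʳ v) (π ⟨$⟩ʳ w)

    M = + m * + m

    first : ∃ λ π → M * distinct-quads F ≤ N * N * (N * N) * sum λ i → sum λ k → quad (relabel F π) (corners i k)
    first =
      let π , le = averaging₂ (quad F) (quad≥0 F) (λ _ _ → 1ℤ) (λ _ _ → 0≤+n {1}) corners (λ i k → inj₂ (corners-distinct i k))
      in π , subst₂ _≤_ (cong (_* distinct-quads F) ones)
               (cong₂ _*_ n⁴ (sum-cong λ i → sum-cong λ k → ℤ.*-identityˡ (quad (relabel F π) (corners i k)))) le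
      where
      ones : sum {m} (λ _ → sum {m} λ _ → 1ℤ) ≡ M
      ones = trans (sum-cong {m} λ _ → trans (sum-const m 1ℤ) (ℤ.*-identityʳ (+ m))) (sum-const m (+ m))

    -- F has already been placed; the values `quad` takes on its corners are the weights with which
    -- the colouring is averaged.
    second : ∀ π₁ → ∃ λ π →
      sum (λ i → sum λ k → quad (relabel F π₁) (corners i k)) * distinct-quads f
      ≤ N * N * (N * N) * sum λ i → sum λ k → quad (relabel F π₁) (corners i k) * quad (relabel f π) (corners i k)
    second π₁ =
      let π , le = averaging₂ (quad f) (quad≥0 f) (λ i k → quad F₁ (corners i k)) (λ i k → quad≥0 F₁ (corners i k))
                     corners (λ i k → inj₂ (corners-distinct i k))
      in π , subst (λ z → sum (λ i → sum λ k → quad F₁ (corners i k)) * distinct-quads f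
               ≤ z * sum λ i → sum λ k → quad F₁ (corners i k) * quad (relabel f π) (corners i k)) n⁴ le
      where
      F₁ : V → V → ℤ
      F₁ = relabel F π₁

    module RM = RegularMatrix F d idem F-sym diag row

  private module Relabelled (π₁ π₂ : Permutation′ n′) where

    F₁ f₁ : V → V → ℤ
    F₁ = relabel F π₁
    f₁ = relabel f π₂

    module RM₁ = RegularMatrix F₁ d (λ v w → idem (π₁ ⟨$⟩ʳ v) (π₁ ⟨$⟩ʳ w)) (λ v w → F-sym (π₁ ⟨$⟩ʳ v) (π₁ ⟨$⟩ʳ w))
      (λ v → diag (π₁ ⟨$⟩ʳ v)) (λ v → trans (sym (sum-permute (F (π₁ ⟨$⟩ʳ v)) π₁)) (row (π₁ ⟨$⟩ʳ v)))
    module Bil = Bilinear {m} {r} F₁ f₁ (λ v w → F-sym (π₁ ⟨$⟩ʳ v) (π₁ ⟨$⟩ʳ w)) (λ v w → f-sym (π₂ ⟨$⟩ʳ v) (π₂ ⟨$⟩ʳ w))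

    a : Fin m → Fin m → ℤ
    a i k = Bil.u-alt F₁ i k * Bil.u-alt f₁ i k

    S : Fin m → ℤ
    S i = sum λ k → a i k * a i k

    T = sum S

    T-quads : sum (λ i → sum λ k → quad F₁ (corners i k) * quad f₁ (corners i k)) ≡ T
    T-quads = sum-cong λ i → sum-cong λ k → squares (Bil.u-alt F₁ i k) (Bil.u-alt f₁ i k)
      where
      squares : ∀ x y → x * x * (y * y) ≡ x * y * (x * y)
      squares = solve-∀

    -- The factor A_f² is at most 16 and A_F² at most 2 (E z + E w), with E the squared difference
    -- of the two rows of F. The W-pairs are disjoint, so these add up to at most the whole row
    -- difference, and 16 · 2 · 4 = 128. Being uniform in i, the bound allows one scale `l` for all
    -- rows.
    S-bound : ∀ i → N * S i ≤ + 128 * e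
    S-bound i = begin
      N * S i
        ≤⟨ *-monoˡ (0≤+n {n′}) (ℤ.≤-trans (sum-mono λ k → term k)
             (ℤ.≤-trans (ℤ.≤-reflexive (sym (*-distribˡ-sum (+ 32) λ k → E (pos (W k false)) + E (pos (W k true)))))
                        (*-monoˡ (0≤+n {32}) W≤all))) ⟩
      N * (+ 32 * sum E)
        ≡⟨ turn N (sum E) ⟩
      + 32 * (N * sum E)
        ≤⟨ *-monoˡ (0≤+n {32}) (RM₁.row-difference x y) ⟩
      + 32 * (+ 4 * e)
        ≡⟨ sym (ℤ.*-assoc (+ 32) (+ 4) e) ⟩
      + 128 * e ∎
      where
      open ℤ.≤-Reasoning
      x = pos (U i false)
      y = pos (U i true)
      turn : ∀ N s → N * (+ 32 * s) ≡ + 32 * (N * s)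
      turn = solve-∀
      Δ E : V → ℤ
      Δ v = F₁ x v - F₁ y v
      E v = Δ v * Δ v
      E≥0 : ∀ v → 0ℤ ≤ E v
      E≥0 v = 0≤square (Δ v)
      W≤all : sum (λ k → E (pos (W k false)) + E (pos (W k true))) ≤ sum E
      W≤all = subst (sW ≤_) (sym (sum-position {m} {r} E))
        (by-diff (subst (0ℤ ≤_) (rest sU sW sR) (0≤+
          (sum-nonneg λ i → 0≤+ (E≥0 (pos (U i false))) (E≥0 (pos (U i true)))) (sum-nonneg λ j → E≥0 (pos (R j))))))
        where
        sU = sum λ i → E (pos (U i false)) + E (pos (U i true))
        sW = sum λ k → E (pos (W k false)) + E (pos (W k true))
        sR = sum λ j → E (pos (R j))
        rest : ∀ u w r → u + r ≡ u + (w + r) - w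
        rest = solve-∀
      term : ∀ k → a i k * a i k ≤ + 32 * (E (pos (W k false)) + E (pos (W k true)))
      term k = begin
        a i k * a i k
          ≡⟨ squares (Bil.u-alt F₁ i k) (Bil.u-alt f₁ i k) ⟩
        Bil.u-alt F₁ i k * Bil.u-alt F₁ i k * (Bil.u-alt f₁ i k * Bil.u-alt f₁ i k)
          ≤⟨ *-mono (0≤square (Bil.u-alt F₁ i k)) (0≤+n {16}) F-part f-part ⟩
        + 2 * (E z + E w) * + 16
          ≡⟨ collect (E z + E w) ⟩
        + 32 * (E z + E w) ∎
        where
        z = pos (W k false)
        w = pos (W k true)
        squares : ∀ x y → x * y * (x * y) ≡ x * x * (y * y)
        squares = solve-∀
        collect : ∀ s → + 2 * s * + 16 ≡ + 32 * s
        collect = solve-∀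
        F-part : Bil.u-alt F₁ i k * Bil.u-alt F₁ i k ≤ + 2 * (E z + E w)
        F-part = by-diff (subst (0ℤ ≤_) (identity (F₁ x z) (F₁ x w) (F₁ y z) (F₁ y w)) (0≤square (Δ z + Δ w)))
          where
          identity : ∀ p q u v → (p - u + (q - v)) * (p - u + (q - v))
            ≡ + 2 * ((p - u) * (p - u) + (q - v) * (q - v)) - (p - q - u + v) * (p - q - u + v)
          identity = solve-∀
        f-part : Bil.u-alt f₁ i k * Bil.u-alt f₁ i k ≤ + 16
        f-part = ℤ.≤-trans (alt²≤ (f₁ x z) (f₁ x w) (f₁ y z) (f₁ y w))
          (*-monoˡ {b = + 4} (0≤+n {4}) (ℤ.+-mono-≤ (ℤ.+-mono-≤ (ℤ.+-mono-≤ (f²≤1 (π₂ ⟨$⟩ʳ x) (π₂ ⟨$⟩ʳ z)) (f²≤1 (π₂ ⟨$⟩ʳ x) (π₂ ⟨$⟩ʳ w)))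
            (f²≤1 (π₂ ⟨$⟩ʳ y) (π₂ ⟨$⟩ʳ z))) (f²≤1 (π₂ ⟨$⟩ʳ y) (π₂ ⟨$⟩ʳ w))))

    swapped : (s t : Fin m → Bool) → Permutation′ n′
    swapped s t = Perm.flip π₁ Perm.∘ₚ (swapPerm {m} {r} s t Perm.∘ₚ π₂)

    swapped-≤ : ∀ s t → weight F₁ f₁ (swapPerm s t) ≤ disc (swapped s t) + disc (swapped s t)
    swapped-≤ s t = subst (_≤ disc (swapped s t) + disc (swapped s t))
      (sym (weight-relabel F f π₁ π₂ (swapPerm s t))) (weight≤ (swapped s t))

    swapped--≤ : ∀ s t → - weight F₁ f₁ (swapPerm s t) ≤ disc (swapped s t) + disc (swapped s t)
    swapped--≤ s t = subst (λ z → - z ≤ disc (swapped s t) + disc (swapped s t))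
      (sym (weight-relabel F f π₁ π₂ (swapPerm s t))) (-weight≤ (swapped s t))

    form-disc : ∀ s t → ∃ λ π → Bil.form s t ≤ + 4 * disc π
    form-disc s t = choose (four-terms (disc π-st) (disc π-s̄t) (disc π-st̄) (disc π-s̄t̄)
        (swapped-≤ s t) (swapped--≤ s̄ t) (swapped--≤ s t̄) (swapped-≤ s̄ t̄) (Bil.bilinear s t))
      where
      s̄ t̄ : Fin m → Bool
      s̄ i = not (s i)
      t̄ k = not (t k)
      π-st  = swapped s t
      π-s̄t  = swapped s̄ t
      π-st̄  = swapped s t̄
      π-s̄t̄ = swapped s̄ t̄
      Y = Bil.form s t
      choose : (Y ≤ + 4 * disc π-st) ⊎ (Y ≤ + 4 * disc π-s̄t) ⊎ (Y ≤ + 4 * disc π-st̄) ⊎ (Y ≤ + 4 * disc π-s̄t̄) →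
               ∃ λ π → Y ≤ + 4 * disc π
      choose (inj₁ y)               = π-st , y
      choose (inj₂ (inj₁ y))        = π-s̄t , y
      choose (inj₂ (inj₂ (inj₁ y))) = π-st̄ , y
      choose (inj₂ (inj₂ (inj₂ y))) = π-s̄t̄ , y

    conclude : ∀ α β → 0ℤ ≤ α → 0ℤ ≤ β → 1ℤ ≤ d → + 24 ≤ N - d → N * N ≤ β * M →
      N * N * (N * N) ≤ α * distinct-quads f →
      M * distinct-quads F ≤ N * N * (N * N) * sum (λ i → sum λ k → quad F₁ (corners i k)) →
      sum (λ i → sum λ k → quad F₁ (corners i k)) * distinct-quads f
        ≤ N * N * (N * N) * sum (λ i → sum λ k → quad F₁ (corners i k) * quad f₁ (corners i k)) →
      ∃ λ π → N * e ≤ + 4 * (α * β * (α * β)) * (+ 4 * + 768) * (disc π * disc π)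
    conclude α β 0≤α 0≤β 1≤d 24≤k N²≤ N⁴≤ first≤ second≤ =
      -- 768 = 6 · 128 turns the row bound 128 e / N into the condition 6 S ≤ l² of `signs`; the
      -- upper bound 4 · 768 e on N l² limits what is lost.
      with-root (root N (+ 768 * e) (0≤+n {n′}) (order-bound (+ 768) N d (+≤+ (s≤s z≤n)) 1≤d 1≤k)
                  (0≤* (0≤+n {768}) 0≤e) 0<N)
      where
      1≤k : 1ℤ ≤ N - d
      1≤k = ℤ.≤-trans (+≤+ (s≤s z≤n)) 24≤k
      0<d : 0ℤ < d
      0<d = ℤ.<-≤-trans (+<+ (s≤s z≤n)) 1≤d
      0<e : 0ℤ < e
      0<e = 0<product 0<d (ℤ.<-≤-trans (+<+ (s≤s z≤n)) 1≤k)
      0≤e = ℤ.<⇒≤ 0<e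
      0<N : 0ℤ < N
      0<N = subst (0ℤ <_) (cancel N d) (ℤ.+-mono-<-≤ 0<d (ℤ.≤-trans (0≤+n {1}) 1≤k))
        where
        cancel : ∀ N d → d + (N - d) ≡ N
        cancel = solve-∀
      C = sum λ i → sum λ k → quad F₁ (corners i k)
      2e≤ : + 2 * e ≤ α * β * T
      2e≤ = double-average-bound α β N M e (distinct-quads F) (distinct-quads f) C T 0<N 0≤α 0≤β
        (0≤* (0≤+n {m}) (0≤+n {m})) (sum-nonneg λ i → sum-nonneg λ k → quad≥0 F₁ (corners i k)) 0≤e N²≤ N⁴≤
        (RM.distinct-quads≥ (ℤ.<⇒≤ 0<d) 24≤k) first≤
        (subst (λ z → C * distinct-quads f ≤ N * N * (N * N) * z) T-quads second≤)

      with-copy : ∀ l → 0ℤ < l → N * (l * l) ≤ + 4 * (+ 768 * e) → ∀ s t → T ≤ l * Bil.form s t →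
        (∃ λ π → Bil.form s t ≤ + 4 * disc π) →
        ∃ λ π → N * e ≤ + 4 * (α * β * (α * β)) * (+ 4 * + 768) * (disc π * disc π)
      with-copy l 0<l ≤4κe s t T≤ (π , Y≤) = π , discrepancy-bound (α * β) (+ 4 * + 768) N e T l (Bil.form s t) (disc π)
        0<e (0≤* 0≤α 0≤β) (0≤+n {n′}) 0<l (disc≥0 π) 2e≤ T≤ Y≤
        (subst (N * (l * l) ≤_) (sym (ℤ.*-assoc (+ 4) (+ 768) e)) ≤4κe)

      with-signs : ∀ l → 0ℤ < l → N * (l * l) ≤ + 4 * (+ 768 * e) →
        (∃₂ λ s t → T ≤ l * Bil.form s t) →
        ∃ λ π → N * e ≤ + 4 * (α * β * (α * β)) * (+ 4 * + 768) * (disc π * disc π)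
      with-signs l 0<l ≤4κe (s , t , T≤) = with-copy l 0<l ≤4κe s t T≤ (form-disc s t)

      with-root : (∃ λ l → 0ℤ < l × + 768 * e ≤ N * (l * l) × N * (l * l) ≤ + 4 * (+ 768 * e)) →
        ∃ λ π → N * e ≤ + 4 * (α * β * (α * β)) * (+ 4 * + 768) * (disc π * disc π)
      with-root (l , 0<l , κe≤ , ≤4κe) = with-signs l 0<l ≤4κe
        (signs l a 0<l (λ i → scale-bound (+ 128) (+ 768) N (S i) e l refl 0<N (S-bound i) κe≤))

  large-alternation : ∀ α β → 0ℤ ≤ α → 0ℤ ≤ β → 1ℤ ≤ d → + 24 ≤ N - d → N * N ≤ β * M →
    N * N * (N * N) ≤ α * distinct-quads f →
    ∃ λ π → N * e ≤ + 4 * (α * β * (α * β)) * (+ 4 * + 768) * (disc π * disc π)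
  large-alternation α β 0≤α 0≤β 1≤d 24≤k N²≤ N⁴≤ = with-first first
    where
    with-second : ∀ π₁ →
      M * distinct-quads F ≤ N * N * (N * N) * sum (λ i → sum λ k → quad (relabel F π₁) (corners i k)) →
      (∃ λ π₂ → sum (λ i → sum λ k → quad (relabel F π₁) (corners i k)) * distinct-quads f
        ≤ N * N * (N * N) * sum (λ i → sum λ k → quad (relabel F π₁) (corners i k) * quad (relabel f π₂) (corners i k))) →
      ∃ λ π → N * e ≤ + 4 * (α * β * (α * β)) * (+ 4 * + 768) * (disc π * disc π)
    with-second π₁ h₁ (π₂ , h₂) = Relabelled.conclude π₁ π₂ α β 0≤α 0≤β 1≤d 24≤k N²≤ N⁴≤ h₁ h₂
    with-first : (∃ λ π₁ → M * distinct-quads F ≤ N * N * (N * N) * sum λ i → sum λ k → quad (relabel F π₁) (corners i k)) →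
      ∃ λ π → N * e ≤ + 4 * (α * β * (α * β)) * (+ 4 * + 768) * (disc π * disc π)
    with-first (π₁ , h₁) = with-second π₁ h₁ (second π₁)

-- The discrepancy bound over the integers

bit-idem : ∀ b → bit b * bit b ≡ bit b
bit-idem true  = refl
bit-idem false = refl

bit≥0 : ∀ b → 0ℤ ≤ bit b
bit≥0 true  = 0≤+n
bit≥0 false = 0≤+n

sum-bit : (g : Fin n → Bool) → sum (λ i → bit (g i)) ≡ + card (Vec.tabulate g)
sum-bit {zero}  g = refl
sum-bit {suc n} g with g zero
... | true  = cong (λ z → 1ℤ + z) (sum-bit (g ∘ suc))
... | false = trans (ℤ.+-identityˡ _) (sum-bit (g ∘ suc))

color-sign : (f : Coloring n) → ∀ v w →
  SignAt v w (color f v w) ⟦ color f v w ℤ.≟ 1ℤ ⟧ ⟦ color f v w ℤ.≟ - 1ℤ ⟧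
color-sign f v w = by-cases (v Fin.≟ w)
  where
  by-cases : Dec (v ≡ w) → SignAt v w (color f v w) ⟦ color f v w ℤ.≟ 1ℤ ⟧ ⟦ color f v w ℤ.≟ - 1ℤ ⟧
  by-cases (yes refl) = subst (λ a → SignAt v v a ⟦ a ℤ.≟ 1ℤ ⟧ ⟦ a ℤ.≟ - 1ℤ ⟧) (sym (color-diag f v)) (diagonal refl)
  by-cases (no v≢w) with color-±1 f v w v≢w
  ... | inj₁ e = subst (λ a → SignAt v w a ⟦ a ℤ.≟ 1ℤ ⟧ ⟦ a ℤ.≟ - 1ℤ ⟧) (sym e) (plus v≢w)
  ... | inj₂ e = subst (λ a → SignAt v w a ⟦ a ℤ.≟ 1ℤ ⟧ ⟦ a ℤ.≟ - 1ℤ ⟧) (sym e) (minus v≢w)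

sign-bounded : ∀ s {v w : Fin n} {a p q} → SignAt v w a p q → 0ℤ ≤ 1ℤ + sgn s * a
sign-bounded false (diagonal _) = 0≤+n
sign-bounded false (plus _)     = 0≤+n
sign-bounded false (minus _)    = 0≤+n
sign-bounded true  (diagonal _) = 0≤+n
sign-bounded true  (plus _)     = 0≤+n
sign-bounded true  (minus _)    = 0≤+n

∣∣-square : ∀ x → + ℤ.∣ x ∣ * + ℤ.∣ x ∣ ≡ x * x
∣∣-square (+ x)    = refl
∣∣-square -[1+ x ] = refl

quarter-bound : ∀ N μ → 0ℤ ≤ N → N * N * (N * N) ≤ + 4 * (μ * μ) → N * N ≤ + 2 * + ℤ.∣ μ ∣
quarter-bound N μ 0≤N le = square-≤⇒≤ (0≤* 0≤N 0≤N) (0≤* (0≤+n {2}) (0≤+n {ℤ.∣ μ ∣}))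
  (subst (N * N * (N * N) ≤_) (trans (cong (+ 4 *_) (sym (∣∣-square μ))) (identity (+ ℤ.∣ μ ∣))) le)
  where
  identity : ∀ a → + 4 * (a * a) ≡ + 2 * a * (+ 2 * a)
  identity = solve-∀

-- The mean case is stronger than necessary: it gives N d ≤ 8 x, while N d (N - d) ≤ (N d)² because
-- d is at least 1.
mean-to-square : ∀ B N d X x → + 8 ≤ B → 1ℤ ≤ d → 0ℤ ≤ N - d → 0ℤ ≤ x → N * d ≤ + 4 * X → X ≤ x + x →
  N * (d * (N - d)) ≤ B * x * (B * x)
mean-to-square B N d X x 8≤B 1≤d 0≤k 0≤x Nd≤ X≤ = ℤ.≤-trans
  (by-diff (subst (0ℤ ≤_) (identity₁ N d) (0≤* 0≤Nd (0≤+ (0≤* 0≤N (diff≥0 1≤d)) 0≤d))))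
  (*-mono 0≤Nd (ℤ.≤-trans 0≤Nd Nd≤Bx) Nd≤Bx Nd≤Bx)
  where
  0≤d = ℤ.≤-trans (0≤+n {1}) 1≤d
  0≤N : 0ℤ ≤ N
  0≤N = subst (0ℤ ≤_) (cancel N d) (0≤+ 0≤k 0≤d)
    where
    cancel : ∀ N d → N - d + d ≡ N
    cancel = solve-∀
  0≤Nd : 0ℤ ≤ N * d
  0≤Nd = 0≤* 0≤N 0≤d
  Nd≤Bx : N * d ≤ B * x
  Nd≤Bx = by-diff (subst (0ℤ ≤_) (identity B N d X x)
    (0≤+ (diff≥0 Nd≤) (0≤+ (0≤* (0≤+n {4}) (diff≥0 X≤)) (0≤* (diff≥0 8≤B) 0≤x))))
    where
    identity : ∀ B N d X x → (+ 4 * X - N * d) + (+ 4 * (x + x - X) + (B - + 8) * x) ≡ B * x - N * d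
    identity = solve-∀
  identity₁ : ∀ N d → N * d * (N * (d - 1ℤ) + d) ≡ N * d * (N * d) - N * (d * (N - d))
  identity₁ = solve-∀

alternation-to-square : ∀ B K x y → K ≤ B * B → 0ℤ ≤ x → y ≤ K * (x * x) → y ≤ B * x * (B * x)
alternation-to-square B K x y K≤ 0≤x y≤ = ℤ.≤-trans y≤ (by-diff (subst (0ℤ ≤_) (identity B K x)
  (0≤* (diff≥0 K≤) (0≤* 0≤x 0≤x))))
  where
  identity : ∀ B K x → (B * B - K) * (x * x) ≡ B * x * (B * x) - K * (x * x)
  identity = solve-∀

block-bound : ∀ N M → 0ℤ ≤ N → N ≤ + 8 * M → N * N ≤ + 64 * (M * M)
block-bound N M 0≤N N≤ = ℤ.≤-trans (*-mono 0≤N (ℤ.≤-trans 0≤N N≤) N≤ N≤) (ℤ.≤-reflexive (identity M))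
  where
  identity : ∀ M → + 8 * M * (+ 8 * M) ≡ + 64 * (M * M)
  identity = solve-∀

-- The squared form of √(n d (n - d)) ≤ B x. The thresholds are those of the dichotomy for the
-- colouring and of the count of distinct quadruples for F.
DiscrepancyBound : ℤ → ℕ → Set
DiscrepancyBound B n = ∀ d (F : Graph n) → Regular d F → + 6144 ≤ + n → 1ℤ ≤ + d → + 24 ≤ + n - + d →
  (f : Coloring n) → ∃ λ (F₀ : Copy F) → let x = + discrepancy f (graph F₀) in
    + n * (+ d * (+ n - + d)) ≤ B * x * (B * x)

module _ (B : ℤ) (8≤B : + 8 ≤ B)
  (K≤B² : + 4 * (+ 1024 * + 64 * (+ 1024 * + 64)) * (+ 4 * + 768) ≤ B * B) where

  discrepancy-size : ∀ m r → + size {m} {r} ≤ + 8 * + m → DiscrepancyBound B (size {m} {r})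
  discrepancy-size m r N≤8m d F regular 6144≤N 1≤d 24≤k f = by-dichotomy (Ch.dichotomy 6144≤N)
    where
    n′ = size {m} {r}
    N = + n′
    p q : Fin n′ → Fin n′ → ℤ
    p v w = ⟦ color f v w ℤ.≟ 1ℤ ⟧
    q v w = ⟦ color f v w ℤ.≟ - 1ℤ ⟧
    disc : Permutation′ n′ → ℤ
    disc π = + discrepancy f (graph (copy F π))
    row : ∀ v → sum (edge F v) ≡ + d
    row v = trans (sum-bit (adj F v)) (cong +_ (regular v))
    diag : ∀ v → edge F v v ≡ 0ℤ
    diag v = cong bit (adj-irrefl F v)
    module Ch = Cherries (color f) p q (color-sym f) (λ v w → cong (λ a → ⟦ a ℤ.≟ 1ℤ ⟧) (color-sym f v w)) (color-sign f)
    module LA = LargeAlternation {m} {r} (edge F) (color f) (+ d)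
      (λ v w → bit-idem (adj F v w)) (λ v w → cong bit (adj-sym F v w)) diag row
      (color-sym f) Ch.A.f²≤1 disc (λ π → 0≤+n) (weight≤disc f F) (-weight≤disc f F)
    Goal = ∃ λ (F₀ : Copy F) → let x = + discrepancy f (graph F₀) in
      N * (+ d * (N - + d)) ≤ B * x * (B * x)

    from-mean : ∀ s → (∃ λ π → N * + d ≤ + 4 * (sgn s * weight (edge F) (color f) π)) → Goal
    from-mean s (π , le) = copy F π , mean-to-square B N (+ d) (sgn s * weight (edge F) (color f) π) (disc π)
        8≤B 1≤d (ℤ.≤-trans (0≤+n {24}) 24≤k) 0≤+n le (signed s)
      where
      signed : ∀ s → sgn s * weight (edge F) (color f) π ≤ disc π + disc π
      signed false = ℤ.≤-trans (ℤ.≤-reflexive (ℤ.*-identityˡ (weight (edge F) (color f) π))) (weight≤disc f F π)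
      signed true  = ℤ.≤-trans (ℤ.≤-reflexive (ℤ.-1*i≡-i (weight (edge F) (color f) π))) (-weight≤disc f F π)

    from-sign : N * N * (N * N) ≤ + 4 * (Ch.A.total-sign * Ch.A.total-sign) →
                (∃ λ s → sgn s * Ch.A.total-sign ≡ + ℤ.∣ Ch.A.total-sign ∣) → Goal
    from-sign le (s , e) = from-mean s
      (LargeMean.large-mean (edge F) (+ d) (λ v w → bit≥0 (adj F v w)) diag row (color f) (color-diag f) s
        (λ v w → sign-bounded s (color-sign f v w))
        (ℤ.≤-trans (+≤+ (ℕ.≤ᵇ⇒≤ 4 6144 _)) 6144≤N) (ℤ.≤-trans (0≤+n {1}) 1≤d)
        (subst (λ z → N * N ≤ + 2 * z) (sym e) (quarter-bound N Ch.A.total-sign 0≤+n le)))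

    from-alternation : (∃ λ π → N * (+ d * (N - + d))
        ≤ + 4 * (+ 1024 * + 64 * (+ 1024 * + 64)) * (+ 4 * + 768) * (disc π * disc π)) → Goal
    from-alternation (π , le) = copy F π , alternation-to-square B
      (+ 4 * (+ 1024 * + 64 * (+ 1024 * + 64)) * (+ 4 * + 768)) (disc π) (N * (+ d * (N - + d))) K≤B² 0≤+n le

    by-dichotomy : (N * N * (N * N) ≤ + 4 * (Ch.A.total-sign * Ch.A.total-sign))
      ⊎ (N * N * (N * N) ≤ + 1024 * distinct-quads (color f)) → Goal
    by-dichotomy (inj₁ le) = from-sign le (∣∣-sgn Ch.A.total-sign)
    -- 1024 is the density constant from the dichotomy, and 64 = 8² comes from N ≤ 8 m.
    by-dichotomy (inj₂ le) = from-alternation (LA.large-alternation (+ 1024) (+ 64) 0≤+n 0≤+n 1≤d 24≤k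
      (block-bound N (+ m) 0≤+n N≤8m) le)

  discrepancy-bound-ℤ : ∀ n → DiscrepancyBound B n
  discrepancy-bound-ℤ n d F regular 6144≤n = subst (DiscrepancyBound B) (sym n≡) (discrepancy-size h r size≤) d F regular 6144≤n
    where
    h = n ℕ./ 4
    r = n ℕ.% 4
    n≡ : n ≡ size {h} {r}
    n≡ = trans (ℕ.m≡m%n+[m/n]*n n 4) (regroup h r)
      where
      open ℕ.+-*-Solver
      regroup : ∀ m r → r ℕ.+ m ℕ.* 4 ≡ m ℕ.+ (m ℕ.+ (m ℕ.+ (m ℕ.+ r)))
      regroup = solve 2 (λ m r → r :+ m :* con 4 := m :+ (m :+ (m :+ (m :+ r)))) refl
    1≤m : 1 ℕ.≤ h
    1≤m = ℕ.m≥n⇒m/n>0 {n} {4} (ℕ.≤-trans (ℕ.≤ᵇ⇒≤ 4 6144 _) (ℤ.drop‿+≤+ 6144≤n))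
    -- The remainder is below 4, hence at most 4 h as h is positive; the pairs thus cover at least
    -- half of the vertices.
    r≤4m : r ℕ.≤ 4 ℕ.* h
    r≤4m = ℕ.≤-trans (ℕ.<⇒≤ (ℕ.m%n<n n 4)) (ℕ.*-monoʳ-≤ 4 1≤m)
    size≤ : + size {h} {r} ≤ + 8 * + h
    size≤ = subst (+ size {h} {r} ≤_) (ℤ.pos-* 8 h) (+≤+ (ℕ.≤-trans
      (ℕ.+-monoʳ-≤ h (ℕ.+-monoʳ-≤ h (ℕ.+-monoʳ-≤ h (ℕ.+-monoʳ-≤ h r≤4m)))) (ℕ.≤-reflexive (eight h))))
      where
      open ℕ.+-*-Solver
      eight : ∀ m → m ℕ.+ (m ℕ.+ (m ℕ.+ (m ℕ.+ 4 ℕ.* m))) ≡ 8 ℕ.* m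
      eight = solve 1 (λ m → m :+ (m :+ (m :+ (m :+ con 4 :* m))) := con 8 :* m) refl

-- Passage to the reals

ι : ℤ → ℚ
ι z = z ℚ./ 1

ι-toℚᵘ : ∀ z → ℚ.toℚᵘ (ι z) ℚᵘ.≃ ℚᵘ.mkℚᵘ z 0
ι-toℚᵘ z = ℚ.toℚᵘ-fromℚᵘ (ℚᵘ.mkℚᵘ z 0)

ι-+ : ∀ a b → ι (a + b) ≡ ι a ℚ.+ ι b
ι-+ a b = ℚ.toℚᵘ-injective (begin
  ℚ.toℚᵘ (ι (a + b))                   ≈⟨ ι-toℚᵘ (a + b) ⟩
  ℚᵘ.mkℚᵘ (a + b) 0                    ≈⟨ ℚᵘ.*≡* (identity a b) ⟩
  ℚᵘ.mkℚᵘ a 0 ℚᵘ.+ ℚᵘ.mkℚᵘ b 0         ≈⟨ ℚᵘ.≃-sym (ℚᵘ.+-cong (ι-toℚᵘ a) (ι-toℚᵘ b)) ⟩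
  ℚ.toℚᵘ (ι a) ℚᵘ.+ ℚ.toℚᵘ (ι b)       ≈⟨ ℚᵘ.≃-sym (ℚ.toℚᵘ-homo-+ (ι a) (ι b)) ⟩
  ℚ.toℚᵘ (ι a ℚ.+ ι b)                 ∎)
  where
  open ℚᵘ.≃-Reasoning
  identity : ∀ a b → (a + b) * + 1 ≡ (a * + 1 + b * + 1) * + 1
  identity = solve-∀

ι-* : ∀ a b → ι (a * b) ≡ ι a ℚ.* ι b
ι-* a b = ℚ.toℚᵘ-injective (begin
  ℚ.toℚᵘ (ι (a * b))                   ≈⟨ ι-toℚᵘ (a * b) ⟩
  ℚᵘ.mkℚᵘ a 0 ℚᵘ.* ℚᵘ.mkℚᵘ b 0         ≈⟨ ℚᵘ.≃-sym (ℚᵘ.*-cong (ι-toℚᵘ a) (ι-toℚᵘ b)) ⟩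
  ℚ.toℚᵘ (ι a) ℚᵘ.* ℚ.toℚᵘ (ι b)       ≈⟨ ℚᵘ.≃-sym (ℚ.toℚᵘ-homo-* (ι a) (ι b)) ⟩
  ℚ.toℚᵘ (ι a ℚ.* ι b)                 ∎)
  where open ℚᵘ.≃-Reasoning

ι-neg : ∀ a → ι (- a) ≡ ℚ.- ι a
ι-neg a = ℚ.toℚᵘ-injective (begin
  ℚ.toℚᵘ (ι (- a))       ≈⟨ ι-toℚᵘ (- a) ⟩
  ℚᵘ.- ℚᵘ.mkℚᵘ a 0       ≈⟨ ℚᵘ.≃-sym (ℚᵘ.-‿cong (ι-toℚᵘ a)) ⟩
  ℚᵘ.- ℚ.toℚᵘ (ι a)      ≈⟨ ℚᵘ.≃-sym (ℚ.toℚᵘ-homo‿- (ι a)) ⟩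
  ℚ.toℚᵘ (ℚ.- ι a)       ∎)
  where open ℚᵘ.≃-Reasoning

ι-minus : ∀ a b → ι (a - b) ≡ ι a ℚ.- ι b
ι-minus a b = trans (ι-+ a (- b)) (cong (λ z → ι a ℚ.+ z) (ι-neg b))

ι-mono-≤ : ∀ {a b} → a ≤ b → ι a ℚ.≤ ι b
ι-mono-≤ {a} {b} a≤b = ℚ.toℚᵘ-cancel-≤ (ℚᵘ.≤-respˡ-≃ (ℚᵘ.≃-sym (ι-toℚᵘ a)) (ℚᵘ.≤-respʳ-≃ (ℚᵘ.≃-sym (ι-toℚᵘ b))
  (ℚᵘ.*≤* (subst₂ _≤_ (sym (ℤ.*-identityʳ a)) (sym (ℤ.*-identityʳ b)) a≤b))))

ι-cancel-≤ : ∀ {a b} → ι a ℚ.≤ ι b → a ≤ b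
ι-cancel-≤ {a} {b} le = subst₂ _≤_ (ℤ.*-identityʳ a) (ℤ.*-identityʳ b)
  (ℚᵘ.drop-*≤* (ℚᵘ.≤-respˡ-≃ (ι-toℚᵘ a) (ℚᵘ.≤-respʳ-≃ (ι-toℚᵘ b) (ℚ.toℚᵘ-mono-≤ le))))

ι-mono-< : ∀ {a b} → a < b → ι a ℚ.< ι b
ι-mono-< {a} {b} a<b = ℚ.≰⇒> λ le → ℤ.<-irrefl refl (ℤ.<-≤-trans a<b (ι-cancel-≤ le))

times-ι : ∀ k h → RationalLemmas.times k h ≡ ι (+ k) ℚ.* h
times-ι zero    h = sym (ℚ.*-zeroˡ h)
times-ι (suc k) h = trans (cong (λ z → h ℚ.+ z) (times-ι k h))
  (trans (identity (ι (+ k)) h) (cong (ℚ._* h) (sym (ι-+ 1ℤ (+ k)))))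
  where
  open ℚ.+-*-Solver
  identity : ∀ a h → h ℚ.+ a ℚ.* h ≡ (1ℚ ℚ.+ a) ℚ.* h
  identity = solve 2 (λ a h → h :+ a :* h := (con 1ℚ :+ a) :* h) refl

*ℚ-monoˡ : ∀ {a b c} → 0ℚ ℚ.≤ c → a ℚ.≤ b → c ℚ.* a ℚ.≤ c ℚ.* b
*ℚ-monoˡ {c = c} 0≤c = ℚ.*-monoˡ-≤-nonNeg c {{ℚ.nonNegative 0≤c}}

*ℚ-monoʳ : ∀ {a b c} → 0ℚ ℚ.≤ c → a ℚ.≤ b → a ℚ.* c ℚ.≤ b ℚ.* c
*ℚ-monoʳ {c = c} 0≤c = ℚ.*-monoʳ-≤-nonNeg c {{ℚ.nonNegative 0≤c}}

square-cancel-≤ : ∀ {a b} → 0ℚ ℚ.≤ b → a ℚ.* a ℚ.≤ b ℚ.* b → a ℚ.≤ b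
square-cancel-≤ 0≤b aa≤bb = ℚ.≮⇒≥ λ b<a →
  ℚ.<-irrefl refl (ℚ.<-≤-trans (RationalLemmas.square-mono-< 0≤b b<a) aa≤bb)

-- The box witnessing the product contains the point (a, s), and a bound valid at the corners holds
-- there; so the rational factor can be replaced by its value.
lower-*-rational : ∀ x s {q} → lower (x *ᴿ fromℚ s) q → ∃ λ a → lower x a × q ℚ.< a ℚ.* s
lower-*-rational x s (a , b , c , d , a∈ , b∈ , c<s , s<d , ac , ad , bc , bd) = a , a∈ ,
  ProductLemmas.box-lower ℚ.≤-refl (ℚ.<⇒≤ (CutLemmas.lower<upper x a∈ b∈)) (ℚ.<⇒≤ c<s) (ℚ.<⇒≤ s<d) ac ad bc bd

lower-rational-* : ∀ s y {q} → lower (fromℚ s *ᴿ y) q → ∃ λ c → lower y c × q ℚ.< s ℚ.* c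
lower-rational-* s y (a , b , c , d , a<s , s<b , c∈ , d∈ , ac , ad , bc , bd) = c , c∈ ,
  ProductLemmas.box-lower (ℚ.<⇒≤ a<s) (ℚ.<⇒≤ s<b) ℚ.≤-refl (ℚ.<⇒≤ (CutLemmas.lower<upper y c∈ d∈)) ac ad bc bd

-- Otherwise a rational q strictly between (1 - e) n and d would lie below (1 - ε) n, although every
-- rational below 1 - ε is less than 1 - e.
degree-bound : ∀ ε n d → fromℕ d ≤ᴿ (1ᴿ -ᴿ ε) *ᴿ fromℕ n → ∀ {e} → lower ε e →
               ι (+ d) ℚ.≤ (1ℚ ℚ.- e) ℚ.* ι (+ n)
degree-bound ε n d d≤ {e} e∈ = ℚ.≮⇒≥ λ lt →
  let q , lt-q , q<d = ℚ.<-dense lt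
  in contradiction q lt-q (lower-*-rational (1ᴿ -ᴿ ε) (ι (+ n)) (d≤ q q<d))
  where
  contradiction : ∀ q → (1ℚ ℚ.- e) ℚ.* ι (+ n) ℚ.< q →
    ¬ (∃ λ a → lower (1ᴿ -ᴿ ε) a × q ℚ.< a ℚ.* ι (+ n))
  contradiction q lt-q (a , (a′ , d′ , a′<1 , d′∈ , a<) , q<an) =
    ℚ.<-asym (ℚ.<-≤-trans q<an (*ℚ-monoʳ (ι-mono-≤ (0≤+n {n})) a≤)) lt-q
    where
    a≤ : a ℚ.≤ 1ℚ ℚ.- e
    a≤ = ℚ.<⇒≤ (ℚ.<-trans a< (ℚ.+-mono-< a′<1 (ℚ.neg-antimono-< (CutLemmas.lower<upper ε e∈ d′∈))))

-- As d ≤ (1 - a) n means a n ≤ n - d, one has (r n)² ≤ a d n² ≤ n d (n - d) ≤ y².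
root-bound : ∀ a r n d y → 0ℚ ℚ.≤ n → 0ℚ ℚ.≤ d → 0ℚ ℚ.≤ y → d ℚ.≤ (1ℚ ℚ.- a) ℚ.* n → r ℚ.* r ℚ.≤ a ℚ.* d →
  n ℚ.* (d ℚ.* (n ℚ.- d)) ℚ.≤ y ℚ.* y → r ℚ.* n ℚ.≤ y
root-bound a r n d y 0≤n 0≤d 0≤y d≤ rr≤ H = square-cancel-≤ 0≤y (ℚ.≤-trans
  (RationalLemmas.0≤q-p⁻¹ (subst (0ℚ ℚ.≤_) (identity a r n d)
    (RationalLemmas.0≤+ (RationalLemmas.0≤* (RationalLemmas.0≤* 0≤n 0≤n) (RationalLemmas.0≤q-p rr≤))
                        (RationalLemmas.0≤* (RationalLemmas.0≤* 0≤n 0≤d) (RationalLemmas.0≤q-p d≤))))) H)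
  where
  open ℚ.+-*-Solver
  identity : ∀ a r n d → n ℚ.* n ℚ.* (a ℚ.* d ℚ.- r ℚ.* r) ℚ.+ n ℚ.* d ℚ.* ((1ℚ ℚ.- a) ℚ.* n ℚ.- d)
             ≡ n ℚ.* (d ℚ.* (n ℚ.- d)) ℚ.- r ℚ.* n ℚ.* (r ℚ.* n)
  identity = solve 4 (λ a r n d → n :* n :* (a :* d :- r :* r) :+ n :* d :* ((con 1ℚ :- a) :* n :- d)
    := n :* (d :* (n :- d)) :- r :* n :* (r :* n)) refl

module RealBound (B : ℤ) (0<B : 0ℤ < B) where

  0<ιB : 0ℚ ℚ.< ι B
  0<ιB = ι-mono-< 0<B

  c₀ : ℚ
  c₀ = (ℚ.1/ ι B) {{ℚ.>-nonZero 0<ιB}}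

  0<c₀ : 0ℚ ℚ.< c₀
  0<c₀ = ℚ.positive⁻¹ c₀ {{ℚ.1/pos⇒pos (ι B) {{ℚ.positive 0<ιB}}}}

  B*c₀ : ι B ℚ.* c₀ ≡ 1ℚ
  B*c₀ = ℚ.*-inverseʳ (ι B) {{ℚ.>-nonZero 0<ιB}}

  c : ℝ
  c = fromℚ c₀

  0<c : 0ᴿ <ᴿ c
  0<c = ℚ.<-dense 0<c₀

  real-bound : ∀ ε n d x → fromℕ d ≤ᴿ (1ᴿ -ᴿ ε) *ᴿ fromℕ n →
    + n * (+ d * (+ n - + d)) ≤ B * + x * (B * + x) →
    c *ᴿ √ (ε *ᴿ fromℕ d) *ᴿ fromℕ n ≤ᴿ fromℕ x
  real-bound ε n d x d≤ H q q∈ = unpack (lower-*-rational (c *ᴿ √ (ε *ᴿ fromℕ d)) N q∈)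
    where
    N = ι (+ n)
    X = ι (+ x)
    Dℚ = ι (+ d)
    0≤N : 0ℚ ℚ.≤ N
    0≤N = ι-mono-≤ (0≤+n {n})
    0≤X : 0ℚ ℚ.≤ X
    0≤X = ι-mono-≤ (0≤+n {x})
    0≤c₀ = ℚ.<⇒≤ 0<c₀
    Y = ι B ℚ.* X
    H′ : N ℚ.* (Dℚ ℚ.* (N ℚ.- Dℚ)) ℚ.≤ Y ℚ.* Y
    H′ = subst₂ ℚ._≤_
      (trans (ι-* (+ n) (+ d * (+ n - + d))) (cong (λ z → N ℚ.* z)
        (trans (ι-* (+ d) (+ n - + d)) (cong (λ z → Dℚ ℚ.* z) (ι-minus (+ n) (+ d))))))
      (trans (ι-* (B * + x) (B * + x)) (cong₂ ℚ._*_ (ι-* B (+ x)) (ι-* B (+ x))))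
      (ι-mono-≤ H)

    scale : ∀ {p s r} → q ℚ.< p ℚ.* N → p ℚ.< c₀ ℚ.* s → s ℚ.< r → r ℚ.* N ℚ.≤ Y → q ℚ.< X
    scale {p} {s} {r} q<pN p<cs s<r rN≤Y = ℚ.<-≤-trans q<pN (ℚ.≤-trans
      (*ℚ-monoʳ 0≤N (ℚ.≤-trans (ℚ.<⇒≤ p<cs) (*ℚ-monoˡ 0≤c₀ (ℚ.<⇒≤ s<r))))
      (ℚ.≤-trans (ℚ.≤-reflexive (ℚ.*-assoc c₀ r N)) (ℚ.≤-trans (*ℚ-monoˡ 0≤c₀ rN≤Y)
        (ℚ.≤-reflexive (trans (identity c₀ (ι B) X) (trans (cong (ℚ._* X) B*c₀) (ℚ.*-identityˡ X)))))))
      where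
      open ℚ.+-*-Solver
      identity : ∀ c b x → c ℚ.* (b ℚ.* x) ≡ b ℚ.* c ℚ.* x
      identity = solve 3 (λ c b x → c :* (b :* x) := b :* c :* x) refl

    at-root : ∀ {r} → lower (ε *ᴿ fromℕ d) (r ℚ.* r) → r ℚ.* N ℚ.≤ Y
    at-root {r} rr∈ =
      let a , a∈ , rr<ad = lower-*-rational ε Dℚ rr∈
      in root-bound a r N Dℚ Y 0≤N (ι-mono-≤ (0≤+n {d})) (RationalLemmas.0≤* (ℚ.<⇒≤ 0<ιB) 0≤X)
           (degree-bound ε n d d≤ a∈) (ℚ.<⇒≤ rr<ad) H′

    -- The lower cut of `√` contains the negative rationals by definition, with a witness r ≤ 0 that
    -- carries no information about ε d.
    nonpositive : ∀ {r} → r ℚ.≤ 0ℚ → r ℚ.* N ℚ.≤ Y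
    nonpositive r≤0 = ℚ.≤-trans (*ℚ-monoʳ 0≤N r≤0)
      (ℚ.≤-trans (ℚ.≤-reflexive (ℚ.*-zeroˡ N)) (RationalLemmas.0≤* (ℚ.<⇒≤ 0<ιB) 0≤X))

    unpack : (∃ λ p → lower (c *ᴿ √ (ε *ᴿ fromℕ d)) p × q ℚ.< p ℚ.* N) → q ℚ.< X
    unpack (p , p∈ , q<pN) with lower-rational-* c₀ (√ (ε *ᴿ fromℕ d)) p∈
    ... | s , (r , s<r , inj₁ r≤0) , p<cs = scale q<pN p<cs s<r (nonpositive r≤0)
    ... | s , (r , s<r , inj₂ rr∈) , p<cs = scale q<pN p<cs s<r (at-root {r} rr∈)

-- For a rational e between 0 and ε, n - d ≥ n e ≥ k e ≥ 24. This is how the size of n comes to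
-- depend on ε.
codegree-bound : ∀ ε n d {e} k → fromℕ d ≤ᴿ (1ᴿ -ᴿ ε) *ᴿ fromℕ n → lower ε e → 0ℚ ℚ.< e →
  ι (+ 24) ℚ.≤ RationalLemmas.times k e → k ℕ.≤ n → + 24 ≤ + n - + d
codegree-bound ε n d {e} k d≤ e∈ 0<e 24≤ k≤n = ι-cancel-≤ (subst (ι (+ 24) ℚ.≤_) (sym (ι-minus (+ n) (+ d)))
  (ℚ.≤-trans 24≤ (ℚ.≤-trans (ℚ.≤-reflexive (times-ι k e))
    (ℚ.≤-trans (*ℚ-monoʳ (ℚ.<⇒≤ 0<e) (ι-mono-≤ (+≤+ k≤n)))
      (RationalLemmas.0≤q-p⁻¹ (subst (0ℚ ℚ.≤_) (identity e (ι (+ n)) (ι (+ d)))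
        (RationalLemmas.0≤q-p (degree-bound ε n d d≤ e∈))))))))
  where
  open ℚ.+-*-Solver
  identity : ∀ e n d → (1ℚ ℚ.- e) ℚ.* n ℚ.- d ≡ n ℚ.- d ℚ.- n ℚ.* e
  identity = solve 3 (λ e n d → (con 1ℚ :- e) :* n :- d := n :- d :- n :* e) refl

theorem1p2 : ∃ λ (c : ℝ) → 0ᴿ <ᴿ c ×
    (∀ (ε : ℝ) → 0ᴿ <ᴿ ε →
    ∃ λ (n₀ : ℕ) →
    ∀ (n : ℕ) → n ≥ n₀ →
    ∀ (d : ℕ) (F : Graph n) → Regular d F →
    fromℕ d ≤ᴿ (1ᴿ -ᴿ ε) *ᴿ fromℕ n →
    ∀ (f : Coloring n) →
    ∃ λ (F₀ : Copy F) →
    c *ᴿ √ (ε *ᴿ fromℕ d) *ᴿ fromℕ n ≤ᴿ fromℕ (discrepancy f (graph F₀)))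
theorem1p2 = c , 0<c , λ ε (e , 0<e , e∈) →
  let k , 24≤ = RationalLemmas.archimedean (ι (+ 24)) 0<e
  -- 6144 serves the dichotomy for the colouring; `k` makes the codegree n - d at least 24.
  in 6144 ℕ.⊔ k , λ n n≥n₀ d F regular d≤ f →
    let F₀ , H = combinatorial n d F regular (+≤+ (ℕ.≤-trans (ℕ.m≤m⊔n 6144 k) n≥n₀))
                   (codegree-bound ε n d k d≤ e∈ 0<e 24≤ (ℕ.≤-trans (ℕ.m≤n⊔m 6144 k) n≥n₀)) f
    in F₀ , real-bound ε n d (discrepancy f (graph F₀)) d≤ H
  where
  -- This is 2²³, the least power of two whose square is at least 4 (1024 · 64)² · 4 · 768 = 3 ·
  -- 2⁴⁴.
  B = + 8388608
  open RealBound B (+<+ (s≤s z≤n))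
  combinatorial : ∀ n d (F : Graph n) → Regular d F → + 6144 ≤ + n → + 24 ≤ + n - + d →
    (f : Coloring n) → ∃ λ (F₀ : Copy F) → let x = + discrepancy f (graph F₀) in
      + n * (+ d * (+ n - + d)) ≤ B * x * (B * x)
  -- For d = 0 the left side vanishes and any copy will do; the main argument needs d at least 1.
  combinatorial n zero F _ _ _ f = copy F Perm.id ,
    ℤ.≤-trans (ℤ.≤-reflexive (ℤ.*-zeroʳ (+ n))) (0≤square (B * + discrepancy f (graph (copy F Perm.id))))
  -- The two large numbers are 4 (1024 · 64)² · 4 · 768 and B² = 2⁴⁶.
  combinatorial n (suc d) F regular 6144≤n 24≤k f =
    discrepancy-bound-ℤ B (+≤+ (ℕ.≤ᵇ⇒≤ 8 8388608 _)) (+≤+ (ℕ.≤ᵇ⇒≤ 52776558133248 70368744177664 _))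
      n (suc d) F regular 6144≤n (+≤+ (s≤s z≤n)) 24≤k f
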